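{- Given an $n$-vertex weighted undirected graph $G=(V,E)$, the hopsets provided by the known algorithms of Elkin–Neiman and Huang–Pettie (whose guarantees are recalled in the context) can be converted into the following subgraphs of $G$: (1) A $(1+\epsilon,\;O(k/\epsilon)^k\cdot W_{\max}\cdot\log n)$-spanner $G'\subseteq G$ with $\widehat{O}\left(n^{1+1/(2^{k+1}-1)}\right)$ edges, where $W_{\max}$ is the largest edge weight. (2) For every integer $k$ and every $S\subseteq V$, an $S$-sourcewise $(4k-1+\epsilon)$-spanner $G'\subseteq G$ with $\widehat{O}\left(n+|S|^{1+1/k}\right)$ edges. (3) For any $\epsilon\in(0,1)$ and integer $k\ge1$, an $\epsilon$-slack $(12k-1+o(1))$-spanner $G'\subseteq G$ with $\widehat{O}\left(n+(1/\epsilon)^{1+1/k}\right)$ edges.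
   Context: Edge weights are polynomial in $n$. $\widehat{O}(\cdot)$ hides $n^{o(1)}$ factors and $\widetilde{O}(\cdot)$ hides $\mathrm{poly}(\log n)$ factors. $\mathrm{dist}^{(\beta)}_{G'}(u,v)$ is the minimum length of a $u$-$v$ path in $G'$ with at most $\beta$ edges. A $(\beta,\epsilon)$-hopset for $G$ is a set $H\subseteq V\times V$ of edges, each weighted by the $G$-distance between its endpoints, such that $\mathrm{dist}_G(u,v)\le\mathrm{dist}^{(\beta)}_{G\cup H}(u,v)\le(1+\epsilon)\,\mathrm{dist}_G(u,v)$ for all $u,v\in V$. Hopsets of Elkin–Neiman and Huang–Pettie: for any weighted undirected $n$-vertex graph and any integer $k\ge1$ there is a $(\beta,\epsilon)$-hopset, for any $0<\epsilon<1$, with $\beta=O(k/\epsilon)^k$ and $O(n^{1+1/(2^{k+1}-1)})$ edges. In (1), $k$ and $\epsilon$ are the hopset parameters; the more precise form of (1) is: for $k\in\{1,\ldots,\log\log n\}$, with $\beta=O(k/\epsilon)^k$, one can compute from these hopsets (and sublinear-size versions of them) a $(1+\epsilon',\beta')$-spanner with $\epsilon'=O(\epsilon\cdot2^k\cdot(\log\log n-k))$, $\beta'=O(\beta\cdot2^k\cdot W_{\max})$ and $\widetilde{O}(n^{1+1/(2^{k+1}-1)}\cdot(ck/\epsilon)^{2k})$ edges, for some constant $c>1$. An $(\alpha,\beta)$-spanner of $G$ is a subgraph $G'\subseteq G$ with $\mathrm{dist}_{G'}(u,v)\le\alpha\cdot\mathrm{dist}_G(u,v)+\beta$ for all $u,v\in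 V$. An $S$-sourcewise $t$-spanner is a subgraph $G'\subseteq G$ with $\mathrm{dist}_{G'}(s,v)\le t\cdot\mathrm{dist}_G(s,v)$ for all $(s,v)\in S\times V$. An $\epsilon$-slack $t$-spanner is a subgraph $G'\subseteq G$ such that for each vertex $v\in V$, the farthest $(1-\epsilon)n$ vertices $w$ from $v$ satisfy $\mathrm{dist}_{G'}(v,w)\le t\cdot\mathrm{dist}_G(v,w)$.
   Formalization: Edge weights and the parameters ε (stretch and slack) are rational numbers instead of reals; in (1) the hidden n^{o(1)} factor is for fixed k and ε. -}

module Defs where

open import Data.Bool.Base using (if_then_else_)
open import Data.Fin.Base using (Fin)
open import Data.Fin.Properties using (_<?_)
open import Data.Fin.Subset using (Subset; _∈_; _∉_; ∣_∣)
open import Data.Integer.Base using (+_)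
open import Data.List.Base using (List; foldr; length; mapMaybe; cartesianProduct; allFin)
open import Data.Maybe.Base using (Maybe; just; nothing)
open import Data.Nat.Base as ℕ using (ℕ; zero; suc)
open import Data.Product.Base using (∃; ∃-syntax; _×_; _,_)
open import Data.Rational.Base as ℚ using (ℚ; 0ℚ; 1ℚ; Positive; _+_; _*_; _-_; _÷_; _⊔_; _≤_; _<_)
open import Data.Rational.Literals using (fromℤ)
open import Data.Rational.Properties using (pos⇒nonZero)
open import Level using (0ℓ)
open import Relation.Binary.Construct.Closure.ReflexiveTransitive using (Star; ε; _◅_)
open import Relation.Binary.Construct.Union using (_∪_)
open import Relation.Binary.PropositionalEquality using (_≡_)
open import Relation.Nullary.Decidable using (does)

open import Algebra.Definitions.RawSemiring ℚ.+-*-rawSemiring public using (_^_)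

fromℕ : ℕ → ℚ
fromℕ n = fromℤ (+ n)

------------------------------------------------------------------------
-- Weighted undirected graphs and distances

record Graph (n : ℕ) : Set where
  field
    weight   : Fin n → Fin n → Maybe ℚ
    sym      : ∀ u v → weight u v ≡ weight v u
    loopless : ∀ v → weight v v ≡ nothing
    positive : ∀ {u v w} → weight u v ≡ just w → 0ℚ < w

open Graph public using (weight)

-- R u v w says that there is an edge of weight w from u to v.
WeightedEdges : ℕ → Set₁
WeightedEdges n = Fin n → Fin n → ℚ → Set

Edge : ∀ {n} → Graph n → WeightedEdges n
Edge G u v w = weight G u v ≡ just w

-- In G ∪ᴱ H an edge may be taken from either graph, so parallel edges of
-- different weights are both available.
_∪ᴱ_ : ∀ {n} → Graph n → Graph n → WeightedEdges n
(G ∪ᴱ H) u = Edge G u ∪ Edge H u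

_⊆ᴳ_ : ∀ {n} → Graph n → Graph n → Set
G′ ⊆ᴳ G = ∀ {u v w} → Edge G′ u v w → Edge G u v w

-- The weights of the edges {u , v}, each undirected edge listed once.
edgeWeights : ∀ {n} → Graph n → List ℚ
edgeWeights {n} G = mapMaybe
  (λ (u , v) → if does (u <? v) then weight G u v else nothing)
  (cartesianProduct (allFin n) (allFin n))

#edges : ∀ {n} → Graph n → ℕ
#edges G = length (edgeWeights G)

W-max : ∀ {n} → Graph n → ℚ
W-max G = foldr _⊔_ 0ℚ (edgeWeights G)

PolynomialWeights : ℕ → ∀ {n} → Graph n → Set
PolynomialWeights c {n} G = ∀ {u v w} → Edge G u v w → w ≤ fromℕ (n ℕ.^ c)

-- Paths may repeat vertices; as all weights are positive this changes
-- neither distances nor hop-bounded distances.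
Path : ∀ {n} → WeightedEdges n → Fin n → Fin n → Set
Path R = Star (λ u v → ∃ (R u v))

module _ {n} {R : WeightedEdges n} where

  pathLength : ∀ {u v} → Path R u v → ℚ
  pathLength ε             = 0ℚ
  pathLength ((w , _) ◅ p) = w + pathLength p

  hops : ∀ {u v} → Path R u v → ℕ
  hops ε       = zero
  hops (_ ◅ p) = suc (hops p)

-- Distances are relations, since dist(u,v) = ∞ is possible: it is the case
-- in which no d satisfies IsDist R u v d.
IsDist : ∀ {n} → WeightedEdges n → Fin n → Fin n → ℚ → Set
IsDist R u v d =
  (∃[ p ] pathLength {R = R} {u} {v} p ≡ d) ×
  (∀ (p : Path R u v) → d ≤ pathLength p)

IsHopDist : ∀ {n} → ℕ → WeightedEdges n → Fin n → Fin n → ℚ → Set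
IsHopDist β R u v d =
  (∃[ p ] hops {R = R} {u} {v} p ℕ.≤ β × pathLength p ≡ d) ×
  (∀ (p : Path R u v) → hops p ℕ.≤ β → d ≤ pathLength p)

-- dist_{G′}(u,v) ≤ f (dist_G(x,y)), where f ∞ = ∞.
dist⟨_,_,_⟩≤_⟨dist⟨_,_,_⟩⟩ : ∀ {n} → Graph n → Fin n → Fin n → (ℚ → ℚ) →
                             Graph n → Fin n → Fin n → Set
dist⟨ G′ , u , v ⟩≤ f ⟨dist⟨ G , x , y ⟩⟩ =
  ∀ d → IsDist (Edge G) x y d → ∃[ d′ ] IsDist (Edge G′) u v d′ × d′ ≤ f d

------------------------------------------------------------------------
-- Spanners

IsSpanner : ∀ {n} → ℚ → ℚ → Graph n → Graph n → Set
IsSpanner α β G G′ = G′ ⊆ᴳ G ×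
  (∀ u v → dist⟨ G′ , u , v ⟩≤ (λ d → α * d + β) ⟨dist⟨ G , u , v ⟩⟩)

IsSourcewiseSpanner : ∀ {n} → Subset n → ℚ → Graph n → Graph n → Set
IsSourcewiseSpanner S t G G′ = G′ ⊆ᴳ G ×
  (∀ s v → s ∈ S → dist⟨ G′ , s , v ⟩≤ (t *_) ⟨dist⟨ G , s , v ⟩⟩)

-- F consists of the ∣F∣ vertices farthest from v, for some resolution of ties.
IsFarthest : ∀ {n} → Graph n → Fin n → Subset n → Set
IsFarthest G v F = ∀ {w x} → w ∈ F → x ∉ F →
  dist⟨ G , v , x ⟩≤ (λ d → d) ⟨dist⟨ G , v , w ⟩⟩

-- Required for every resolution of ties, and with (1 - δ)n rounded up.
IsSlackSpanner : ∀ {n} → ℚ → ℚ → Graph n → Graph n → Set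
IsSlackSpanner {n} δ t G G′ = G′ ⊆ᴳ G ×
  (∀ v F → + ∣ F ∣ ≡ ℚ.ceiling ((1ℚ - δ) * fromℕ n) → IsFarthest G v F →
   ∀ w → w ∈ F → dist⟨ G′ , v , w ⟩≤ (t *_) ⟨dist⟨ G , v , w ⟩⟩)

------------------------------------------------------------------------
-- Asymptotics

-- x^(1+1/k) ≤ r for k ≥ 1.  A bound y ≤ a (b + x^(1+1/k)) with a ≥ 0 on
-- possibly irrational powers is expressed by y ≤ a (b + r) for all rational
-- r with x^(1+1/k) ≤ r, which is equivalent by density of ℚ.
_^[1+1/_]≤_ : ℚ → ℕ → ℚ → Set
x ^[1+1/ k ]≤ r = 0ℚ ≤ r × x ^ suc k ≤ r ^ k

-- g(n) = n^o(1)
Subpolynomial : (ℕ → ℕ) → Set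
Subpolynomial g = ∀ d → ∃[ N ] (∀ n → N ℕ.≤ n → g n ℕ.^ d ℕ.≤ n)

-- η(n) = o(1)
Vanishing : (ℕ → ℚ) → Set
Vanishing η = ∀ δ → 0ℚ < δ → ∃[ N ] (∀ n → N ℕ.≤ n → ℚ.∣ η n ∣ ≤ δ)

-- The bound O(k/ϵ)^k, with C the constant hidden in O(·).
hopBound : ℕ → ℕ → (ϵ : ℚ) .{{_ : Positive ϵ}} → ℚ
hopBound C k ϵ = ((fromℕ (C ℕ.* k) ÷ ϵ) {{pos⇒nonZero ϵ}}) ^ k

------------------------------------------------------------------------
-- Hopsets

IsHopset : ∀ {n} → ℕ → ℚ → Graph n → Graph n → Set
IsHopset β ϵ G H =
  (∀ {u v w} → Edge H u v w → IsDist (Edge G) u v w) ×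
  (∀ u v d → IsDist (Edge G) u v d →
   ∃[ d′ ] IsHopDist β (G ∪ᴱ H) u v d′ × d ≤ d′ × d′ ≤ (1ℚ + ϵ) * d)

-- The guarantee of the Elkin–Neiman and Huang–Pettie hopsets, with C the
-- constant hidden in both occurrences of O(·).
HopsetGuarantee : ℕ → Set
HopsetGuarantee C =
  ∀ {n} (G : Graph n) k → 1 ℕ.≤ k → ∀ ϵ .{{_ : Positive ϵ}} → ϵ < 1ℚ →
  ∃[ β ] ∃[ H ] IsHopset β ϵ G H ×
    fromℕ β ≤ hopBound C k ϵ ×
    (∀ r → fromℕ n ^[1+1/ 2 ℕ.^ suc k ℕ.∸ 1 ]≤ r → fromℕ (#edges H) ≤ fromℕ C * r)

{-# OPTIONS --safe #-}
-- A hopset replaces shortest paths by paths with few hops. Hence a set of pairs is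
-- preserved up to 1+ϵ by the graph edges of these paths, once the hopset edges on
-- them are preserved as well. Iterating with hopsets on ever sparser vertex samples
-- that hit every long geodesic, until no sample is left, preserves any set P of
-- pairs with n^o(1) (n + |P|) edges. A sample of n/2ˣ vertices costs a factor 2ˣ in
-- the number of hops, but its hopset has only (n/2ˣ)^(1+1/K) edges to preserve.
--
-- The subgraphs arise from suitable sets of pairs. For (1) these are the edges of a
-- hopset of G, and the pairs of a Thorup–Zwick emulator, which provides detours for
-- the edges of G on a path with few hops. For (2) they are an emulator on S and, for
-- each vertex, the pair with its nearest vertex in S. For (3), S is a set hitting
-- the ϵn nearest vertices of every vertex.

module Submission where

open import Algebra.Bundles using (module CommutativeRing)
import Algebra.Properties.CommutativeSemiring.Exp as Exp
open import Data.Bool.Base using (true; false; if_then_else_)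
open import Data.Fin.Base as Fin using (Fin; zero; suc)
import Data.Fin.Properties as Fin
open import Data.Fin.Subset as Subset using (Subset; ∁; ∣_∣)
open import Data.Fin.Subset.Properties as Subset using (∣∁p∣≡n∸∣p∣; x∈∁p⇒x∉p)
open import Data.Integer.Base as ℤ using (+[1+_]; -[1+_])
open import Data.Integer.DivMod as ℤ using (div-pos-is-/ℕ; a≡a%ℕn+[a/ℕn]*n; n%ℕd<d)
import Data.Integer.Properties as ℤ
open import Data.Integer.Tactic.RingSolver using () renaming (solve-∀ to ℤ-solve-∀)
open import Data.List.Base
  using (List; []; _∷_; _++_; length; map; filter; deduplicate; allFin; cartesianProduct; foldr
    ; mapMaybe; lookup; concatMap)
open import Data.List.Membership.Propositional using (_∈_; find; lose)
open import Data.List.Membership.Propositional.Properties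
  using (∈-∃++; ∈-++⁻; ∈-++⁺ˡ; ∈-++⁺ʳ; ∈-filter⁺; ∈-filter⁻; ∈-deduplicate⁺; ∈-deduplicate⁻
    ; ∈-allFin; ∈-map⁺; ∈-cartesianProduct⁺; ∈-map⁻; ∈-lookup; ∈-concatMap⁺)
open import Data.List.Properties
  using (length-++; length-deduplicate; length-map; length-tabulate; length-filter)
open import Data.List.Relation.Binary.Subset.Propositional using (_⊆_)
open import Data.List.Relation.Unary.All as All using (All; []; _∷_)
import Data.List.Relation.Unary.All.Properties as All
open import Data.List.Relation.Unary.AllPairs using ([]; _∷_)
open import Data.List.Relation.Unary.Any as Any using (here; there)
open import Data.List.Relation.Unary.Any.Properties using (lookup-index)
open import Data.List.Relation.Unary.Unique.DecPropositional.Properties using (deduplicate-!)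
open import Data.List.Relation.Unary.Unique.Propositional using (Unique)
import Data.List.Relation.Unary.Unique.Propositional.Properties as Unique
open import Data.Maybe.Base using (Maybe; just; nothing)
open import Data.Maybe.Properties using (just-injective)
open import Data.Nat.Base as ℕ using (ℕ; zero; suc; z≤n; s≤s; NonZero)
open import Data.Nat.DivMod using (m≡m%n+[m/n]*n; m%n<n; m/n*n≤m; m*n/n≡m; /-monoˡ-≤)
open import Data.Nat.ListAction using (sum)
open import Data.Nat.Logarithm
  using (⌊log₂_⌋; ⌈log₂_⌉; ⌊log₂⌋-mono-≤; ⌊log₂[2^n]⌋≡n; ⌊log₂⌊n/2⌋⌋≡⌊log₂n⌋∸1; ⌈log₂⌉-mono-≤
    ; ⌈log₂2^n⌉≡n)
import Data.Nat.Properties as ℕ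
open import Data.Nat.Tactic.RingSolver using (solve-∀)
open import Data.Product.Base using (∃; ∃-syntax; _×_; _,_; proj₁; proj₂; Σ-syntax; uncurry)
open import Data.Product.Properties using (≡-dec)
open import Data.Rational.Base as ℚ
  using (ℚ; 0ℚ; 1ℚ; Positive; 1/_; _+_; _*_; _-_; _≤_; _<_; mkℚ; *≤*; _⊔_; *<*)
open import Data.Rational.Properties as ℚ using (pos⇒nonZero)
open import Data.Rational.Unnormalised.Base as ℚᵘ using (*≡*)
import Data.Rational.Unnormalised.Properties as ℚᵘ
open import Data.Sum.Base using (_⊎_; inj₁; inj₂; [_,_]′; swap)
open import Data.Vec.Base using ([]; _∷_; here; there)
open import Defs
open import Function.Base using (_∘_; id)
open import Relation.Binary.Construct.Closure.ReflexiveTransitive using (ε; _◅_; _◅◅_)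
open import Relation.Binary.Definitions using (DecidableEquality; tri<; tri≈; tri>)
open import Relation.Binary.PropositionalEquality
  using (_≡_; refl; sym; trans; cong; cong₂; subst; subst₂; _≢_)
open import Relation.Nullary using (¬_; yes; no; contradiction; Dec)
open import Relation.Nullary.Decidable using (¬?; does; dec-true; dec-false; _⊎-dec_)
open import Relation.Unary using (Decidable)
open import Tactic.RingSolver using () renaming (solve-∀ to ring-solve-∀)
open import Tactic.RingSolver.Core.AlmostCommutativeRing
  using (AlmostCommutativeRing; fromCommutativeRing)

-- Greedy hitting sets

-- A hopset edge need not be an edge of `G`, and unrolling it along a shortest path may take almost
-- n edges: preserving it is as hard as preserving any other pair. What breaks the circle is that
-- sparser samples cut the number of hopset edges slightly more than they lengthen the hops. At
-- level x a surplus factor 2^(x/K) remains, and it pays for the longer hops of the next level, so x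
-- grows by the factor 1+1/K (plus one). As every level multiplies the stretch by 1+ϵ, the accuracy
-- of the hopsets must be divided by the number of levels. With K at least log n, log n levels
-- suffice and all losses are n^o(1). For smaller k, about 2ᵏ(log log n - k) levels suffice, which
-- is the error factor in the precise form of (1). In (1) the constant stretch of an emulator is
-- harmless: it is paid only on the at most β single edges of a hopset path, and so enters the
-- additive term through `W-max`. In (2) and (3) it is the main term, and preserving the pairs
-- almost exactly adds only ϵ. Greedy hitting sets replace random samples at the price of a
-- logarithm, so no probability occurs.

module _ {A : Set} where

  Unique-⊆⇒length≤ : {xs ys : List A} → Unique xs → xs ⊆ ys → length xs ℕ.≤ length ys
  Unique-⊆⇒length≤ {[]} _ _ = z≤n
  Unique-⊆⇒length≤ {x ∷ xs} (x∉xs ∷ u) xs⊆ys with ∈-∃++ (xs⊆ys (here refl))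
  ... | ys₁ , ys₂ , refl = begin
    suc (length xs) ≤⟨ s≤s (Unique-⊆⇒length≤ u xs⊆) ⟩
    suc (length (ys₁ ++ ys₂)) ≡⟨ cong suc (length-++ ys₁) ⟩
    suc (length ys₁ ℕ.+ length ys₂) ≡⟨ ℕ.+-suc (length ys₁) _ ⟨
    length ys₁ ℕ.+ suc (length ys₂) ≡⟨ length-++ ys₁ ⟨
    length (ys₁ ++ x ∷ ys₂) ∎
    where
    open ℕ.≤-Reasoning
    xs⊆ : xs ⊆ ys₁ ++ ys₂
    xs⊆ y∈xs with ∈-++⁻ ys₁ (xs⊆ys (there y∈xs))
    ... | inj₁ y∈ys₁        = ∈-++⁺ˡ y∈ys₁
    ... | inj₂ (here refl)  = contradiction refl (All.lookup x∉xs y∈xs)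
    ... | inj₂ (there y∈ys₂) = ∈-++⁺ʳ ys₁ y∈ys₂

  length-filter-∁ : ∀ {P : A → Set} (P? : Decidable P) xs →
    length (filter P? xs) ℕ.+ length (filter (¬? ∘ P?) xs) ≡ length xs
  length-filter-∁ P? [] = refl
  length-filter-∁ P? (x ∷ xs) with P? x
  ... | yes _ = cong suc (length-filter-∁ P? xs)
  ... | no  _ = trans (ℕ.+-suc _ _) (cong suc (length-filter-∁ P? xs))

  sum-map-+ : ∀ (f g : A → ℕ) xs →
    sum (map (λ x → f x ℕ.+ g x) xs) ≡ sum (map f xs) ℕ.+ sum (map g xs)
  sum-map-+ f g [] = refl
  sum-map-+ f g (x ∷ xs) rewrite sum-map-+ f g xs = lemma (f x) (g x) _ _
    where
    lemma : ∀ a b c d → a ℕ.+ b ℕ.+ (c ℕ.+ d) ≡ a ℕ.+ c ℕ.+ (b ℕ.+ d)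
    lemma = solve-∀

  some-≥-average : ∀ (f : A → ℕ) x xs →
    ∃[ y ] y ∈ x ∷ xs × sum (map f (x ∷ xs)) ℕ.≤ length (x ∷ xs) ℕ.* f y
  some-≥-average f x [] = x , here refl , ℕ.≤-refl
  some-≥-average f x (y ∷ ys) with some-≥-average f y ys
  ... | z , z∈ , le with ℕ.≤-total (f x) (f z)
  ... | inj₁ fx≤fz = z , there z∈ , ℕ.+-mono-≤ fx≤fz le
  ... | inj₂ fz≤fx = x , here refl ,
    ℕ.+-monoʳ-≤ (f x) (ℕ.≤-trans le (ℕ.*-monoʳ-≤ (suc (length ys)) fz≤fx))

module HittingSet {A : Set} (_≟_ : DecidableEquality A) (U : List A) (t : ℕ) where

  open import Data.List.Membership.DecPropositional _≟_ using (_∈?_)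

  private
    u = length U

  Large : List A → Set
  Large f = Unique f × f ⊆ U × t ℕ.≤ length f

  _Hits_ : List A → List A → Set
  X Hits f = ∃[ x ] x ∈ X × x ∈ f

  degree : A → List (List A) → ℕ
  degree x F = length (filter (x ∈?_) F)

  -- The incidences between `F` and `U` are counted once by sets and once by elements.
  double-counting : ∀ F → All Large F → length F ℕ.* t ℕ.≤ sum (map (λ x → degree x F) U)
  double-counting [] [] = z≤n
  double-counting (f ∷ F) ((uniq , f⊆U , t≤f) ∷ large) = begin
    t ℕ.+ length F ℕ.* t
      ≤⟨ ℕ.+-mono-≤ (ℕ.≤-trans t≤f (Unique-⊆⇒length≤ uniq λ x∈f → ∈-filter⁺ (_∈? f) (f⊆U x∈f) x∈f))
                    (double-counting F large) ⟩
    length (filter (_∈? f) U) ℕ.+ sum (map (λ x → degree x F) U)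
      ≡⟨ cong (ℕ._+ _) (indicator U) ⟨
    sum (map (λ x → degree x (f ∷ [])) U) ℕ.+ sum (map (λ x → degree x F) U)
      ≡⟨ sum-map-+ (λ x → degree x (f ∷ [])) (λ x → degree x F) U ⟨
    sum (map (λ x → degree x (f ∷ []) ℕ.+ degree x F) U)
      ≡⟨ cong sum (map-degree U) ⟩
    sum (map (λ x → degree x (f ∷ F)) U) ∎
    where
    open ℕ.≤-Reasoning
    indicator : ∀ xs → sum (map (λ x → degree x (f ∷ [])) xs) ≡ length (filter (_∈? f) xs)
    indicator [] = refl
    indicator (x ∷ xs) with x ∈? f
    ... | yes _ = cong suc (indicator xs)
    ... | no  _ = indicator xs
    map-degree : ∀ xs → map (λ x → degree x (f ∷ []) ℕ.+ degree x F) xs ≡ map (λ x → degree x (f ∷ F)) xs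
    map-degree [] = refl
    map-degree (x ∷ xs) with x ∈? f
    ... | yes _ = cong (_ ∷_) (map-degree xs)
    ... | no  _ = cong (_ ∷_) (map-degree xs)

  record Partial (F : List (List A)) : Set where
    field
      hitting  : List A
      rest     : List (List A)
      ⊆U       : hitting ⊆ U
      rest⊆F   : rest ⊆ F
      hits     : ∀ {f} → f ∈ F → f ∈ rest ⊎ hitting Hits f

  open Partial

  -- An average element of `U` lies in a fraction t/u of the sets. There is an element at all
  -- because `f` has at least t ≥ 1 of them.
  popular : .{{_ : NonZero t}} → ∀ f F → All Large (f ∷ F) →
    ∃[ x ] x ∈ U × length (f ∷ F) ℕ.* t ℕ.≤ u ℕ.* degree x (f ∷ F)
  popular f F large@((uniq , f⊆U , t≤f) ∷ _) = nonempty U refl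
    where
    nonempty : ∀ V → V ≡ U → ∃[ x ] x ∈ U × length (f ∷ F) ℕ.* t ℕ.≤ u ℕ.* degree x (f ∷ F)
    nonempty [] refl = contradiction (ℕ.≤-trans t≤f (Unique-⊆⇒length≤ uniq f⊆U)) (ℕ.<⇒≱ (ℕ.>-nonZero⁻¹ t))
    nonempty (v ∷ V) refl with some-≥-average (λ x → degree x (f ∷ F)) v V
    ... | x , x∈ , le = x , x∈ , ℕ.≤-trans (double-counting (f ∷ F) large) le

  -- The second alternative says that every chosen element removed at least
  -- the fraction t/2u of F.
  greedy : .{{_ : NonZero t}} → ∀ F → All Large F → ∀ s → ∃[ P ] length (hitting {F} P) ℕ.≤ s ×
    (2 ℕ.* length (rest P) ℕ.≤ length F ⊎
     s ℕ.* t ℕ.* length F ℕ.+ 2 ℕ.* u ℕ.* length (rest P) ℕ.≤ 2 ℕ.* u ℕ.* length F)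
  greedy F large zero =
    record { hitting = [] ; rest = F ; ⊆U = λ () ; rest⊆F = id ; hits = inj₁ } , z≤n , inj₂ ℕ.≤-refl
  greedy F large (suc s) with greedy F large s
  ... | P , ≤s , inj₁ half = P , ℕ.m≤n⇒m≤1+n ≤s , inj₁ half
  ... | P , ≤s , inj₂ many with rest P in rest≡
  ... | [] = P , ℕ.m≤n⇒m≤1+n ≤s , inj₁ (ℕ.≤-trans (ℕ.≤-reflexive (cong (λ R → 2 ℕ.* length R) rest≡)) z≤n)
  ... | f ∷ R with 2 ℕ.* length (f ∷ R) ℕ.≤? length F
  ... | yes half = P , ℕ.m≤n⇒m≤1+n ≤s , inj₁ (subst (λ R → 2 ℕ.* length R ℕ.≤ length F) (sym rest≡) half)
  -- More than half of `F` is still unhit, so an element in a fraction t/u of the remaining sets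
  -- removes a fraction t/2u of `F`.
  ... | no ¬half with popular f R (subst (All Large) rest≡ (All.tabulate (All.lookup large ∘ rest⊆F P)))
  ... | x , x∈U , degree≥ = record
    { hitting = x ∷ hitting P
    ; rest    = R′
    ; ⊆U      = λ { (here refl) → x∈U ; (there y∈) → ⊆U P y∈ }
    ; rest⊆F  = λ g∈ → rest⊆F P (subst (_ ∈_) (sym rest≡) (proj₁ (∈-filter⁻ (¬? ∘ (x ∈?_)) g∈)))
    ; hits    = hits′
    } , s≤s ≤s , inj₂ (begin
      (t ℕ.+ s ℕ.* t) ℕ.* m ℕ.+ 2 ℕ.* u ℕ.* length R′
        ≡⟨ lemma₁ t s m u (length R′) ⟩
      t ℕ.* m ℕ.+ (s ℕ.* t ℕ.* m ℕ.+ 2 ℕ.* u ℕ.* length R′)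
        ≤⟨ ℕ.+-monoˡ-≤ _ (begin
             t ℕ.* m ≤⟨ ℕ.*-monoʳ-≤ t (ℕ.<⇒≤ (ℕ.≰⇒> ¬half)) ⟩
             t ℕ.* (2 ℕ.* length (f ∷ R)) ≡⟨ lemma₂ t (length (f ∷ R)) ⟩
             2 ℕ.* (length (f ∷ R) ℕ.* t) ≤⟨ ℕ.*-monoʳ-≤ 2 degree≥ ⟩
             2 ℕ.* (u ℕ.* degree x (f ∷ R)) ∎) ⟩
      2 ℕ.* (u ℕ.* degree x (f ∷ R)) ℕ.+ (s ℕ.* t ℕ.* m ℕ.+ 2 ℕ.* u ℕ.* length R′)
        ≡⟨ lemma₃ u (degree x (f ∷ R)) (s ℕ.* t ℕ.* m) (length R′) ⟩
      s ℕ.* t ℕ.* m ℕ.+ 2 ℕ.* u ℕ.* (degree x (f ∷ R) ℕ.+ length R′)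
        ≡⟨ cong (λ l → s ℕ.* t ℕ.* m ℕ.+ 2 ℕ.* u ℕ.* l) (length-filter-∁ (x ∈?_) (f ∷ R)) ⟩
      s ℕ.* t ℕ.* m ℕ.+ 2 ℕ.* u ℕ.* length (f ∷ R)
        ≤⟨ many ⟩
      2 ℕ.* u ℕ.* m ∎)
    where
    open ℕ.≤-Reasoning
    m  = length F
    R′ = filter (¬? ∘ (x ∈?_)) (f ∷ R)
    lemma₁ : ∀ t s m u r → (t ℕ.+ s ℕ.* t) ℕ.* m ℕ.+ 2 ℕ.* u ℕ.* r ≡ t ℕ.* m ℕ.+ (s ℕ.* t ℕ.* m ℕ.+ 2 ℕ.* u ℕ.* r)
    lemma₁ = solve-∀
    lemma₂ : ∀ t l → t ℕ.* (2 ℕ.* l) ≡ 2 ℕ.* (l ℕ.* t)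
    lemma₂ = solve-∀
    lemma₃ : ∀ u d a r → 2 ℕ.* (u ℕ.* d) ℕ.+ (a ℕ.+ 2 ℕ.* u ℕ.* r) ≡ a ℕ.+ 2 ℕ.* u ℕ.* (d ℕ.+ r)
    lemma₃ = solve-∀
    hits′ : ∀ {g} → g ∈ F → g ∈ R′ ⊎ (x ∷ hitting P) Hits g
    hits′ {g} g∈F with hits P g∈F
    ... | inj₂ (y , y∈ , y∈g) = inj₂ (y , there y∈ , y∈g)
    ... | inj₁ g∈rest with x ∈? g
    ... | yes x∈g = inj₂ (x , here refl , x∈g)
    ... | no  x∉g = inj₁ (∈-filter⁺ (¬? ∘ (x ∈?_)) (subst (g ∈_) rest≡ g∈rest) x∉g)

  halve : .{{_ : NonZero t}} → ∀ f F → All Large (f ∷ F) → ∃[ P ]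
    length (hitting {f ∷ F} P) ℕ.* t ℕ.≤ 2 ℕ.* u × 2 ℕ.* length (rest P) ℕ.≤ length (f ∷ F)
  halve f F large@((uniq , f⊆U , t≤f) ∷ _) with greedy (f ∷ F) large (suc (u ℕ./ t))
  ... | P , ≤s , few = P , size , [ id , half ]′ few
    where
    open ℕ.≤-Reasoning
    m = length (f ∷ F)
    -- Rounding up gives s·t ≥ u, which turns the second outcome of `greedy` into a halving as well;
    -- t ≤ u keeps s·t ≤ 2u.
    s = suc (u ℕ./ t)
    t≤u : t ℕ.≤ u
    t≤u = ℕ.≤-trans t≤f (Unique-⊆⇒length≤ uniq f⊆U)
    size : length (hitting P) ℕ.* t ℕ.≤ 2 ℕ.* u
    size = begin
      length (hitting P) ℕ.* t ≤⟨ ℕ.*-monoˡ-≤ t ≤s ⟩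
      t ℕ.+ u ℕ./ t ℕ.* t ≤⟨ ℕ.+-mono-≤ t≤u (m/n*n≤m u t) ⟩
      u ℕ.+ u ≡⟨ cong (u ℕ.+_) (ℕ.+-identityʳ u) ⟨
      2 ℕ.* u ∎
    u≤st : u ℕ.≤ s ℕ.* t
    u≤st = begin
      u ≡⟨ m≡m%n+[m/n]*n u t ⟩
      u ℕ.% t ℕ.+ u ℕ./ t ℕ.* t ≤⟨ ℕ.+-monoˡ-≤ _ (ℕ.<⇒≤ (m%n<n u t)) ⟩
      s ℕ.* t ∎
    instance
      nonZero-u : NonZero u
      nonZero-u = ℕ.>-nonZero (ℕ.<-≤-trans (ℕ.>-nonZero⁻¹ t) t≤u)
    half : s ℕ.* t ℕ.* m ℕ.+ 2 ℕ.* u ℕ.* length (rest P) ℕ.≤ 2 ℕ.* u ℕ.* m → 2 ℕ.* length (rest P) ℕ.≤ m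
    half many = ℕ.*-cancelˡ-≤ u (ℕ.+-cancelˡ-≤ (u ℕ.* m) _ _ (begin
      u ℕ.* m ℕ.+ u ℕ.* (2 ℕ.* length (rest P)) ≡⟨ cong (u ℕ.* m ℕ.+_) (lemma₁ u _) ⟩
      u ℕ.* m ℕ.+ 2 ℕ.* u ℕ.* length (rest P) ≤⟨ ℕ.+-monoˡ-≤ _ (ℕ.*-monoˡ-≤ m u≤st) ⟩
      s ℕ.* t ℕ.* m ℕ.+ 2 ℕ.* u ℕ.* length (rest P) ≤⟨ many ⟩
      2 ℕ.* u ℕ.* m ≡⟨ lemma₂ u m ⟩
      u ℕ.* m ℕ.+ u ℕ.* m ∎))
      where
      lemma₁ : ∀ u r → u ℕ.* (2 ℕ.* r) ≡ 2 ℕ.* u ℕ.* r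
      lemma₁ = solve-∀
      lemma₂ : ∀ u m → 2 ℕ.* u ℕ.* m ≡ u ℕ.* m ℕ.+ u ℕ.* m
      lemma₂ = solve-∀

  -- Each round halves the sets not yet hit at the price of 2u/t elements, and h halvings exhaust
  -- fewer than 2ʰ sets.
  iterated : .{{_ : NonZero t}} → ∀ h F → All Large F → length F ℕ.< 2 ℕ.^ h →
    ∃[ X ] X ⊆ U × (∀ {f} → f ∈ F → X Hits f) × length X ℕ.* t ℕ.≤ h ℕ.* (2 ℕ.* u)
  iterated h [] _ _ = [] , (λ ()) , (λ ()) , z≤n
  iterated zero (_ ∷ _) _ (s≤s ())
  iterated (suc h) (f ∷ F) large <2^ with halve f F large
  ... | P , size , half
    with iterated h (rest P) (All.tabulate (All.lookup large ∘ rest⊆F P)) (ℕ.*-cancelˡ-< 2 _ _ (ℕ.≤-<-trans half <2^))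
  ... | X , X⊆U , X-hits , X-size = hitting P ++ X , ⊆ , hits′ , size′
    where
    open ℕ.≤-Reasoning
    ⊆ : hitting P ++ X ⊆ U
    ⊆ y∈ = [ ⊆U P , X⊆U ]′ (∈-++⁻ (hitting P) y∈)
    hits′ : ∀ {g} → g ∈ f ∷ F → (hitting P ++ X) Hits g
    hits′ g∈ with hits P g∈
    ... | inj₂ (y , y∈ , y∈g) = y , ∈-++⁺ˡ y∈ , y∈g
    ... | inj₁ g∈rest with X-hits g∈rest
    ... | y , y∈ , y∈g = y , ∈-++⁺ʳ (hitting P) y∈ , y∈g
    size′ : length (hitting P ++ X) ℕ.* t ℕ.≤ suc h ℕ.* (2 ℕ.* u)
    size′ = begin
      length (hitting P ++ X) ℕ.* t ≡⟨ cong (ℕ._* t) (length-++ (hitting P)) ⟩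
      (length (hitting P) ℕ.+ length X) ℕ.* t ≡⟨ ℕ.*-distribʳ-+ t (length (hitting P)) _ ⟩
      length (hitting P) ℕ.* t ℕ.+ length X ℕ.* t ≤⟨ ℕ.+-mono-≤ size X-size ⟩
      suc h ℕ.* (2 ℕ.* u) ∎

  abstract
    -- Repetitions are removed because a sample will serve as a vertex set through `lookup`, which
    -- must be injective, and because later hitting sets count distinct elements of it.
    hitting-set : .{{_ : NonZero t}} → ∀ h F → All Large F → length F ℕ.< 2 ℕ.^ h →
      ∃[ X ] Unique X × X ⊆ U × (∀ {f} → f ∈ F → X Hits f) × length X ℕ.* t ℕ.≤ h ℕ.* (2 ℕ.* u)
    hitting-set h F large <2^ with iterated h F large <2^
    ... | X , X⊆U , X-hits , X-size =
      deduplicate _≟_ X , deduplicate-! _≟_ X , (λ y∈ → X⊆U (∈-deduplicate⁻ _≟_ X y∈)) ,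
      (λ f∈ → let y , y∈ , y∈f = X-hits f∈ in y , ∈-deduplicate⁺ _≟_ y∈ , y∈f) ,
      ℕ.≤-trans (ℕ.*-monoˡ-≤ t (length-deduplicate _≟_ X)) X-size

-- Binary logarithms and lengths of lists

n<2^1+⌊log₂n⌋ : ∀ n → n ℕ.< 2 ℕ.^ suc ⌊log₂ n ⌋
n<2^1+⌊log₂n⌋ n = ℕ.≰⇒> λ le → ℕ.<-irrefl refl
  (ℕ.≤-trans (ℕ.≤-reflexive (sym (⌊log₂[2^n]⌋≡n (suc ⌊log₂ n ⌋)))) (⌊log₂⌋-mono-≤ le))

2^⌊log₂n⌋≤n : ∀ n .{{_ : NonZero n}} → 2 ℕ.^ ⌊log₂ n ⌋ ℕ.≤ n
2^⌊log₂n⌋≤n n = go n n ℕ.≤-refl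
  where
  go : ∀ m n .{{_ : NonZero n}} → n ℕ.≤ m → 2 ℕ.^ ⌊log₂ n ⌋ ℕ.≤ n
  go _       1             _        = s≤s z≤n
  go (suc m) n@(suc (suc k)) (s≤s le) = begin
    2 ℕ.^ ⌊log₂ n ⌋ ≤⟨ ℕ.^-monoʳ-≤ 2 (ℕ.m≤n+m∸n ⌊log₂ n ⌋ 1) ⟩
    2 ℕ.* 2 ℕ.^ (⌊log₂ n ⌋ ℕ.∸ 1) ≡⟨ cong (λ e → 2 ℕ.* 2 ℕ.^ e) (⌊log₂⌊n/2⌋⌋≡⌊log₂n⌋∸1 n) ⟨
    2 ℕ.* 2 ℕ.^ ⌊log₂ ℕ.⌊ n /2⌋ ⌋ ≤⟨ ℕ.*-monoʳ-≤ 2 (go m ℕ.⌊ n /2⌋ (ℕ.≤-trans (s≤s (ℕ.⌊n/2⌋≤n k)) le)) ⟩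
    2 ℕ.* ℕ.⌊ n /2⌋ ≡⟨ cong (ℕ.⌊ n /2⌋ ℕ.+_) (ℕ.+-identityʳ _) ⟩
    ℕ.⌊ n /2⌋ ℕ.+ ℕ.⌊ n /2⌋ ≤⟨ ℕ.+-monoʳ-≤ ℕ.⌊ n /2⌋ (ℕ.⌊n/2⌋≤⌈n/2⌉ n) ⟩
    ℕ.⌊ n /2⌋ ℕ.+ ℕ.⌈ n /2⌉ ≡⟨ ℕ.⌊n/2⌋+⌈n/2⌉≡n n ⟩
    n ∎
    where open ℕ.≤-Reasoning

square<2^ : ∀ {m} η → m ℕ.< 2 ℕ.^ η → m ℕ.* m ℕ.< 2 ℕ.^ (2 ℕ.* η)
square<2^ {m} η m< = subst (m ℕ.* m ℕ.<_)
  (trans (sym (ℕ.^-distribˡ-+-* 2 η η)) (cong (λ e → 2 ℕ.^ (η ℕ.+ e)) (sym (ℕ.+-identityʳ η)))) (ℕ.*-mono-< m< m<)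

length-allFin : ∀ n → length (allFin n) ≡ n
length-allFin n = length-tabulate {n = n} id

length-cartesianProduct : ∀ {A B : Set} (xs : List A) (ys : List B) →
  length (cartesianProduct xs ys) ≡ length xs ℕ.* length ys
length-cartesianProduct []       ys = refl
length-cartesianProduct (x ∷ xs) ys = trans (length-++ (map (x ,_) ys))
  (cong₂ ℕ._+_ (length-map (x ,_) ys) (length-cartesianProduct xs ys))

-- Rational arithmetic

ℚ-ring : AlmostCommutativeRing _ _
ℚ-ring = fromCommutativeRing ℚ.+-*-commutativeRing isZero
  where
  isZero : ∀ x → Maybe (0ℚ ≡ x)
  isZero x with 0ℚ ℚ.≟ x
  ... | yes p = just p
  ... | no  _ = nothing

fromℕ-+ : ∀ a b → fromℕ (a ℕ.+ b) ≡ fromℕ a + fromℕ b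
fromℕ-+ a b = ℚ.toℚᵘ-injective (ℚᵘ.≃-trans
  (*≡* (cong (ℤ._* (ℤ.+ 1)) (cong₂ ℤ._+_ (sym (ℤ.*-identityʳ (ℤ.+ a))) (sym (ℤ.*-identityʳ (ℤ.+ b))))))
  (ℚᵘ.≃-sym (ℚ.toℚᵘ-homo-+ (fromℕ a) (fromℕ b))))

fromℕ-* : ∀ a b → fromℕ (a ℕ.* b) ≡ fromℕ a * fromℕ b
fromℕ-* a b = ℚ.toℚᵘ-injective (ℚᵘ.≃-trans
  (*≡* (cong (ℤ._* (ℤ.+ 1)) (ℤ.pos-* a b)))
  (ℚᵘ.≃-sym (ℚ.toℚᵘ-homo-* (fromℕ a) (fromℕ b))))

fromℕ-^ : ∀ a k → fromℕ (a ℕ.^ k) ≡ fromℕ a ^ k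
fromℕ-^ a zero    = refl
fromℕ-^ a (suc k) = trans (fromℕ-* a (a ℕ.^ k)) (cong (fromℕ a *_) (fromℕ-^ a k))

fromℕ-mono-≤ : ∀ {a b} → a ℕ.≤ b → fromℕ a ≤ fromℕ b
fromℕ-mono-≤ {a} {b} a≤b = *≤* (subst₂ ℤ._≤_ (sym (ℤ.*-identityʳ (ℤ.+ a))) (sym (ℤ.*-identityʳ (ℤ.+ b))) (ℤ.+≤+ a≤b))

fromℕ-cancel-≤ : ∀ {a b} → fromℕ a ≤ fromℕ b → a ℕ.≤ b
fromℕ-cancel-≤ {a} {b} (*≤* le) = ℤ.drop‿+≤+ (subst₂ ℤ._≤_ (ℤ.*-identityʳ (ℤ.+ a)) (ℤ.*-identityʳ (ℤ.+ b)) le)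

0≤fromℕ : ∀ a → 0ℚ ≤ fromℕ a
0≤fromℕ a = fromℕ-mono-≤ z≤n

0≤1 : 0ℚ ≤ 1ℚ
0≤1 = 0≤fromℕ 1

*-mono-≤ : ∀ {a b c d} → 0ℚ ≤ a → a ≤ b → 0ℚ ≤ c → c ≤ d → a * c ≤ b * d
*-mono-≤ {a} {b} {c} {d} 0≤a a≤b 0≤c c≤d = ℚ.≤-trans
  (ℚ.*-monoʳ-≤-nonNeg c {{ℚ.nonNegative 0≤c}} a≤b)
  (ℚ.*-monoˡ-≤-nonNeg b {{ℚ.nonNegative (ℚ.≤-trans 0≤a a≤b)}} c≤d)

*-monoˡ-≤ : ∀ {a b c} → 0ℚ ≤ c → a ≤ b → c * a ≤ c * b
*-monoˡ-≤ {c = c} 0≤c = ℚ.*-monoˡ-≤-nonNeg c {{ℚ.nonNegative 0≤c}}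

*-monoʳ-≤ : ∀ {a b c} → 0ℚ ≤ c → a ≤ b → a * c ≤ b * c
*-monoʳ-≤ {c = c} 0≤c = ℚ.*-monoʳ-≤-nonNeg c {{ℚ.nonNegative 0≤c}}

0≤* : ∀ {a b} → 0ℚ ≤ a → 0ℚ ≤ b → 0ℚ ≤ a * b
0≤* {a} {b} 0≤a 0≤b = subst (_≤ a * b) (ℚ.*-zeroˡ 0ℚ) (*-mono-≤ ℚ.≤-refl 0≤a ℚ.≤-refl 0≤b)

0≤+ : ∀ {a b} → 0ℚ ≤ a → 0ℚ ≤ b → 0ℚ ≤ a + b
0≤+ = ℚ.+-mono-≤

p≤p+q′ : ∀ {p q} → 0ℚ ≤ q → p ≤ p + q
p≤p+q′ {p} {q} 0≤q = subst (_≤ p + q) (ℚ.+-identityʳ p) (ℚ.+-monoʳ-≤ p 0≤q)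

p≤q+p′ : ∀ {p q} → 0ℚ ≤ q → p ≤ q + p
p≤q+p′ {p} {q} 0≤q = subst (_≤ q + p) (ℚ.+-identityˡ p) (ℚ.+-monoˡ-≤ p 0≤q)

1≤* : ∀ {a b} → 1ℚ ≤ a → 1ℚ ≤ b → 1ℚ ≤ a * b
1≤* {a} {b} 1≤a 1≤b = subst (_≤ a * b) (ℚ.*-identityˡ 1ℚ) (*-mono-≤ 0≤1 1≤a 0≤1 1≤b)

0≤^ : ∀ {a} k → 0ℚ ≤ a → 0ℚ ≤ a ^ k
0≤^ zero    0≤a = 0≤1
0≤^ (suc k) 0≤a = 0≤* 0≤a (0≤^ k 0≤a)

1≤^ : ∀ {a} k → 1ℚ ≤ a → 1ℚ ≤ a ^ k
1≤^ zero    1≤a = ℚ.≤-refl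
1≤^ (suc k) 1≤a = 1≤* 1≤a (1≤^ k 1≤a)

^-monoˡ-≤ : ∀ {a b} k → 0ℚ ≤ a → a ≤ b → a ^ k ≤ b ^ k
^-monoˡ-≤ zero    0≤a a≤b = ℚ.≤-refl
^-monoˡ-≤ (suc k) 0≤a a≤b = *-mono-≤ 0≤a a≤b (0≤^ k 0≤a) (^-monoˡ-≤ k 0≤a a≤b)

^-monoʳ-≤ : ∀ {a k l} → 1ℚ ≤ a → k ℕ.≤ l → a ^ k ≤ a ^ l
^-monoʳ-≤ {l = l} 1≤a z≤n     = 1≤^ l 1≤a
^-monoʳ-≤         1≤a (s≤s k≤l) = *-monoˡ-≤ (ℚ.≤-trans 0≤1 1≤a) (^-monoʳ-≤ 1≤a k≤l)

-- Stands in for taking k-th roots, which may be irrational.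
^-cancelˡ-≤ : ∀ {a b} k → 1 ℕ.≤ k → 0ℚ ≤ a → 0ℚ ≤ b → a ^ k ≤ b ^ k → a ≤ b
^-cancelˡ-≤ {a} {b} (suc k) _ 0≤a 0≤b le = ℚ.≮⇒≥ λ b<a →
  let instance
        a-pos : Positive a
        a-pos = ℚ.positive (ℚ.≤-<-trans 0≤b b<a)
  in ℚ.<-irrefl refl (begin-strict
    b * b ^ k ≤⟨ *-monoˡ-≤ 0≤b (^-monoˡ-≤ k 0≤b (ℚ.<⇒≤ b<a)) ⟩
    b * a ^ k <⟨ ℚ.*-monoˡ-<-pos (a ^ k) {{pos^ k}} b<a ⟩
    a * a ^ k ≤⟨ le ⟩
    b * b ^ k ∎)
  where
  open ℚ.≤-Reasoning
  pos^ : ∀ {a} k → .{{_ : Positive a}} → Positive (a ^ k)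
  pos^     zero    = _
  pos^ {a} (suc k) = ℚ.pos*pos⇒pos a (a ^ k) {{pos^ k}}

open Exp (CommutativeRing.commutativeSemiring ℚ.+-*-commutativeRing)
  using (^-distrib-*; ^-assocʳ)

1/-inverseʳ : ∀ a .{{_ : Positive a}} → a * (1/ a) {{ℚ.pos⇒nonZero a}} ≡ 1ℚ
1/-inverseʳ a = ℚ.*-inverseʳ a {{ℚ.pos⇒nonZero a}}

0≤1/ : ∀ a .{{_ : Positive a}} → 0ℚ ≤ (1/ a) {{ℚ.pos⇒nonZero a}}
0≤1/ a = ℚ.<⇒≤ (ℚ.positive⁻¹ ((1/ a) {{ℚ.pos⇒nonZero a}}) {{ℚ.1/pos⇒pos a}})

fromℕ-upper : ∀ r → ∃[ N ] r ≤ fromℕ N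
fromℕ-upper r@(mkℚ (ℤ.+ a) d-1 _) = a , *≤* (begin
  ℤ.+ a ℤ.* ℤ.+ 1 ≡⟨ ℤ.pos-* a 1 ⟨
  ℤ.+ (a ℕ.* 1) ≤⟨ ℤ.+≤+ (ℕ.*-monoʳ-≤ a (s≤s z≤n)) ⟩
  ℤ.+ (a ℕ.* suc d-1) ≡⟨ ℤ.pos-* a (suc d-1) ⟩
  ℤ.+ a ℤ.* ℤ.+ suc d-1 ∎)
  where open ℤ.≤-Reasoning
fromℕ-upper r@(mkℚ ℤ.-[1+ a ] d-1 _) = 0 , ℚ.nonPositive⁻¹ r

abstract
  ceil : ∀ r → 0ℚ ≤ r → ∃[ N ] r ≤ fromℕ N × fromℕ N ≤ r + 1ℚ
  ceil r 0≤r = let N , r≤N = fromℕ-upper r in go N r≤N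
    where
    go : ∀ N → r ≤ fromℕ N → ∃[ N ] r ≤ fromℕ N × fromℕ N ≤ r + 1ℚ
    go zero    r≤N = 0 , r≤N , ℚ.≤-trans 0≤r (p≤p+q′ 0≤1)
    go (suc N) r≤N with r ℚ.≤? fromℕ N
    ... | yes r≤ = go N r≤
    ... | no  r≰ = suc N , r≤N , subst (_≤ r + 1ℚ)
      (trans (ℚ.+-comm (fromℕ N) 1ℚ) (sym (fromℕ-+ 1 N))) (ℚ.+-monoˡ-≤ 1ℚ (ℚ.<⇒≤ (ℚ.≰⇒> r≰)))

+-cancelˡ-≤ : ∀ p {q r} → p + q ≤ p + r → q ≤ r
+-cancelˡ-≤ p le = ℚ.≮⇒≥ λ r<q → ℚ.<-irrefl refl (ℚ.<-≤-trans (ℚ.+-monoʳ-< p r<q) le)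

+-cancelʳ-≤ : ∀ p {q r} → q + p ≤ r + p → q ≤ r
+-cancelʳ-≤ p {q} {r} le = +-cancelˡ-≤ p (subst₂ _≤_ (ℚ.+-comm q p) (ℚ.+-comm r p) le)

x≤[1+ϵ]*x : ∀ {ϵ x} → 0ℚ ≤ ϵ → 0ℚ ≤ x → x ≤ (1ℚ + ϵ) * x
x≤[1+ϵ]*x {ϵ} {x} 0≤ϵ 0≤x =
  subst (_≤ (1ℚ + ϵ) * x) (ℚ.*-identityˡ x) (*-monoʳ-≤ {1ℚ} {1ℚ + ϵ} 0≤x (p≤p+q′ 0≤ϵ))

2*_ : ∀ x → fromℕ 2 * x ≡ x + x
2* x = trans (ℚ.*-distribʳ-+ x 1ℚ 1ℚ) (cong₂ _+_ (ℚ.*-identityˡ x) (ℚ.*-identityˡ x))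

-- Walks and geodesics

module _ {n} {R : WeightedEdges n} where

  pathLength-◅◅ : ∀ {u v w} (p : Path R u v) (q : Path R v w) →
    pathLength {R = R} (p ◅◅ q) ≡ pathLength p + pathLength q
  pathLength-◅◅ ε             q = sym (ℚ.+-identityˡ _)
  pathLength-◅◅ ((w , _) ◅ p) q = trans (cong (w +_) (pathLength-◅◅ p q)) (sym (ℚ.+-assoc w _ _))

  hops-◅◅ : ∀ {u v w} (p : Path R u v) (q : Path R v w) →
    hops {R = R} (p ◅◅ q) ≡ hops p ℕ.+ hops q
  hops-◅◅ ε       q = refl
  hops-◅◅ (_ ◅ p) q = cong suc (hops-◅◅ p q)

  vertices : ∀ {u v} → Path R u v → List (Fin n)
  vertices {u} ε       = u ∷ []
  vertices {u} (_ ◅ p) = u ∷ vertices p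

  initial : ∀ {u v} → Path R u v → List (Fin n)
  initial     ε       = []
  initial {u} (_ ◅ p) = u ∷ initial p

  interior : ∀ {u v} → Path R u v → List (Fin n)
  interior ε       = []
  interior (_ ◅ p) = initial p

  length-vertices : ∀ {u v} (p : Path R u v) → length (vertices p) ≡ suc (hops p)
  length-vertices ε       = refl
  length-vertices (_ ◅ p) = cong suc (length-vertices p)

  length-initial : ∀ {u v} (p : Path R u v) → length (initial p) ≡ hops p
  length-initial ε       = refl
  length-initial (_ ◅ p) = cong suc (length-initial p)

  vertices-initial : ∀ {u v} (p : Path R u v) → vertices p ≡ initial p ++ v ∷ []
  vertices-initial ε       = refl
  vertices-initial (_ ◅ p) = cong (_ ∷_) (vertices-initial p)

  initial-unique : ∀ {u v} (p : Path R u v) → Unique (vertices p) → Unique (initial p)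
  initial-unique ε       _       = []
  initial-unique (_ ◅ p) (u∉ ∷ uniq) =
    All.++⁻ˡ (initial p) (subst (All _) (vertices-initial p) u∉) ∷ initial-unique p uniq

  interior-unique : ∀ {u v} (p : Path R u v) → Unique (vertices p) → Unique (interior p)
  interior-unique ε       _       = []
  interior-unique (_ ◅ p) (_ ∷ uniq) = initial-unique p uniq

  simple⇒short : ∀ {u v} (p : Path R u v) → Unique (vertices p) → hops p ℕ.< n
  simple⇒short p uniq = subst₂ ℕ._≤_ (length-vertices p) (length-allFin n)
    (Unique-⊆⇒length≤ uniq (λ {x} _ → ∈-allFin x))

  split-initial : ∀ {u v x} (p : Path R u v) → x ∈ initial p →
    Σ[ p₁ ∈ Path R u x ] Σ[ p₂ ∈ Path R x v ] pathLength p₁ + pathLength p₂ ≡ pathLength p ×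
      hops p₁ ℕ.< hops p × hops p₂ ℕ.≤ hops p
  split-initial p@(_ ◅ _) (here refl) = ε , p , ℚ.+-identityˡ _ , s≤s z≤n , ℕ.≤-refl
  split-initial ((w , e) ◅ p) (there x∈) with split-initial p x∈
  ... | p₁ , p₂ , len , h₁ , h₂ = (w , e) ◅ p₁ , p₂ ,
    trans (ℚ.+-assoc w _ _) (cong (w +_) len) , s≤s h₁ , ℕ.m≤n⇒m≤1+n h₂

  split-interior : ∀ {u v x} (p : Path R u v) → x ∈ interior p →
    Σ[ p₁ ∈ Path R u x ] Σ[ p₂ ∈ Path R x v ] pathLength p₁ + pathLength p₂ ≡ pathLength p ×
      hops p₁ ℕ.< hops p × hops p₂ ℕ.< hops p
  split-interior ((w , e) ◅ p) x∈ with split-initial p x∈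
  ... | p₁ , p₂ , len , h₁ , h₂ = (w , e) ◅ p₁ , p₂ ,
    trans (ℚ.+-assoc w _ _) (cong (w +_) len) , s≤s h₁ , s≤s h₂

least : ∀ {n} {B : Fin n → Set} (value : ∀ i → B i → ℚ) →
  (∀ i → (Σ[ b ∈ B i ] ∀ b′ → value i b ≤ value i b′) ⊎ ¬ B i) →
  (∃[ i ] Σ[ b ∈ B i ] ∀ j (b′ : B j) → value i b ≤ value j b′) ⊎ (∀ i → ¬ B i)
least {zero} value min = inj₂ λ ()
least {suc n} value min with min zero | least (value ∘ suc) (min ∘ suc)
... | inj₂ ¬b₀ | inj₂ ¬b = inj₂ λ { zero → ¬b₀ ; (suc i) → ¬b i }
... | inj₁ (b₀ , ≤₀) | inj₂ ¬b = inj₁ (zero , b₀ , λ { zero b′ → ≤₀ b′ ; (suc j) b′ → contradiction b′ (¬b j) })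
... | inj₂ ¬b₀ | inj₁ (i , b , b≤) = inj₁ (suc i , b , λ { zero b′ → contradiction b′ ¬b₀ ; (suc j) b′ → b≤ j b′ })
... | inj₁ (b₀ , ≤₀) | inj₁ (i , b , b≤) with ℚ.≤-total (value zero b₀) (value (suc i) b)
... | inj₁ b₀≤b = inj₁ (zero , b₀ , λ { zero b′ → ≤₀ b′ ; (suc j) b′ → ℚ.≤-trans b₀≤b (b≤ j b′) })
... | inj₂ b≤b₀ = inj₁ (suc i , b , λ { zero b′ → ℚ.≤-trans b≤b₀ (≤₀ b′) ; (suc j) b′ → b≤ j b′ })

module _ {n} (G : Graph n) where

  0≤pathLength : ∀ {u v} (p : Path (Edge G) u v) → 0ℚ ≤ pathLength p
  0≤pathLength ε             = ℚ.≤-refl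
  0≤pathLength ((w , e) ◅ p) = 0≤+ (ℚ.<⇒≤ (Graph.positive G e)) (0≤pathLength p)

  0<pathLength : ∀ {u v} → u ≢ v → (p : Path (Edge G) u v) → 0ℚ < pathLength p
  0<pathLength u≢v ε             = contradiction refl u≢v
  0<pathLength u≢v ((w , e) ◅ p) = ℚ.<-≤-trans (Graph.positive G e) (p≤p+q′ (0≤pathLength p))

  reverse : ∀ {u v} (p : Path (Edge G) u v) →
    Σ[ q ∈ Path (Edge G) v u ] pathLength q ≡ pathLength p × hops q ≡ hops p
  reverse ε = ε , refl , refl
  reverse ((w , e) ◅ p) with reverse p
  ... | q , len , h = q ◅◅ e′ ◅ ε ,
    trans (pathLength-◅◅ q (e′ ◅ ε))
      (trans (cong₂ _+_ len (ℚ.+-identityʳ w)) (ℚ.+-comm (pathLength p) w)) ,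
    trans (hops-◅◅ q (e′ ◅ ε)) (trans (ℕ.+-comm (hops q) 1) (cong suc h))
    where
    e′ = w , trans (Graph.sym G _ _) e

  suffix : ∀ {u v x} (p : Path (Edge G) u v) → Unique (vertices p) → x ∈ vertices p →
    Σ[ q ∈ Path (Edge G) x v ] Unique (vertices q) × pathLength q ≤ pathLength p × hops q ℕ.≤ hops p
  suffix ε uniq (here refl) = ε , uniq , ℚ.≤-refl , z≤n
  suffix p@(_ ◅ _) uniq (here refl) = p , uniq , ℚ.≤-refl , ℕ.≤-refl
  suffix ((w , e) ◅ p) (_ ∷ uniq) (there x∈) with suffix p uniq x∈
  ... | q , q-uniq , len , h = q , q-uniq ,
    ℚ.≤-trans len (p≤q+p′ (ℚ.<⇒≤ (Graph.positive G e))) , ℕ.m≤n⇒m≤1+n h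

  simplify : ∀ {u v} (p : Path (Edge G) u v) →
    Σ[ q ∈ Path (Edge G) u v ] Unique (vertices q) × pathLength q ≤ pathLength p × hops q ℕ.≤ hops p
  simplify ε = ε , [] ∷ [] , ℚ.≤-refl , z≤n
  simplify {u} ((w , e) ◅ p) with simplify p
  ... | q , uniq , len , h with u ∈? vertices q
    where open import Data.List.Membership.DecPropositional (Fin._≟_ {n}) using (_∈?_)
  ... | no u∉ = (w , e) ◅ q , All.¬Any⇒All¬ _ u∉ ∷ uniq , ℚ.+-monoʳ-≤ w len , s≤s h
  ... | yes u∈ with suffix q uniq u∈
  ... | q′ , uniq′ , len′ , h′ = q′ , uniq′ ,
    ℚ.≤-trans len′ (ℚ.≤-trans len (p≤q+p′ (ℚ.<⇒≤ (Graph.positive G e)))) ,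
    ℕ.≤-trans h′ (ℕ.m≤n⇒m≤1+n h)

  edge? : ∀ u v → (∃[ w ] Edge G u v w) ⊎ (∀ w → ¬ Edge G u v w)
  edge? u v with weight G u v
  ... | just w  = inj₁ (w , refl)
  ... | nothing = inj₂ λ _ ()

  HopMinimal : ℕ → Fin n → Fin n → Set
  HopMinimal h u v = Σ[ p ∈ Path (Edge G) u v ] hops p ℕ.≤ h ×
    (∀ (q : Path (Edge G) u v) → hops q ℕ.≤ h → pathLength p ≤ pathLength q)

  -- The Bellman-Ford recursion: minimise over the first edge, followed by an optimal walk with one
  -- edge less. For equal endpoints the empty walk is optimal, as weights are positive.
  hopMinimal? : ∀ h u v → HopMinimal h u v ⊎ (∀ (q : Path (Edge G) u v) → ¬ hops q ℕ.≤ h)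
  hopMinimal? h u v with u Fin.≟ v
  ... | yes refl = inj₁ (ε , z≤n , λ q _ → 0≤pathLength q)
  hopMinimal? zero u v | no u≢v = inj₂ λ { ε _ → u≢v refl }
  hopMinimal? (suc h) u v | no u≢v = result (least value candidates)
    where
    First : Fin n → Set
    First x = (∃[ w ] Edge G u x w) × Σ[ p ∈ Path (Edge G) x v ] hops p ℕ.≤ h
    value : ∀ x → First x → ℚ
    value x ((w , _) , p , _) = w + pathLength p
    candidates : ∀ x → (Σ[ b ∈ First x ] ∀ b′ → value x b ≤ value x b′) ⊎ ¬ First x
    candidates x with edge? u x | hopMinimal? h x v
    ... | inj₂ none | _ = inj₂ λ { ((w , e) , _) → none w e }
    ... | inj₁ _ | inj₂ none = inj₂ λ { (_ , p , ≤h) → none p ≤h }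
    ... | inj₁ (w , e) | inj₁ (p , ≤h , p-min) = inj₁ (((w , e) , p , ≤h) ,
      λ { ((w′ , e′) , q , q≤h) → ℚ.+-mono-≤ (ℚ.≤-reflexive (just-injective (trans (sym e) e′))) (p-min q q≤h) })
    result : (∃[ x ] Σ[ b ∈ First x ] ∀ y (b′ : First y) → value x b ≤ value y b′) ⊎ (∀ x → ¬ First x) → _
    result (inj₂ none) = inj₂ λ { ε _ → u≢v refl ; (e ◅ q) (s≤s ≤h) → none _ (e , q , ≤h) }
    result (inj₁ (x , (e , p , ≤h) , p-min)) = inj₁ (e ◅ p , s≤s ≤h ,
      λ { ε _ → contradiction refl u≢v ; (e′ ◅ q) (s≤s q≤h) → p-min _ (e′ , q , q≤h) })

  -- `fewest` makes the number of edges depend on the pair only, so having at most t edges is a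
  -- symmetric notion and pieces of a geodesic have geodesics that are no longer. `simple` makes the
  -- interior a set of distinct vertices, as the hitting sets require.
  record Geodesic (u v : Fin n) : Set where
    field
      path     : Path (Edge G) u v
      shortest : ∀ (q : Path (Edge G) u v) → pathLength path ≤ pathLength q
      fewest   : ∀ (q : Path (Edge G) u v) → pathLength q ≤ pathLength path → hops path ℕ.≤ hops q
      simple   : Unique (vertices path)

  open Geodesic

  abstract
    geodesic? : ∀ u v → Geodesic u v ⊎ ¬ Path (Edge G) u v
    geodesic? u v with hopMinimal? n u v
    ... | inj₂ none = inj₂ λ q → let q′ , uniq , _ = simplify q in none q′ (ℕ.<⇒≤ (simple⇒short q′ uniq))
    ... | inj₁ (p , ≤n , p-min) = inj₁ (fewer n p ≤n p-shortest)
      where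
      p-shortest : ∀ (q : Path (Edge G) u v) → pathLength p ≤ pathLength q
      p-shortest q = let q′ , uniq , len , _ = simplify q in
        ℚ.≤-trans (p-min q′ (ℕ.<⇒≤ (simple⇒short q′ uniq))) len
      simplified : (p : Path (Edge G) u v) → (∀ (q : Path (Edge G) u v) → pathLength p ≤ pathLength q) →
        (∀ (q : Path (Edge G) u v) → pathLength q ≤ pathLength p → hops p ℕ.≤ hops q) → Geodesic u v
      simplified p p-shortest p-fewest = let p′ , uniq , len , h = simplify p in record
        { path     = p′
        ; shortest = λ q → ℚ.≤-trans len (p-shortest q)
        ; fewest   = λ q q≤ → ℕ.≤-trans h (p-fewest q (ℚ.≤-trans q≤ len))
        ; simple   = uniq
        }
      -- The hop bound is lowered as long as the optimum within it still attains the distance. When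
      -- it no longer does, every shortest walk needs more edges than the bound, hence at least as
      -- many as `p`.
      fewer : ∀ h (p : Path (Edge G) u v) → hops p ℕ.≤ h → (∀ (q : Path (Edge G) u v) → pathLength p ≤ pathLength q) → Geodesic u v
      fewer zero p ≤0 p-shortest = simplified p p-shortest λ _ _ → ℕ.≤-trans ≤0 z≤n
      fewer (suc h) p ≤h p-shortest with hopMinimal? h u v
      ... | inj₂ none = simplified p p-shortest λ q _ → ℕ.≤-trans ≤h (ℕ.≰⇒> (none q))
      ... | inj₁ (p′ , p′≤h , p′-min) with pathLength p′ ℚ.≤? pathLength p
      ... | yes p′≤p = fewer h p′ p′≤h λ q → ℚ.≤-trans p′≤p (p-shortest q)
      ... | no  p′≰p = simplified p p-shortest λ q q≤p →
        ℕ.≤-trans ≤h (ℕ.≰⇒> λ q≤h → p′≰p (ℚ.≤-trans (p′-min q q≤h) q≤p))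

  -- The walk serves only to exclude the unreachable case. The result is the canonical geodesic of
  -- the two endpoints, the one whose interior the samples hit.
  geodesic : ∀ {u v} → Path (Edge G) u v → Geodesic u v
  geodesic {u} {v} p with geodesic? u v
  ... | inj₁ g  = g
  ... | inj₂ ¬p = contradiction p ¬p

  reverse-length : ∀ {u v} (g : Geodesic u v) (g′ : Geodesic v u) → pathLength (path g) ≡ pathLength (path g′)
  reverse-length g g′ =
    let r , len , _ = reverse (path g) ; r′ , len′ , _ = reverse (path g′) in
    ℚ.≤-antisym (subst (_ ≤_) len′ (shortest g r′)) (subst (_ ≤_) len (shortest g′ r))

  reverse-hops : ∀ {u v} (g : Geodesic u v) (g′ : Geodesic v u) → hops (path g) ≡ hops (path g′)
  reverse-hops g g′ =
    let r , len , h = reverse (path g) ; r′ , len′ , h′ = reverse (path g′) in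
    ℕ.≤-antisym
      (subst (_ ℕ.≤_) h′ (fewest g r′ (ℚ.≤-reflexive (trans len′ (sym (reverse-length g g′))))))
      (subst (_ ℕ.≤_) h (fewest g′ r (ℚ.≤-reflexive (trans len (reverse-length g g′)))))

  isDist : ∀ {u v} (g : Geodesic u v) → IsDist (Edge G) u v (pathLength (path g))
  isDist g = (path g , refl) , shortest g

-- Subgraphs spanned by a list of pairs

Pairs : ℕ → Set
Pairs n = List (Fin n × Fin n)

Linked : ∀ {n} → Pairs n → Fin n → Fin n → Set
Linked L u v = (u , v) ∈ L ⊎ (v , u) ∈ L

abstract
  linked? : ∀ {n} (L : Pairs n) u v → Dec (Linked L u v)
  linked? L u v = (u , v) ∈? L ⊎-dec (v , u) ∈? L
    where open import Data.List.Membership.DecPropositional (≡-dec Fin._≟_ Fin._≟_) using (_∈?_)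

Linked-mono : ∀ {n} {L L′ : Pairs n} → L ⊆ L′ → ∀ {u v} → Linked L u v → Linked L′ u v
Linked-mono L⊆L′ (inj₁ uv∈) = inj₁ (L⊆L′ uv∈)
Linked-mono L⊆L′ (inj₂ vu∈) = inj₂ (L⊆L′ vu∈)

restrict : ∀ {n} → Graph n → Pairs n → Graph n
restrict {n} G L = record
  { weight   = w
  ; sym      = w-sym
  ; loopless = w-loopless
  ; positive = λ {u v} → w-positive u v
  }
  where
  w : Fin n → Fin n → Maybe ℚ
  w u v = if does (linked? L u v) then weight G u v else nothing
  w-sym : ∀ u v → w u v ≡ w v u
  w-sym u v with linked? L u v | linked? L v u
  ... | yes _ | yes _ = Graph.sym G u v
  ... | no _  | no _  = refl
  ... | yes l | no ¬l = contradiction (swap l) ¬l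
  ... | no ¬l | yes l = contradiction (swap l) ¬l
  w-loopless : ∀ v → w v v ≡ nothing
  w-loopless v with linked? L v v
  ... | yes _ = Graph.loopless G v
  ... | no _  = refl
  w-positive : ∀ u v {x} → w u v ≡ just x → 0ℚ < x
  w-positive u v eq with linked? L u v
  ... | yes _ = Graph.positive G eq

module _ {n} (G : Graph n) (L : Pairs n) where

  restrict-edge⁺ : ∀ {u v w} → Linked L u v → Edge G u v w → Edge (restrict G L) u v w
  restrict-edge⁺ {u} {v} l e with linked? L u v
  ... | yes _ = e
  ... | no ¬l = contradiction l ¬l

  restrict-edge⁻ : ∀ {u v w} → Edge (restrict G L) u v w → Linked L u v × Edge G u v w
  restrict-edge⁻ {u} {v} e with linked? L u v
  ... | yes l = l , e

restrict-⊆ : ∀ {n} (G : Graph n) L → restrict G L ⊆ᴳ G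
restrict-⊆ G L e = proj₂ (restrict-edge⁻ G L e)

allPairs : ∀ n → Pairs n
allPairs n = cartesianProduct (allFin n) (allFin n)

∈-allPairs : ∀ {n} (u v : Fin n) → (u , v) ∈ allPairs n
∈-allPairs u v = ∈-cartesianProduct⁺ (∈-allFin u) (∈-allFin v)

module _ {n} (G : Graph n) where

  private
    orientedWeight : Fin n × Fin n → Maybe ℚ
    orientedWeight (u , v) = if does (u Fin.<? v) then weight G u v else nothing

    present? : ∀ x → Dec (∃[ w ] orientedWeight x ≡ just w)
    present? x with orientedWeight x
    ... | just w  = yes (w , refl)
    ... | nothing = no λ ()

    oriented⁺ : ∀ {u v w} → u Fin.< v → Edge G u v w → orientedWeight (u , v) ≡ just w
    oriented⁺ {u} {v} u<v e rewrite dec-true (u Fin.<? v) u<v = e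

    oriented⁻ : ∀ {u v w} → orientedWeight (u , v) ≡ just w → u Fin.< v × Edge G u v w
    oriented⁻ {u} {v} eq with u Fin.<? v
    ... | yes u<v rewrite dec-true (u Fin.<? v) u<v = u<v , eq
    ... | no  u≮v rewrite dec-false (u Fin.<? v) u≮v with () ← eq

    length-mapMaybe : ∀ xs → length (filter present? xs) ≡ length (mapMaybe orientedWeight xs)
    length-mapMaybe [] = refl
    length-mapMaybe (x ∷ xs) with orientedWeight x
    ... | just _  = cong suc (length-mapMaybe xs)
    ... | nothing = length-mapMaybe xs

    ∈-mapMaybe : ∀ {x w} xs → x ∈ xs → orientedWeight x ≡ just w → w ∈ mapMaybe orientedWeight xs
    ∈-mapMaybe (x ∷ xs) (here refl) eq with orientedWeight x
    ∈-mapMaybe (x ∷ xs) (here refl) refl | just _ = here refl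
    ∈-mapMaybe (y ∷ xs) (there x∈) eq with orientedWeight y
    ... | just _  = there (∈-mapMaybe xs x∈ eq)
    ... | nothing = ∈-mapMaybe xs x∈ eq

  -- Uses the list and the orientation of `edgeWeights`, so that its length is exactly the number of
  -- edges.
  edgePairs : Pairs n
  edgePairs = filter present? (allPairs n)

  length-edgePairs : length edgePairs ≡ #edges G
  length-edgePairs = length-mapMaybe (allPairs n)

  edgePairs-unique : Unique edgePairs
  edgePairs-unique = Unique.filter⁺ present? (Unique.cartesianProduct⁺ (Unique.allFin⁺ n) (Unique.allFin⁺ n))

  edgePairs⁺ : ∀ {u v w} → Edge G u v w → Linked edgePairs u v
  edgePairs⁺ {u} {v} e with Fin.<-cmp u v
  ... | tri< u<v _ _ = inj₁ (∈-filter⁺ present? (∈-allPairs u v) (_ , oriented⁺ u<v e))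
  ... | tri> _ _ v<u = inj₂ (∈-filter⁺ present? (∈-allPairs v u) (_ , oriented⁺ v<u (trans (Graph.sym G v u) e)))
  ... | tri≈ _ refl _ with () ← trans (sym e) (Graph.loopless G u)

  edgePairs⁻ : ∀ {u v} → (u , v) ∈ edgePairs → u Fin.< v × ∃[ w ] Edge G u v w
  edgePairs⁻ {u} {v} uv∈ with proj₂ (∈-filter⁻ present? {xs = allPairs n} uv∈)
  ... | w , eq = let u<v , e = oriented⁻ eq in u<v , w , e

  edge≤W-max : ∀ {u v w} → Edge G u v w → w ≤ W-max G
  edge≤W-max {u} {v} e = ∈⇒≤max (edgeWeights G) (weight∈ e)
    where
    ∈⇒≤max : ∀ {w} ws → w ∈ ws → w ≤ foldr _⊔_ 0ℚ ws
    ∈⇒≤max (w ∷ ws) (here refl) = ℚ.p≤p⊔q w _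
    ∈⇒≤max (w ∷ ws) (there x∈) = ℚ.≤-trans (∈⇒≤max ws x∈) (ℚ.p≤q⊔p w _)
    weight∈ : ∀ {u v w} → Edge G u v w → w ∈ edgeWeights G
    weight∈ {u} {v} e with Fin.<-cmp u v
    ... | tri< u<v _ _ = ∈-mapMaybe (allPairs n) (∈-allPairs u v) (oriented⁺ u<v e)
    ... | tri> _ _ v<u = ∈-mapMaybe (allPairs n) (∈-allPairs v u) (oriented⁺ v<u (trans (Graph.sym G v u) e))
    ... | tri≈ _ refl _ with () ← trans (sym e) (Graph.loopless G u)

  0≤W-max : 0ℚ ≤ W-max G
  0≤W-max = 0≤max (edgeWeights G)
    where
    0≤max : ∀ ws → 0ℚ ≤ foldr _⊔_ 0ℚ ws
    0≤max []       = ℚ.≤-refl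
    0≤max (w ∷ ws) = ℚ.≤-trans (0≤max ws) (ℚ.p≤q⊔p w _)

-- Once every pair of `L` is sorted, all edges of the restriction, listed once as sorted pairs,
-- occur in the resulting list.
#edges-restrict : ∀ {n} (G : Graph n) L → #edges (restrict G L) ℕ.≤ length L
#edges-restrict {n} G L = begin
  #edges (restrict G L) ≡⟨ length-edgePairs (restrict G L) ⟨
  length (edgePairs (restrict G L)) ≤⟨ Unique-⊆⇒length≤ (edgePairs-unique (restrict G L)) oriented ⟩
  length (map orient L) ≡⟨ length-map orient L ⟩
  length L ∎
  where
  open ℕ.≤-Reasoning
  orient : Fin n × Fin n → Fin n × Fin n
  orient (u , v) = if does (u Fin.<? v) then (u , v) else (v , u)
  orient-< : ∀ {u v} → u Fin.< v → orient (u , v) ≡ (u , v)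
  orient-< {u} {v} u<v rewrite dec-true (u Fin.<? v) u<v = refl
  orient-> : ∀ {u v} → v Fin.< u → orient (u , v) ≡ (v , u)
  orient-> {u} {v} v<u rewrite dec-false (u Fin.<? v) (Fin.<-asym v<u) = refl
  oriented : edgePairs (restrict G L) ⊆ map orient L
  oriented uv∈ with edgePairs⁻ (restrict G L) uv∈
  ... | u<v , _ , e with proj₁ (restrict-edge⁻ G L e)
  ... | inj₁ l = subst (_∈ map orient L) (orient-< u<v) (∈-map⁺ orient l)
  ... | inj₂ l = subst (_∈ map orient L) (orient-> u<v) (∈-map⁺ orient l)

module _ {n} {R R′ : WeightedEdges n} (R⊆R′ : ∀ {u v w} → R u v w → R′ u v w) where

  mapPath : ∀ {u v} (p : Path R u v) → Σ[ q ∈ Path R′ u v ] pathLength q ≡ pathLength p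
  mapPath ε             = ε , refl
  mapPath ((w , e) ◅ p) = let q , len = mapPath p in (w , R⊆R′ e) ◅ q , cong (w +_) len

module _ {n} {R : WeightedEdges n} where

  edges : ∀ {u v} → Path R u v → Pairs n
  edges                   ε       = []
  edges {u} (_◅_ {j = x} _ p) = (u , x) ∷ edges p

  length-edges : ∀ {u v} (p : Path R u v) → length (edges p) ≡ hops p
  length-edges ε       = refl
  length-edges (_ ◅ p) = cong suc (length-edges p)

restrictPath : ∀ {n} (G : Graph n) {L u v} (p : Path (Edge G) u v) → edges p ⊆ L →
  Σ[ q ∈ Path (Edge (restrict G L)) u v ] pathLength q ≡ pathLength p
restrictPath G ε             _   = ε , refl
restrictPath G {L} ((w , e) ◅ p) sub with restrictPath G p (sub ∘ there)
... | q , len = (w , restrict-edge⁺ G L (inj₁ (sub (here refl))) e) ◅ q , cong (w +_) len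

-- Routes of bounded length and stretch

Route : ∀ {n} → Graph n → Fin n → Fin n → ℚ → Set
Route G u v ℓ = Σ[ p ∈ Path (Edge G) u v ] pathLength p ≤ ℓ

-- Quantifying over walks instead of distances makes the condition empty for unreachable pairs and
-- lets it compose without choosing shortest paths.
Approximates : ∀ {n} → ℚ → Graph n → Graph n → Fin n → Fin n → Set
Approximates s G G′ u v = ∀ (p : Path (Edge G) u v) → Route G′ u v (s * pathLength p)

Approximates-sym : ∀ {n s} (G G′ : Graph n) {u v} → Approximates s G G′ u v → Approximates s G G′ v u
Approximates-sym {s = s} G G′ approx p =
  let q , len , _ = reverse G p ; q′ , le = approx q ; p′ , len′ , _ = reverse G′ q′ in
  p′ , subst₂ _≤_ (sym len′) (cong (s *_) len) le

Preserves : ∀ {n} → ℚ → Graph n → Pairs n → Pairs n → Set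
Preserves s G P L = ∀ {u v} → (u , v) ∈ P → Approximates s G (restrict G L) u v

Preserves-linked : ∀ {n s} (G : Graph n) {P L} → Preserves s G P L →
  ∀ {u v} → Linked P u v → Approximates s G (restrict G L) u v
Preserves-linked G         pres (inj₁ uv∈) = pres uv∈
Preserves-linked {s = s} G {L = L} pres (inj₂ vu∈) = Approximates-sym {s = s} G (restrict G L) (pres vu∈)

-- A distance bound on walks transfers to IsDist because shortest paths exist.
distBound : ∀ {n} (G G′ : Graph n) (f : ℚ → ℚ) {u v x y} →
  (∀ (p : Path (Edge G) x y) → Route G′ u v (f (pathLength p))) →
  dist⟨ G′ , u , v ⟩≤ f ⟨dist⟨ G , x , y ⟩⟩
distBound G G′ f bound d ((p , refl) , _) =
  let p′ , le = bound p ; g = geodesic G′ p′ in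
  pathLength (Geodesic.path g) , isDist G′ g , ℚ.≤-trans (Geodesic.shortest g p′) le

-- Sampled skeleton graphs

length-allPairs : ∀ n → length (allPairs n) ≡ n ℕ.* n
length-allPairs n = trans (length-cartesianProduct (allFin n) (allFin n)) (cong₂ ℕ._*_ (length-allFin n) (length-allFin n))

lookup-injective : ∀ {A : Set} {xs : List A} → Unique xs → ∀ {i j} → lookup xs i ≡ lookup xs j → i ≡ j
lookup-injective (_ ∷ _)    {zero}  {zero}  _  = refl
lookup-injective (x∉ ∷ _)   {zero}  {suc j} eq = contradiction eq (All.lookup x∉ (∈-lookup j))
lookup-injective (x∉ ∷ _)   {suc i} {zero}  eq = contradiction (sym eq) (All.lookup x∉ (∈-lookup i))
lookup-injective (_ ∷ uniq) {suc i} {suc j} eq = cong suc (lookup-injective uniq eq)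

module _ {n} (G : Graph n) where

  open Geodesic

  inside : Fin n → Fin n → List (Fin n)
  inside u v with geodesic? G u v
  ... | inj₁ g = interior (path g)
  ... | inj₂ _ = []

  inside-geodesic : ∀ {u v} (p : Path (Edge G) u v) → inside u v ≡ interior (path (geodesic G p))
  inside-geodesic {u} {v} p with geodesic? G u v
  ... | inj₁ _  = refl
  ... | inj₂ ¬p = contradiction p ¬p

  inside-unique : ∀ u v → Unique (inside u v)
  inside-unique u v with geodesic? G u v
  ... | inj₁ g = interior-unique (path g) (simple g)
  ... | inj₂ _ = []

  HitsInsides : ℕ → List (Fin n) → Set
  HitsInsides t A = ∀ u v → t ℕ.≤ length (inside u v) → ∃[ x ] x ∈ A × x ∈ inside u v

  abstract
    insides-hit : ∀ t .{{_ : NonZero t}} h → n ℕ.* n ℕ.< 2 ℕ.^ h →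
      ∃[ A ] Unique A × HitsInsides t A × length A ℕ.* t ℕ.≤ h ℕ.* (2 ℕ.* n)
    insides-hit t h n²<2^h = result
      where
      open HittingSet Fin._≟_ (allFin n) t
      long? : ∀ uv → Dec (t ℕ.≤ length (uncurry inside uv))
      long? uv = t ℕ.≤? length (uncurry inside uv)
      family : List (List (Fin n))
      family = map (uncurry inside) (filter long? (allPairs n))
      large : All Large family
      large = All.tabulate λ f∈ → let (u , v) , uv∈ , eq = ∈-map⁻ (uncurry inside) f∈ in
        subst Large (sym eq) (inside-unique u v , (λ {x} _ → ∈-allFin x) , proj₂ (∈-filter⁻ long? {xs = allPairs n} uv∈))
      small : length family ℕ.< 2 ℕ.^ h
      small = ℕ.≤-<-trans (ℕ.≤-trans (ℕ.≤-reflexive (length-map _ (filter long? (allPairs n))))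
        (ℕ.≤-trans (length-filter long? (allPairs n)) (ℕ.≤-reflexive (length-allPairs n)))) n²<2^h
      result : ∃[ A ] Unique A × HitsInsides t A × length A ℕ.* t ℕ.≤ h ℕ.* (2 ℕ.* n)
      result with hitting-set h family large small
      ... | A , A-unique , _ , A-hits , A-size = A , A-unique ,
        (λ u v long → A-hits (∈-map⁺ _ (∈-filter⁺ long? (∈-allPairs u v) long))) ,
        subst (λ m → length A ℕ.* t ℕ.≤ h ℕ.* (2 ℕ.* m)) (length-allFin n) A-size

  short : ∀ t a b → Dec (Σ[ g ∈ Geodesic G a b ] hops (path g) ℕ.≤ t)
  short t a b with geodesic? G a b
  ... | inj₂ ¬p = no λ (g , _) → ¬p (path g)
  ... | inj₁ g with hops (path g) ℕ.≤? t
  ... | yes ≤t = yes (g , ≤t)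
  ... | no ≰t  = no λ (g′ , ≤t) → ≰t (ℕ.≤-trans (fewest g (path g′) (shortest g′ (path g))) ≤t)

  module Skeleton (t : ℕ) (A : List (Fin n)) (A-unique : Unique A) where

    private
      m = length A
      emb : Fin m → Fin n
      emb = lookup A

    -- Two samples are adjacent if a geodesic between them has at most t edges, and the weight is
    -- their distance. The decisions are arguments so that the proofs below can abstract over them.
    shortcut : ∀ a b → Dec (emb a ≡ emb b) → Dec (Σ[ g ∈ Geodesic G (emb a) (emb b) ] hops (path g) ℕ.≤ t) → Maybe ℚ
    shortcut a b (no _) (yes (g , _)) = just (pathLength (path g))
    shortcut a b _      _             = nothing

    skeleton : Graph m
    skeleton = record
      { weight   = λ a b → shortcut a b (emb a Fin.≟ emb b) (short t (emb a) (emb b))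
      ; sym      = shortcut-sym
      ; loopless = λ a → shortcut-loopless a
      ; positive = λ {a} {b} → shortcut-positive a b
      }
      where
      shortcut-sym : ∀ a b → shortcut a b (emb a Fin.≟ emb b) (short t (emb a) (emb b)) ≡
                             shortcut b a (emb b Fin.≟ emb a) (short t (emb b) (emb a))
      shortcut-sym a b with emb a Fin.≟ emb b | emb b Fin.≟ emb a | short t (emb a) (emb b) | short t (emb b) (emb a)
      ... | yes _  | yes _  | _ | _ = refl
      ... | yes eq | no neq | _ | _ = contradiction (sym eq) neq
      ... | no neq | yes eq | _ | _ = contradiction (sym eq) neq
      ... | no _ | no _ | no _ | no _ = refl
      ... | no _ | no _ | yes (g , _) | yes (g′ , _) = cong just (reverse-length G g g′)
      ... | no _ | no _ | yes (g , ≤t) | no none = contradiction (g′ , subst (ℕ._≤ t) (reverse-hops G g g′) ≤t) none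
        where g′ = geodesic G (proj₁ (reverse G (path g)))
      ... | no _ | no _ | no none | yes (g , ≤t) = contradiction (g′ , subst (ℕ._≤ t) (reverse-hops G g g′) ≤t) none
        where g′ = geodesic G (proj₁ (reverse G (path g)))
      shortcut-loopless : ∀ a → shortcut a a (emb a Fin.≟ emb a) (short t (emb a) (emb a)) ≡ nothing
      shortcut-loopless a with emb a Fin.≟ emb a
      ... | yes _  = refl
      ... | no neq = contradiction refl neq
      shortcut-positive : ∀ a b {w} → shortcut a b (emb a Fin.≟ emb b) (short t (emb a) (emb b)) ≡ just w → 0ℚ < w
      shortcut-positive a b eq with emb a Fin.≟ emb b | short t (emb a) (emb b)
      shortcut-positive a b refl | no a≢b | yes (g , _) = 0<pathLength G a≢b (path g)

    skeleton-edge⁻ : ∀ {a b w} → Edge skeleton a b w →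
      Σ[ p ∈ Path (Edge G) (emb a) (emb b) ] pathLength p ≡ w × hops p ℕ.≤ t
    skeleton-edge⁻ {a} {b} eq with emb a Fin.≟ emb b | short t (emb a) (emb b)
    skeleton-edge⁻ {a} {b} refl | no a≢b | yes (g , ≤t) = path g , refl , ≤t

    skeleton-edge⁺ : ∀ {a b} → a ≢ b → (g : Geodesic G (emb a) (emb b)) → hops (path g) ℕ.≤ t →
      Edge skeleton a b (pathLength (path g))
    skeleton-edge⁺ {a} {b} a≢b g ≤t with emb a Fin.≟ emb b | short t (emb a) (emb b)
    ... | yes eq | _ = contradiction (lookup-injective A-unique eq) a≢b
    ... | no _ | no none = contradiction (g , ≤t) none
    ... | no _ | yes (g′ , _) = cong just (ℚ.≤-antisym (shortest g′ (path g)) (shortest g (path g′)))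

    expand : ∀ {a b} (q : Path (Edge skeleton) a b) → Σ[ p ∈ Path (Edge G) (emb a) (emb b) ] pathLength p ≡ pathLength q
    expand ε = ε , refl
    expand ((w , e) ◅ q) = let p₁ , len₁ , _ = skeleton-edge⁻ e ; p₂ , len₂ = expand q in
      p₁ ◅◅ p₂ , trans (pathLength-◅◅ p₁ p₂) (cong₂ _+_ len₁ len₂)

    -- Induction on the number of edges of a canonical geodesic, which is hit in
    -- its interior as soon as it has more than t edges.
    module _ (A-hits : HitsInsides t A) where

      private
        hit : ∀ {u v} (p : Path (Edge G) u v) → t ℕ.< hops (path (geodesic G p)) →
          ∃[ c ] emb c ∈ interior (path (geodesic G p))
        hit {u} {v} p t< with A-hits u v (subst (λ xs → t ℕ.≤ length xs) (sym (inside-geodesic p)) (long (path (geodesic G p)) t<))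
          where
          long : ∀ {u v} (q : Path (Edge G) u v) → t ℕ.< hops q → t ℕ.≤ length (interior q)
          long (_ ◅ q) (s≤s t≤) = subst (t ℕ.≤_) (sym (length-initial q)) t≤
        ... | x , x∈A , x∈ = Any.index x∈A , subst₂ _∈_ (lookup-index x∈A) (inside-geodesic p) x∈

        -- Pieces of a shortest path are shortest, whence their canonical geodesics are no longer.
        piece : ∀ {u v x} (g : Geodesic G u v) (p₁ : Path (Edge G) u x) (p₂ : Path (Edge G) x v) →
          pathLength p₁ + pathLength p₂ ≡ pathLength (path g) →
          hops (path (geodesic G p₁)) ℕ.≤ hops p₁ × hops (path (geodesic G p₂)) ℕ.≤ hops p₂
        piece g p₁ p₂ eq = fewest g₁ p₁ (+-cancelʳ-≤ (pathLength p₂) (le (path g₁) p₂)) ,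
                           fewest g₂ p₂ (+-cancelˡ-≤ (pathLength p₁) (le p₁ (path g₂)))
          where
          g₁ = geodesic G p₁
          g₂ = geodesic G p₂
          le : ∀ q₁ q₂ → pathLength p₁ + pathLength p₂ ≤ pathLength q₁ + pathLength q₂
          le q₁ q₂ = subst₂ _≤_ (sym eq) (pathLength-◅◅ q₁ q₂) (shortest g (q₁ ◅◅ q₂))

      near : ∀ h {u b} (p : Path (Edge G) u (emb b)) → hops (path (geodesic G p)) ℕ.≤ h →
        ∃[ a ] Σ[ g ∈ Geodesic G u (emb a) ] Σ[ q ∈ Path (Edge skeleton) a b ]
          hops (path g) ℕ.≤ t × pathLength (path g) + pathLength q ≤ pathLength p
      near h {u} {b} p ≤h with hops (path (geodesic G p)) ℕ.≤? t
      ... | yes ≤t = b , geodesic G p , ε , ≤t ,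
        subst (_≤ pathLength p) (sym (ℚ.+-identityʳ _)) (shortest (geodesic G p) p)
      near zero p ≤0 | no ≰t = contradiction (ℕ.≤-trans ≤0 z≤n) ≰t
      near (suc h) {u} {b} p ≤h | no ≰t with hit p (ℕ.≰⇒> ≰t)
      ... | c , c∈ with split-interior (path (geodesic G p)) c∈
      ... | p₁ , p₂ , len , h₁ , h₂ with piece (geodesic G p) p₁ p₂ len
      -- As c is a sample, both parts again end in a sample, and both have fewer edges.
      ... | h₁′ , h₂′ with near h p₁ (ℕ.≤-trans h₁′ (ℕ.≤-pred (ℕ.≤-trans h₁ ≤h))) | near h p₂ (ℕ.≤-trans h₂′ (ℕ.≤-pred (ℕ.≤-trans h₂ ≤h)))
      ... | a , g , q₁ , ≤t , le₁ | a′ , g′ , q₂ , ≤t′ , le₂ = a , g , q₁ ◅◅ proj₁ join , ≤t , (begin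
        pathLength (path g) + pathLength (q₁ ◅◅ proj₁ join)
          ≡⟨ cong (pathLength (path g) +_) (pathLength-◅◅ q₁ (proj₁ join)) ⟩
        pathLength (path g) + (pathLength q₁ + pathLength (proj₁ join))
          ≡⟨ ℚ.+-assoc (pathLength (path g)) _ _ ⟨
        pathLength (path g) + pathLength q₁ + pathLength (proj₁ join)
          ≤⟨ ℚ.+-mono-≤ le₁ (ℚ.≤-trans (proj₂ join) le₂) ⟩
        pathLength p₁ + pathLength p₂ ≡⟨ len ⟩
        pathLength (path (geodesic G p)) ≤⟨ shortest (geodesic G p) p ⟩
        pathLength p ∎)
        where
        open ℚ.≤-Reasoning
        -- The piece from c to a′ has at most t edges and thus is a skeleton edge. If c and a′
        -- coincide there is no loop to use, and the piece is dropped.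
        join : Route skeleton c b (pathLength (path g′) + pathLength q₂)
        join with c Fin.≟ a′
        ... | yes refl = q₂ , p≤q+p′ (0≤pathLength G (path g′))
        ... | no c≢a′  = (_ , skeleton-edge⁺ c≢a′ g′ ≤t′) ◅ q₂ , ℚ.≤-refl

      -- A long geodesic is cut at a sample c. Both parts are directed towards c, the second one by
      -- reversal, so that `near` applies to each; the two skeleton walks meet in c.
      reach : ∀ {u v} (p : Path (Edge G) u v) →
        (Σ[ r ∈ Path (Edge G) u v ] hops r ℕ.≤ t × pathLength r ≤ pathLength p) ⊎
        (∃[ a ] ∃[ b ] Σ[ r ∈ Path (Edge G) u (emb a) ] Σ[ q ∈ Path (Edge skeleton) a b ] Σ[ r′ ∈ Path (Edge G) (emb b) v ]
          hops r ℕ.≤ t × hops r′ ℕ.≤ t × pathLength r + pathLength q + pathLength r′ ≤ pathLength p)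
      reach {u} {v} p with hops (path (geodesic G p)) ℕ.≤? t
      ... | yes ≤t = inj₁ (path (geodesic G p) , ≤t , shortest (geodesic G p) p)
      ... | no ≰t with hit p (ℕ.≰⇒> ≰t)
      ... | c , c∈ with split-interior (path (geodesic G p)) c∈
      ... | p₁ , p₂ , len , _ with near _ p₁ ℕ.≤-refl | near _ (proj₁ (reverse G p₂)) ℕ.≤-refl
      ... | a , g , q , ≤t , le | b , g′ , q′ , ≤t′ , le′ =
        inj₂ (a , b , path g , q ◅◅ q″ , r′ , ≤t , subst (ℕ._≤ t) (sym r′-hops) ≤t′ , (begin
          pathLength (path g) + pathLength (q ◅◅ q″) + pathLength r′
            ≡⟨ cong₂ (λ x y → pathLength (path g) + x + y) (pathLength-◅◅ q q″) r′-len ⟩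
          pathLength (path g) + (pathLength q + pathLength q″) + pathLength (path g′)
            ≡⟨ cong (λ x → pathLength (path g) + (pathLength q + x) + pathLength (path g′)) q″-len ⟩
          pathLength (path g) + (pathLength q + pathLength q′) + pathLength (path g′)
            ≡⟨ rearrange (pathLength (path g)) (pathLength q) (pathLength q′) (pathLength (path g′)) ⟩
          (pathLength (path g) + pathLength q) + (pathLength (path g′) + pathLength q′)
            ≤⟨ ℚ.+-mono-≤ le le′ ⟩
          pathLength p₁ + pathLength (proj₁ (reverse G p₂))
            ≡⟨ cong (pathLength p₁ +_) (proj₁ (proj₂ (reverse G p₂))) ⟩
          pathLength p₁ + pathLength p₂ ≡⟨ len ⟩
          pathLength (path (geodesic G p)) ≤⟨ shortest (geodesic G p) p ⟩
          pathLength p ∎))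
        where
        open ℚ.≤-Reasoning
        rev  = reverse skeleton q′
        q″   = proj₁ rev
        q″-len = proj₁ (proj₂ rev)
        rev′ = reverse G (path g′)
        r′   = proj₁ rev′
        r′-len = proj₁ (proj₂ rev′)
        r′-hops = proj₂ (proj₂ rev′)
        rearrange : ∀ a b c d → a + (b + c) + d ≡ a + b + (d + c)
        rearrange = ring-solve-∀ ℚ-ring

-- Preservers from hopsets

module Realisation {n} (G : Graph n) (s : ℚ) (1≤s : 1ℚ ≤ s) (P : Pairs n) where

  private
    0≤s = ℚ.≤-trans 0≤1 1≤s

  -- The list `L` stays open, since it will also contain the edges that preserve `P`. Only edges
  -- taken directly from `G` are counted by m; pairs in `P` are free here and are paid for when `P`
  -- is preserved.
  Realised : Fin n → Fin n → ℚ → ℕ → Set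
  Realised u v ℓ m = Σ[ E ∈ Pairs n ] length E ℕ.≤ m ×
    (∀ L → E ⊆ L → Preserves s G P L → Route (restrict G L) u v (s * ℓ))

  realise-≤ : ∀ {u v ℓ ℓ′ m m′} → ℓ ≤ ℓ′ → m ℕ.≤ m′ → Realised u v ℓ m → Realised u v ℓ′ m′
  realise-≤ ℓ≤ m≤ (E , size , rec) = E , ℕ.≤-trans size m≤ , λ L E⊆L pres →
    let p , le = rec L E⊆L pres in p , ℚ.≤-trans le (*-monoˡ-≤ 0≤s ℓ≤)

  realise-path : ∀ {u v} (p : Path (Edge G) u v) → Realised u v (pathLength p) (hops p)
  realise-path p = edges p , ℕ.≤-reflexive (length-edges p) , λ L p⊆L _ →
    let q , len = restrictPath G p p⊆L in q ,
    subst (_≤ s * pathLength p) (trans (ℚ.*-identityˡ _) (sym len)) (*-monoʳ-≤ (0≤pathLength G p) 1≤s)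

  realise-pair : ∀ {u v} → Linked P u v → (p : Path (Edge G) u v) → Realised u v (pathLength p) 0
  realise-pair l p = [] , z≤n , λ L _ pres → Preserves-linked {s = s} G pres l p

  realise-◅◅ : ∀ {u v w ℓ ℓ′ m m′} → Realised u v ℓ m → Realised v w ℓ′ m′ → Realised u w (ℓ + ℓ′) (m ℕ.+ m′)
  realise-◅◅ {ℓ = ℓ} {ℓ′} (E , size , rec) (E′ , size′ , rec′) = E ++ E′ ,
    subst (ℕ._≤ _) (sym (length-++ E)) (ℕ.+-mono-≤ size size′) ,
    λ L sub pres →
      let p , le = rec L (sub ∘ ∈-++⁺ˡ) pres ; q , le′ = rec′ L (sub ∘ ∈-++⁺ʳ E) pres in
      p ◅◅ q , subst₂ _≤_ (sym (pathLength-◅◅ p q)) (sym (ℚ.*-distribˡ-+ s ℓ ℓ′)) (ℚ.+-mono-≤ le le′)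

  -- One geodesic per connected pair is realised. It serves every walk between its endpoints, being
  -- no longer than any of them.
  realise-pairs : ∀ {σ} m → 0ℚ ≤ σ → (∀ {u v} (p : Path (Edge G) u v) → Realised u v (σ * pathLength p) m) → ∀ Q →
    Σ[ E ∈ Pairs n ] length E ℕ.≤ length Q ℕ.* m ×
      (∀ L → E ⊆ L → Preserves s G P L → Preserves (s * σ) G Q L)
  realise-pairs m 0≤σ realise [] = [] , z≤n , λ _ _ _ ()
  realise-pairs {σ} m 0≤σ realise ((u , v) ∷ Q) with geodesic? G u v | realise-pairs m 0≤σ realise Q
  ... | inj₂ ¬p | E , size , rec = E , ℕ.≤-trans size (ℕ.m≤n+m _ m) , λ where
    L sub pres (here refl) p → contradiction p ¬p
    L sub pres (there uv∈) p → rec L sub pres uv∈ p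
  ... | inj₁ g | E , size , rec with realise (Geodesic.path g)
  ... | E′ , size′ , rec′ = E′ ++ E , subst (ℕ._≤ _) (sym (length-++ E′)) (ℕ.+-mono-≤ size′ size) , λ where
    L sub pres (here refl) p → let q , le = rec′ L (sub ∘ ∈-++⁺ˡ) pres in
      q , ℚ.≤-trans le (subst (s * (σ * pathLength (Geodesic.path g)) ≤_) (sym (ℚ.*-assoc s σ _))
        (*-monoˡ-≤ 0≤s (*-monoˡ-≤ 0≤σ (Geodesic.shortest g p))))
    L sub pres (there uv∈) p → rec L (sub ∘ ∈-++⁺ʳ E′) pres uv∈ p

module _ {n} (G : Graph n) (t : ℕ) (A : List (Fin n)) (A-unique : Unique A) where

  open Skeleton G t A A-unique

  private
    emb : Fin (length A) → Fin n
    emb = lookup A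

    embPair : Fin (length A) × Fin (length A) → Fin n × Fin n
    embPair (a , b) = emb a , emb b

  hopsetPairs : Graph (length A) → Pairs n
  hopsetPairs H = map embPair (edgePairs H)

  length-hopsetPairs : ∀ H → length (hopsetPairs H) ≡ #edges H
  length-hopsetPairs H = trans (length-map embPair (edgePairs H)) (length-edgePairs H)

  module _ {β ϵ H} (0≤ϵ : 0ℚ ≤ ϵ) (hopset : IsHopset β ϵ skeleton H) (s : ℚ) (1≤s : 1ℚ ≤ s) where

    open Realisation G s 1≤s (hopsetPairs H)

    -- A skeleton edge unrolls to at most t edges of `G`; a hopset edge is a pair of the preserved
    -- list and contributes none.
    realise-mixed : ∀ {a b} (q : Path (skeleton ∪ᴱ H) a b) →
      Realised (emb a) (emb b) (pathLength q) (hops q ℕ.* t)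
    realise-mixed ε = realise-path ε
    realise-mixed ((w , e) ◅ q) = realise-◅◅ (realise-edge e) (realise-mixed q)
      where
      linked : ∀ {a b} → Linked (edgePairs H) a b → Linked (hopsetPairs H) (emb a) (emb b)
      linked (inj₁ l) = inj₁ (∈-map⁺ embPair l)
      linked (inj₂ l) = inj₂ (∈-map⁺ embPair l)
      realise-edge : ∀ {a b w} → (skeleton ∪ᴱ H) a b w → Realised (emb a) (emb b) w t
      realise-edge (inj₁ e) with skeleton-edge⁻ e
      ... | p , refl , ≤t = realise-≤ ℚ.≤-refl ≤t (realise-path p)
      realise-edge (inj₂ e) with proj₁ hopset e
      ... | (q , refl) , _ with expand q
      ... | p , len = realise-≤ (ℚ.≤-reflexive len) z≤n
        (realise-pair (linked (edgePairs⁺ H e)) p)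

    module _ (A-hits : HitsInsides G t A) where

      -- The count β + 2 stands for the β hops between the samples and the two pieces that lead from
      -- the endpoints to them, each of at most t edges.
      realise : ∀ {u v} (p : Path (Edge G) u v) →
        Realised u v ((1ℚ + ϵ) * pathLength p) ((β ℕ.+ 2) ℕ.* t)
      realise p with reach A-hits p
      ... | inj₁ (r , ≤t , le) = realise-≤
        (ℚ.≤-trans le (x≤[1+ϵ]*x 0≤ϵ (0≤pathLength G p))) (ℕ.≤-trans ≤t (ℕ.m≤n*m t (β ℕ.+ 2) {{ℕ.>-nonZero (ℕ.m≤n⇒m≤o+n β (s≤s z≤n))}})) (realise-path r)
      ... | inj₂ (a , b , r , q , r′ , ≤t , ≤t′ , le)
        with proj₂ hopset a b _ (isDist skeleton (geodesic skeleton q))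
      ... | d′ , ((h , ≤β , refl) , _) , _ , d′≤ = realise-≤
        (begin
          pathLength r + pathLength h + pathLength r′
            ≤⟨ ℚ.+-mono-≤ (ℚ.+-mono-≤ (x≤[1+ϵ]*x 0≤ϵ (0≤pathLength G r))
                 (ℚ.≤-trans d′≤ (*-monoˡ-≤ 0≤1+ϵ (Geodesic.shortest (geodesic skeleton q) q)))) (x≤[1+ϵ]*x 0≤ϵ (0≤pathLength G r′)) ⟩
          (1ℚ + ϵ) * pathLength r + (1ℚ + ϵ) * pathLength q + (1ℚ + ϵ) * pathLength r′
            ≡⟨ factor (1ℚ + ϵ) (pathLength r) (pathLength q) (pathLength r′) ⟩
          (1ℚ + ϵ) * (pathLength r + pathLength q + pathLength r′)
            ≤⟨ *-monoˡ-≤ 0≤1+ϵ le ⟩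
          (1ℚ + ϵ) * pathLength p ∎)
        (ℕ.≤-trans (ℕ.+-mono-≤ (ℕ.+-mono-≤ ≤t (ℕ.*-monoˡ-≤ t ≤β)) ≤t′) (ℕ.≤-reflexive (count β t)))
        (realise-◅◅
          (realise-◅◅ (realise-path r) (realise-mixed h))
          (realise-path r′))
        where
        open ℚ.≤-Reasoning
        0≤1+ϵ : 0ℚ ≤ 1ℚ + ϵ
        0≤1+ϵ = 0≤+ 0≤1 0≤ϵ
        factor : ∀ c x y z → c * x + c * y + c * z ≡ c * (x + y + z)
        factor = ring-solve-∀ ℚ-ring
        count : ∀ β t → t ℕ.+ β ℕ.* t ℕ.+ t ≡ (β ℕ.+ 2) ℕ.* t
        count = solve-∀

abstract
  -- The guarantee is used with r = R/2ʸ. Thereby the saving 2ʸ of a sparse sample is expressed by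
  -- natural numbers, without roots.
  hopset-size : ∀ {C} → HopsetGuarantee C → ∀ {m} (G : Graph m) k → 1 ℕ.≤ k → ∀ ϵ .{{_ : Positive ϵ}} → ϵ < 1ℚ →
    ∃[ β ] ∃[ H ] IsHopset β ϵ G H × fromℕ β ≤ hopBound C k ϵ ×
      (∀ R y → let K = 2 ℕ.^ suc k ℕ.∸ 1 in
        m ℕ.^ suc K ℕ.* (2 ℕ.^ y) ℕ.^ K ℕ.≤ R ℕ.^ K → #edges H ℕ.* 2 ℕ.^ y ℕ.≤ C ℕ.* R)
  hopset-size {C} guarantee {m} G k 1≤k ϵ ϵ<1 with guarantee G k 1≤k ϵ ϵ<1
  ... | β , H , hopset , β≤ , size = β , H , hopset , β≤ , bound
    where
    K : ℕ
    K = 2 ℕ.^ suc k ℕ.∸ 1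
    bound : ∀ R y → m ℕ.^ suc K ℕ.* (2 ℕ.^ y) ℕ.^ K ℕ.≤ R ℕ.^ K → #edges H ℕ.* 2 ℕ.^ y ℕ.≤ C ℕ.* R
    bound R y le = fromℕ-cancel-≤ (begin
      fromℕ (#edges H ℕ.* 2 ℕ.^ y) ≡⟨ fromℕ-* (#edges H) _ ⟩
      fromℕ (#edges H) * Y ≤⟨ *-monoʳ-≤ (0≤fromℕ (2 ℕ.^ y)) (size (fromℕ R * 1/Y) (0≤* (0≤fromℕ R) 0≤1/Y , power)) ⟩
      fromℕ C * (fromℕ R * 1/Y) * Y ≡⟨ assoc (fromℕ C) (fromℕ R) 1/Y Y ⟩
      fromℕ C * fromℕ R * (Y * 1/Y) ≡⟨ cong (fromℕ C * fromℕ R *_) Y*1/Y ⟩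
      fromℕ C * fromℕ R * 1ℚ ≡⟨ ℚ.*-identityʳ _ ⟩
      fromℕ C * fromℕ R ≡⟨ fromℕ-* C R ⟨
      fromℕ (C ℕ.* R) ∎)
      where
      open ℚ.≤-Reasoning
      Y : ℚ
      Y = fromℕ (2 ℕ.^ y)
      instance
        Y-pos : Positive Y
        Y-pos = ℚ.positive (ℚ.<-≤-trans (ℚ.positive⁻¹ 1ℚ) (fromℕ-mono-≤ (ℕ.m^n>0 2 y)))
      1/Y : ℚ
      1/Y = (1/ Y) {{ℚ.pos⇒nonZero Y}}
      0≤1/Y : 0ℚ ≤ 1/Y
      0≤1/Y = 0≤1/ Y
      Y*1/Y : Y * 1/Y ≡ 1ℚ
      Y*1/Y = 1/-inverseʳ Y
      assoc : ∀ a b c d → a * (b * c) * d ≡ a * b * (d * c)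
      assoc = ring-solve-∀ ℚ-ring
      power : fromℕ m ^ suc K ≤ (fromℕ R * 1/Y) ^ K
      power = begin
        fromℕ m ^ suc K ≡⟨ ℚ.*-identityʳ _ ⟨
        fromℕ m ^ suc K * 1ℚ ≡⟨ cong (fromℕ m ^ suc K *_) (1^ K) ⟨
        fromℕ m ^ suc K * 1ℚ ^ K ≡⟨ cong (λ z → fromℕ m ^ suc K * z ^ K) Y*1/Y ⟨
        fromℕ m ^ suc K * (Y * 1/Y) ^ K ≡⟨ cong (fromℕ m ^ suc K *_) (^-distrib-* Y 1/Y K) ⟩
        fromℕ m ^ suc K * (Y ^ K * 1/Y ^ K) ≡⟨ ℚ.*-assoc (fromℕ m ^ suc K) (Y ^ K) (1/Y ^ K) ⟨
        fromℕ m ^ suc K * Y ^ K * 1/Y ^ K ≡⟨ cong (_* 1/Y ^ K) nat ⟩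
        fromℕ (m ℕ.^ suc K ℕ.* (2 ℕ.^ y) ℕ.^ K) * 1/Y ^ K
          ≤⟨ *-monoʳ-≤ (0≤^ K 0≤1/Y) (fromℕ-mono-≤ le) ⟩
        fromℕ (R ℕ.^ K) * 1/Y ^ K ≡⟨ cong (_* 1/Y ^ K) (fromℕ-^ R K) ⟩
        fromℕ R ^ K * 1/Y ^ K ≡⟨ ^-distrib-* (fromℕ R) 1/Y K ⟨
        (fromℕ R * 1/Y) ^ K ∎
        where
        1^ : ∀ k → 1ℚ ^ k ≡ 1ℚ
        1^ zero    = refl
        1^ (suc k) = trans (ℚ.*-identityˡ _) (1^ k)
        nat : fromℕ m ^ suc K * Y ^ K ≡ fromℕ (m ℕ.^ suc K ℕ.* (2 ℕ.^ y) ℕ.^ K)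
        nat = sym (trans (fromℕ-* (m ℕ.^ suc K) _) (cong₂ _*_ (fromℕ-^ m (suc K)) (fromℕ-^ (2 ℕ.^ y) K)))

restrict-mono : ∀ {n} (G : Graph n) {L L′ : Pairs n} → L ⊆ L′ → restrict G L ⊆ᴳ restrict G L′
restrict-mono G {L} {L′} L⊆L′ e = let l , e′ = restrict-edge⁻ G L e in restrict-edge⁺ G L′ (Linked-mono L⊆L′ l) e′

Preserves-mono : ∀ {n s} (G : Graph n) {P L L′} → L ⊆ L′ → Preserves s G P L → Preserves s G P L′
Preserves-mono {s = s} G L⊆L′ pres uv∈ p =
  let q , le = pres uv∈ p ; q′ , len = mapPath (restrict-mono G L⊆L′) q in
  q′ , subst (_≤ s * pathLength p) (sym len) le

Preserves-≡ : ∀ {n s s′} (G : Graph n) {P L} → s ≡ s′ → Preserves s G P L → Preserves s′ G P L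
Preserves-≡ G refl pres = pres

^-distribʳ-* : ∀ a b e → (a ℕ.* b) ℕ.^ e ≡ a ℕ.^ e ℕ.* b ℕ.^ e
^-distribʳ-* a b zero    = refl
^-distribʳ-* a b (suc e) = trans (cong (a ℕ.* b ℕ.*_) (^-distribʳ-* a b e)) (lemma a b (a ℕ.^ e) (b ℕ.^ e))
  where
  lemma : ∀ a b c d → a ℕ.* b ℕ.* (c ℕ.* d) ≡ a ℕ.* c ℕ.* (b ℕ.* d)
  lemma = solve-∀

-- At level x the hopset lives on at most n/2ˣ sampled vertices. The next level is
-- the largest for which preserving its n^(1+1/K) / 2^(x+x/K) edges stays affordable.
nextLevel : (K : ℕ) .{{_ : NonZero K}} → ℕ → ℕ
nextLevel K x = suc (x ℕ.+ x ℕ./ K)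

iterateLevel : (K : ℕ) .{{_ : NonZero K}} → ℕ → ℕ → ℕ
iterateLevel K zero    x = x
iterateLevel K (suc j) x = iterateLevel K j (nextLevel K x)

module Preserver {C : ℕ} (guarantee : HopsetGuarantee C) {n : ℕ} (G : Graph n)
  (η : ℕ) .{{_ : NonZero η}} (n<2^η : n ℕ.< 2 ℕ.^ η)
  (k : ℕ) (1≤k : 1 ℕ.≤ k) (ϵ : ℚ) .{{_ : Positive ϵ}} (ϵ<1 : ϵ < 1ℚ)
  (M : ℕ) (β-bound : ∀ β → fromℕ β ≤ hopBound C k ϵ → β ℕ.≤ M)
  (R : ℕ) .{{_ : NonZero (2 ℕ.^ suc k ℕ.∸ 1)}} (R-bound : n ℕ.^ suc (2 ℕ.^ suc k ℕ.∸ 1) ℕ.≤ R ℕ.^ (2 ℕ.^ suc k ℕ.∸ 1)) where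

  private
    K = 2 ℕ.^ suc k ℕ.∸ 1
    0≤ϵ : 0ℚ ≤ ϵ
    0≤ϵ = ℚ.<⇒≤ (ℚ.positive⁻¹ ϵ)
    -- A hitting set for at most n² < 2^(2η) interiors loses the factor 2η·2. The threshold `Λ`
    -- times 2ˣ makes up for it and leaves at most n/2ˣ samples.
    Λ = 4 ℕ.* η

  pairCost : ℕ → ℕ
  pairCost x = (M ℕ.+ 2) ℕ.* (Λ ℕ.* 2 ℕ.^ x)

  -- A hopset at level x has at most C·R/2ʸ edges with y = x + ⌊x/K⌋, and each costs (M+2)·Λ·2^(1+y)
  -- at the next level 1+y. The powers cancel up to a factor 2.
  levelCost : ℕ
  levelCost = 2 ℕ.* (C ℕ.* R) ℕ.* ((M ℕ.+ 2) ℕ.* Λ)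

  private
    module Sample (x : ℕ) where
      t = Λ ℕ.* 2 ℕ.^ x
      instance
        Λ-nonZero : NonZero Λ
        Λ-nonZero = ℕ.m*n≢0 4 η
        2^x-nonZero : NonZero (2 ℕ.^ x)
        2^x-nonZero = ℕ.m^n≢0 2 x
        t-nonZero : NonZero t
        t-nonZero = ℕ.m*n≢0 Λ (2 ℕ.^ x)
      sample = insides-hit G t (2 ℕ.* η) (square<2^ η n<2^η)
      A        = proj₁ sample
      A-unique = proj₁ (proj₂ sample)
      A-hits   = proj₁ (proj₂ (proj₂ sample))
      m = length A
      m*2^x≤n : m ℕ.* 2 ℕ.^ x ℕ.≤ n
      m*2^x≤n = ℕ.*-cancelˡ-≤ Λ (begin
        Λ ℕ.* (m ℕ.* 2 ℕ.^ x) ≡⟨ lemma₁ Λ m (2 ℕ.^ x) ⟩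
        m ℕ.* (Λ ℕ.* 2 ℕ.^ x) ≤⟨ proj₂ (proj₂ (proj₂ sample)) ⟩
        2 ℕ.* η ℕ.* (2 ℕ.* n) ≡⟨ lemma₂ η n ⟩
        Λ ℕ.* n ∎)
        where
        open ℕ.≤-Reasoning
        lemma₁ : ∀ a b c → a ℕ.* (b ℕ.* c) ≡ b ℕ.* (a ℕ.* c)
        lemma₁ = solve-∀
        lemma₂ : ∀ a b → 2 ℕ.* a ℕ.* (2 ℕ.* b) ≡ 4 ℕ.* a ℕ.* b
        lemma₂ = solve-∀
      open Skeleton G t A A-unique public
      y = x ℕ.+ x ℕ./ K
      sampled = hopset-size guarantee skeleton k 1≤k ϵ ϵ<1
      β = proj₁ sampled
      H = proj₁ (proj₂ sampled)
      hopset : IsHopset β ϵ skeleton H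
      hopset = proj₁ (proj₂ (proj₂ sampled))
      β≤M : β ℕ.≤ M
      β≤M = β-bound β (proj₁ (proj₂ (proj₂ (proj₂ sampled))))
      H-size : #edges H ℕ.* 2 ℕ.^ y ℕ.≤ C ℕ.* R
      -- From m ≤ n/2ˣ, the value m^(1+1/K) is smaller than R by the factor 2^(x+x/K); y rounds this
      -- exponent down.
      H-size = proj₂ (proj₂ (proj₂ (proj₂ sampled))) R y (begin
        m ℕ.^ suc K ℕ.* (2 ℕ.^ y) ℕ.^ K ≡⟨ cong (m ℕ.^ suc K ℕ.*_) (ℕ.^-*-assoc 2 y K) ⟩
        m ℕ.^ suc K ℕ.* 2 ℕ.^ (y ℕ.* K) ≤⟨ ℕ.*-monoʳ-≤ (m ℕ.^ suc K) (ℕ.^-monoʳ-≤ 2 y*K≤) ⟩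
        m ℕ.^ suc K ℕ.* 2 ℕ.^ (x ℕ.* suc K) ≡⟨ cong (m ℕ.^ suc K ℕ.*_) (ℕ.^-*-assoc 2 x (suc K)) ⟨
        m ℕ.^ suc K ℕ.* (2 ℕ.^ x) ℕ.^ suc K ≡⟨ ^-distribʳ-* m (2 ℕ.^ x) (suc K) ⟨
        (m ℕ.* 2 ℕ.^ x) ℕ.^ suc K ≤⟨ ℕ.^-monoˡ-≤ (suc K) m*2^x≤n ⟩
        n ℕ.^ suc K ≤⟨ R-bound ⟩
        R ℕ.^ K ∎)
        where
        open ℕ.≤-Reasoning
        y*K≤ : y ℕ.* K ℕ.≤ x ℕ.* suc K
        y*K≤ = begin
          (x ℕ.+ x ℕ./ K) ℕ.* K ≡⟨ ℕ.*-distribʳ-+ K x (x ℕ./ K) ⟩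
          x ℕ.* K ℕ.+ x ℕ./ K ℕ.* K ≤⟨ ℕ.+-monoʳ-≤ (x ℕ.* K) (m/n*n≤m x K) ⟩
          x ℕ.* K ℕ.+ x ≡⟨ ℕ.+-comm (x ℕ.* K) x ⟩
          x ℕ.+ x ℕ.* K ≡⟨ ℕ.*-suc x K ⟨
          x ℕ.* suc K ∎
      P′ : Pairs n
      P′ = hopsetPairs G t A A-unique H
      P′-size : length P′ ≡ #edges H
      P′-size = length-hopsetPairs G t A A-unique H
      step : ∀ s → 1ℚ ≤ s → ∀ P → Σ[ E ∈ Pairs n ] length E ℕ.≤ length P ℕ.* pairCost x ×
        (∀ L → E ⊆ L → Preserves s G P′ L → Preserves (s * (1ℚ + ϵ)) G P L)
      step s 1≤s P = realise-pairs (pairCost x) (0≤+ 0≤1 0≤ϵ)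
        (λ p → realise-≤ ℚ.≤-refl (ℕ.*-monoˡ-≤ t (ℕ.+-monoˡ-≤ 2 β≤M))
          (realise G t A A-unique {β} {ϵ} {H} 0≤ϵ hopset s 1≤s A-hits p)) P
        where open Realisation G s 1≤s P′

      -- From level η on, n/2ˣ is less than 1 and no sample is left, which ends the recursion.
      P′-empty : η ℕ.≤ x → P′ ≡ []
      P′-empty η≤x = length≡0 P′ (trans P′-size (no-edges m≡0 H))
        where
        m≡0 : m ≡ 0
        m≡0 with m ℕ.≟ 0
        ... | yes eq = eq
        ... | no neq = contradiction m*2^x≤n (ℕ.<⇒≱ (ℕ.<-≤-trans n<2^η (ℕ.≤-trans (ℕ.^-monoʳ-≤ 2 η≤x)
          (ℕ.m≤n*m (2 ℕ.^ x) m {{ℕ.≢-nonZero neq}}))))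
        no-edges : ∀ {m} → m ≡ 0 → (H : Graph m) → #edges H ≡ 0
        no-edges refl H = refl
        length≡0 : (Q : Pairs n) → length Q ≡ 0 → Q ≡ []
        length≡0 [] _ = refl

  abstract
    sampleStep : ∀ x → Σ[ P′ ∈ Pairs n ] (η ℕ.≤ x → P′ ≡ []) × length P′ ℕ.* 2 ℕ.^ (x ℕ.+ x ℕ./ K) ℕ.≤ C ℕ.* R ×
      (∀ s → 1ℚ ≤ s → ∀ P → Σ[ E ∈ Pairs n ] length E ℕ.≤ length P ℕ.* pairCost x ×
        (∀ L → E ⊆ L → Preserves s G P′ L → Preserves (s * (1ℚ + ϵ)) G P L))
    sampleStep x = P′ , P′-empty , subst (λ l → l ℕ.* 2 ℕ.^ y ℕ.≤ C ℕ.* R) (sym P′-size) H-size , step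
      where open Sample x

  -- Only the given pairs are charged `pairCost x`, which is why the recursion may start from any
  -- `P`. The hopset pairs of each level are the pairs given to the next, at a cost independent of
  -- the level.
  preserve : ∀ j x → η ℕ.≤ iterateLevel K j x → ∀ P →
    Σ[ L ∈ Pairs n ] length L ℕ.≤ length P ℕ.* pairCost x ℕ.+ j ℕ.* levelCost ×
      Preserves ((1ℚ + ϵ) ^ suc j) G P L
  preserve zero x η≤x P =
    -- With no hopset pairs left, preserving them with stretch 1 is vacuous.
    let P′ , empty , _ , step = sampleStep x
        E , size , pres = step 1ℚ ℚ.≤-refl P
    in E , ℕ.≤-trans size (ℕ.≤-reflexive (sym (ℕ.+-identityʳ _))) ,
       Preserves-≡ G (ℚ.*-comm 1ℚ (1ℚ + ϵ)) (pres E id λ uv∈ → contradiction (subst (_ ∈_) (empty η≤x) uv∈) λ ())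
  preserve (suc j) x η≤x P =
    let P′ , _ , P′-size , step = sampleStep x
        L , size , pres = preserve j (nextLevel K x) η≤x P′
        E , size′ , pres′ = step ((1ℚ + ϵ) ^ suc j) (1≤^ (suc j) (p≤p+q′ 0≤ϵ)) P
    in E ++ L , (begin
        length (E ++ L) ≡⟨ length-++ E ⟩
        length E ℕ.+ length L ≤⟨ ℕ.+-mono-≤ size′ (ℕ.≤-trans size (ℕ.+-monoˡ-≤ (j ℕ.* levelCost) (charge (length P′) P′-size))) ⟩
        length P ℕ.* pairCost x ℕ.+ suc j ℕ.* levelCost ∎) ,
      Preserves-≡ G (ℚ.*-comm ((1ℚ + ϵ) ^ suc j) (1ℚ + ϵ))
        (pres′ (E ++ L) ∈-++⁺ˡ (Preserves-mono {s = (1ℚ + ϵ) ^ suc j} G (∈-++⁺ʳ E) pres))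
    where
    open ℕ.≤-Reasoning
    charge : ∀ l → l ℕ.* 2 ℕ.^ (x ℕ.+ x ℕ./ K) ℕ.≤ C ℕ.* R → l ℕ.* pairCost (nextLevel K x) ℕ.≤ levelCost
    charge l le = begin
      l ℕ.* ((M ℕ.+ 2) ℕ.* (Λ ℕ.* (2 ℕ.* 2 ℕ.^ (x ℕ.+ x ℕ./ K)))) ≡⟨ lemma l (M ℕ.+ 2) Λ _ ⟩
      2 ℕ.* (l ℕ.* 2 ℕ.^ (x ℕ.+ x ℕ./ K)) ℕ.* ((M ℕ.+ 2) ℕ.* Λ) ≤⟨ ℕ.*-monoˡ-≤ _ (ℕ.*-monoʳ-≤ 2 le) ⟩
      levelCost ∎
      where
      lemma : ∀ a b c d → a ℕ.* (b ℕ.* (c ℕ.* (2 ℕ.* d))) ≡ 2 ℕ.* (a ℕ.* d) ℕ.* (b ℕ.* c)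
      lemma = solve-∀

-- Thorup–Zwick emulators

module _ {A : Set} {_≼_ : A → A → Set} (≼-total : ∀ x y → x ≼ y ⊎ y ≼ x) (≼-trans : ∀ {x y z} → x ≼ y → y ≼ z → x ≼ z) where

  minimum : ∀ x xs → ∃[ m ] m ∈ x ∷ xs × (∀ {y} → y ∈ x ∷ xs → m ≼ y)
  minimum x [] = x , here refl , λ { (here refl) → [ id , id ]′ (≼-total x x) }
  minimum x (y ∷ ys) with minimum y ys
  ... | m , m∈ , m-min with ≼-total x m
  ... | inj₁ x≼m = x , here refl , λ { (here refl) → [ id , id ]′ (≼-total x x) ; (there z∈) → ≼-trans x≼m (m-min z∈) }
  ... | inj₂ m≼x = m , there m∈ , λ { (here refl) → m≼x ; (there z∈) → m-min z∈ }

length-concatMap-≤ : ∀ {A B : Set} (f : A → List B) m xs → (∀ {x} → x ∈ xs → length (f x) ℕ.≤ m) →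
  length (concatMap f xs) ℕ.≤ length xs ℕ.* m
length-concatMap-≤ f m []       _  = z≤n
length-concatMap-≤ f m (x ∷ xs) ≤m = subst (ℕ._≤ _) (sym (length-++ (f x)))
  (ℕ.+-mono-≤ (≤m (here refl)) (length-concatMap-≤ f m xs (≤m ∘ there)))

module _ {n} (G : Graph n) where

  open Geodesic

  -- dist(x,v) ≤ dist(w,v), where both may be infinite.
  Closer : Fin n → Fin n → Fin n → Set
  Closer v x w = ∀ (p : Path (Edge G) w v) → Route G x v (pathLength p)

  closer? : ∀ v x w → Dec (Closer v x w)
  closer? v x w with geodesic? G w v
  ... | inj₂ ¬p = yes λ p → contradiction p ¬p
  ... | inj₁ g with geodesic? G x v
  ... | inj₂ ¬p = no λ closer → ¬p (proj₁ (closer (path g)))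
  ... | inj₁ g′ with pathLength (path g′) ℚ.≤? pathLength (path g)
  ... | yes le = yes λ p → path g′ , ℚ.≤-trans le (shortest g p)
  ... | no nle = no λ closer → let q , q≤ = closer (path g) in nle (ℚ.≤-trans (shortest g′ q) q≤)

  Closer-trans : ∀ {v x y z} → Closer v x y → Closer v y z → Closer v x z
  Closer-trans xy yz p = let q , q≤ = yz p ; r , r≤ = xy q in r , ℚ.≤-trans r≤ q≤

  Closer-total : ∀ v x y → Closer v x y ⊎ Closer v y x
  Closer-total v x y with geodesic? G x v | geodesic? G y v
  ... | inj₂ ¬p | _ = inj₂ λ p → contradiction p ¬p
  ... | inj₁ _ | inj₂ ¬p = inj₁ λ p → contradiction p ¬p
  ... | inj₁ g | inj₁ g′ with ℚ.≤-total (pathLength (path g)) (pathLength (path g′))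
  ... | inj₁ le = inj₁ λ p → path g , ℚ.≤-trans le (shortest g′ p)
  ... | inj₂ le = inj₂ λ p → path g′ , ℚ.≤-trans le (shortest g p)

  ball : List (Fin n) → Fin n → Fin n → List (Fin n)
  ball A v w = filter (λ x → closer? v x w) A

  HitsBalls : List (Fin n) → List (Fin n) → ℕ → List (Fin n) → Set
  HitsBalls S A t A′ = ∀ {v w} → v ∈ S → w ∈ A → t ℕ.≤ length (ball A v w) → ∃[ y ] y ∈ A′ × Closer v y w

  abstract
    balls-hit : ∀ S A → Unique A → ∀ t .{{_ : NonZero t}} h → length S ℕ.* length A ℕ.< 2 ℕ.^ h →
      ∃[ A′ ] Unique A′ × A′ ⊆ A × HitsBalls S A t A′ × length A′ ℕ.* t ℕ.≤ h ℕ.* (2 ℕ.* length A)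
    balls-hit S A A-unique t h <2^h = result
      where
      open HittingSet Fin._≟_ A t
      large? : ∀ vw → Dec (t ℕ.≤ length (uncurry (ball A) vw))
      large? vw = t ℕ.≤? length (uncurry (ball A) vw)
      centres : Pairs n
      centres = filter large? (cartesianProduct S A)
      family : List (List (Fin n))
      family = map (uncurry (ball A)) centres
      large : All Large family
      large = All.tabulate λ f∈ → let (v , w) , vw∈ , eq = ∈-map⁻ (uncurry (ball A)) f∈ in
        subst Large (sym eq)
          (Unique.filter⁺ (λ x → closer? v x w) A-unique ,
           (λ x∈ → proj₁ (∈-filter⁻ (λ x → closer? v x w) {xs = A} x∈)) ,
           proj₂ (∈-filter⁻ large? {xs = cartesianProduct S A} vw∈))
      small : length family ℕ.< 2 ℕ.^ h
      small = ℕ.≤-<-trans (ℕ.≤-trans (ℕ.≤-reflexive (length-map _ centres))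
        (ℕ.≤-trans (length-filter large? (cartesianProduct S A)) (ℕ.≤-reflexive (length-cartesianProduct S A)))) <2^h
      result : ∃[ A′ ] Unique A′ × A′ ⊆ A × HitsBalls S A t A′ × length A′ ℕ.* t ℕ.≤ h ℕ.* (2 ℕ.* length A)
      result =
        let A′ , unique , A′⊆A , hits , size = hitting-set h family large small in
        A′ , unique , A′⊆A ,
        (λ {v} {w} v∈S w∈A t≤ →
          let y , y∈A′ , y∈ = hits (∈-map⁺ (uncurry (ball A)) {v , w} (∈-filter⁺ large? (∈-cartesianProduct⁺ v∈S w∈A) t≤))
          in y , y∈A′ , proj₂ (∈-filter⁻ (λ x → closer? v x w) {xs = A} y∈)) ,
        size

  -- The list has at most one entry, and none if there is no sample, as on the last level of a
  -- hierarchy.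
  nearest : List (Fin n) → Fin n → List (Fin n)
  nearest []       v = []
  nearest (y ∷ ys) v = proj₁ (minimum (Closer-total v) Closer-trans y ys) ∷ []

  nearest-size : ∀ B v → length (nearest B v) ℕ.≤ 1
  nearest-size []      v = z≤n
  nearest-size (_ ∷ _) v = ℕ.≤-refl

  nearest⁺ : ∀ B {v y} → y ∈ B → ∃[ m ] m ∈ B × m ∈ nearest B v × Closer v m y
  nearest⁺ (x ∷ xs) {v} y∈ with minimum (Closer-total v) Closer-trans x xs
  ... | m , m∈ , m-min = m , m∈ , here refl , m-min y∈

  -- The invariant of a Thorup-Zwick distance query that has reached the pivot w of u: it finds a
  -- common neighbour x of u and v. `Known` is the set of usable pairs. Leaving it arbitrary allows
  -- the pair of u with itself, with which the query starts, and later the instance `Approximates`.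
  Meets : List (Fin n) → ℚ → List (Fin n) → Pairs n → Set₁
  Meets S c A P = ∀ (Known : Fin n → Fin n → Set) → (∀ {x y} → (x , y) ∈ P → Known x y) →
    ∀ {u v w} → u ∈ S → v ∈ S → w ∈ A → (r : Path (Edge G) w u) → Known w u → (p : Path (Edge G) u v) →
    ∃[ x ] Σ[ r₁ ∈ Path (Edge G) x u ] Σ[ r₂ ∈ Path (Edge G) x v ] Known x u × Known x v ×
      pathLength r₁ + pathLength r₂ ≤ (pathLength r + pathLength r) + c * pathLength p

  -- One level of the Thorup–Zwick hierarchy, A′ being a sample of A.
  module Bunches (S A A′ : List (Fin n)) (A-unique : Unique A) (t : ℕ) (hits : HitsBalls S A t A′) where

    dominated? : ∀ v x → Dec (Any.Any (λ y → Closer v y x) A′)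
    dominated? v x = Any.any? (λ y → closer? v y x) A′

    bunch : Fin n → List (Fin n)
    bunch v = filter (λ x → ¬? (dominated? v x)) A

    -- If there were t or more members, the ball around v reaching to the farthest of them would
    -- contain the bunch, so `A′` would hit it. That hit dominates the farthest member, which thus
    -- is not in the bunch.
    bunch-size : ∀ {v} → v ∈ S → length (bunch v) ℕ.≤ t
    bunch-size {v} v∈S with ℕ.≤-total (length (bunch v)) t
    ... | inj₁ ≤t = ≤t
    ... | inj₂ t≤ = farthest (bunch v) refl
      where
      farthest : ∀ xs → xs ≡ bunch v → length (bunch v) ℕ.≤ t
      farthest [] eq = subst (λ xs → length xs ℕ.≤ t) eq z≤n
      farthest (x ∷ xs) eq with minimum {_≼_ = λ x y → Closer v y x} (λ x y → Closer-total v y x) (λ yx zy → Closer-trans zy yx) x xs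
      ... | w , w∈ , w-max = contradiction (lose y∈A′ y≼w) w-free
        where
        w∈A×free : w ∈ A × ¬ Any.Any (λ y → Closer v y w) A′
        w∈A×free = ∈-filter⁻ (λ x → ¬? (dominated? v x)) {xs = A} (subst (w ∈_) eq w∈)
        w-free = proj₂ w∈A×free
        bunch⊆ball : bunch v ⊆ ball A v w
        bunch⊆ball x∈ = ∈-filter⁺ (λ x → closer? v x w) (proj₁ (∈-filter⁻ (λ x → ¬? (dominated? v x)) {xs = A} x∈)) (w-max (subst (_ ∈_) (sym eq) x∈))
        hit = hits v∈S (proj₁ w∈A×free) (ℕ.≤-trans t≤
          (Unique-⊆⇒length≤ (Unique.filter⁺ (λ x → ¬? (dominated? v x)) A-unique) bunch⊆ball))
        y∈A′ = proj₁ (proj₂ hit)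
        y≼w  = proj₂ (proj₂ hit)

    star : Fin n → Pairs n
    star v = map (_, v) (bunch v ++ nearest A′ v)

    stars : Pairs n
    stars = concatMap star S

    length-stars : length stars ℕ.≤ length S ℕ.* (t ℕ.+ 1)
    length-stars = length-concatMap-≤ star (t ℕ.+ 1) S λ {v} v∈S → begin
      length (star v) ≡⟨ length-map (_, v) (bunch v ++ nearest A′ v) ⟩
      length (bunch v ++ nearest A′ v) ≡⟨ length-++ (bunch v) ⟩
      length (bunch v) ℕ.+ length (nearest A′ v) ≤⟨ ℕ.+-mono-≤ (bunch-size v∈S) (nearest-size A′ v) ⟩
      t ℕ.+ 1 ∎
      where
      open ℕ.≤-Reasoning

    stars⁺ : ∀ {v x} → v ∈ S → x ∈ bunch v ++ nearest A′ v → (x , v) ∈ stars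
    stars⁺ {v} v∈S x∈ = ∈-concatMap⁺ star (lose v∈S (∈-map⁺ (_, v) x∈))

    ascend : ∀ {v} → v ∈ S → ∀ {w} → w ∈ A → (w , v) ∈ stars ⊎ (∃[ m ] m ∈ A′ × (m , v) ∈ stars × Closer v m w)
    ascend {v} v∈S {w} w∈A with dominated? v w
    ... | no free = inj₁ (stars⁺ v∈S (∈-++⁺ˡ (∈-filter⁺ (λ x → ¬? (dominated? v x)) w∈A free)))
    ... | yes dominated with find dominated
    ... | y , y∈ , y≼w with nearest⁺ A′ y∈
    ... | m , m∈ , m∈nearest , m≼y = inj₂ (m , m∈ , stars⁺ v∈S (∈-++⁺ʳ (bunch v) m∈nearest) , Closer-trans m≼y y≼w)

    -- If w is in the bunch of v, then u - w - v costs at most r + (r + p). Otherwise w is replaced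
    -- by the pivot of v in `A′`, at distance at most r + p, and u and v swap roles: 2(r + p) +
    -- (d-1)p = 2r + (d+1)p.
    extend : ∀ {d P′} → 0ℚ ≤ d → Meets S (d - 1ℚ) A′ P′ → Meets S (fromℕ 2 + d - 1ℚ) A (stars ++ P′)
    extend {d} {P′} 0≤d meets Known known {u} {v} {w} u∈S v∈S w∈A r known-wu p = [ halt , climb ]′ (ascend v∈S w∈A)
      where
      open ℚ.≤-Reasoning
      Goal : Set
      Goal = ∃[ x ] Σ[ r₁ ∈ Path (Edge G) x u ] Σ[ r₂ ∈ Path (Edge G) x v ] Known x u × Known x v ×
        pathLength r₁ + pathLength r₂ ≤ (pathLength r + pathLength r) + (fromℕ 2 + d - 1ℚ) * pathLength p
      lemma₁ : ∀ a b c → (a + b) + (a + b) + c ≡ a + a + ((b + b) + c)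
      lemma₁ = ring-solve-∀ ℚ-ring
      lemma₂ : ∀ a b c d e → a + (d * b + (c - e) * b) ≡ a + ((d + c) - e) * b
      lemma₂ = ring-solve-∀ ℚ-ring
      1≤ : 1ℚ ≤ fromℕ 2 + d - 1ℚ
      1≤ = ℚ.+-monoˡ-≤ (ℚ.- 1ℚ) {fromℕ 2} {fromℕ 2 + d} (p≤p+q′ 0≤d)
      halt : (w , v) ∈ stars → Goal
      halt wv∈ = w , r , r ◅◅ p , known-wu , known (∈-++⁺ˡ wv∈) , (begin
        pathLength r + pathLength (r ◅◅ p) ≡⟨ cong (pathLength r +_) (pathLength-◅◅ r p) ⟩
        pathLength r + (pathLength r + pathLength p) ≡⟨ ℚ.+-assoc (pathLength r) _ _ ⟨
        pathLength r + pathLength r + pathLength p ≡⟨ cong (pathLength r + pathLength r +_) (ℚ.*-identityˡ _) ⟨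
        pathLength r + pathLength r + 1ℚ * pathLength p
          ≤⟨ ℚ.+-monoʳ-≤ (pathLength r + pathLength r) (*-monoʳ-≤ (0≤pathLength G p) 1≤) ⟩
        pathLength r + pathLength r + (fromℕ 2 + d - 1ℚ) * pathLength p ∎)
      climb : (∃[ m ] m ∈ A′ × (m , v) ∈ stars × Closer v m w) → Goal
      climb (m , m∈A′ , mv∈ , m≼w) =
        let r′ , r′≤ = m≼w (r ◅◅ p)
            p⁻ , p⁻-len , _ = reverse G p
            x , r₁ , r₂ , known₁ , known₂ , le =
              meets Known (λ xy∈ → known (∈-++⁺ʳ stars xy∈)) v∈S u∈S m∈A′ r′ (known (∈-++⁺ˡ mv∈)) p⁻
            r′≤r+p = subst (pathLength r′ ≤_) (pathLength-◅◅ r p) r′≤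
        in x , r₂ , r₁ , known₂ , known₁ , (begin
        pathLength r₂ + pathLength r₁ ≡⟨ ℚ.+-comm (pathLength r₂) _ ⟩
        pathLength r₁ + pathLength r₂ ≤⟨ le ⟩
        pathLength r′ + pathLength r′ + (d - 1ℚ) * pathLength p⁻
          ≡⟨ cong (λ l → pathLength r′ + pathLength r′ + (d - 1ℚ) * l) p⁻-len ⟩
        pathLength r′ + pathLength r′ + (d - 1ℚ) * pathLength p
          ≤⟨ ℚ.+-monoˡ-≤ ((d - 1ℚ) * pathLength p) (ℚ.+-mono-≤ r′≤r+p r′≤r+p) ⟩
        (pathLength r + pathLength p) + (pathLength r + pathLength p) + (d - 1ℚ) * pathLength p
          ≡⟨ lemma₁ (pathLength r) (pathLength p) ((d - 1ℚ) * pathLength p) ⟩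
        pathLength r + pathLength r + ((pathLength p + pathLength p) + (d - 1ℚ) * pathLength p)
          ≡⟨ cong (λ z → pathLength r + pathLength r + (z + (d - 1ℚ) * pathLength p)) (2*_ (pathLength p)) ⟨
        pathLength r + pathLength r + (fromℕ 2 * pathLength p + (d - 1ℚ) * pathLength p)
          ≡⟨ lemma₂ (pathLength r + pathLength r) (pathLength p) d (fromℕ 2) 1ℚ ⟩
        pathLength r + pathLength r + (fromℕ 2 + d - 1ℚ) * pathLength p ∎)

  Meets-≡ : ∀ {S c c′ A P} → c ≡ c′ → Meets S c A P → Meets S c′ A P
  Meets-≡ refl meets = meets

  -- The threshold 2hq absorbs the loss of the hitting set, so that each sample is smaller by the
  -- factor q and j levels use up fewer than qʲ vertices. Each level adds 2 to the stretch.
  hierarchy : ∀ S (h q : ℕ) .{{_ : NonZero h}} .{{_ : NonZero q}} → length S ℕ.* length S ℕ.< 2 ℕ.^ h →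
    ∀ j A → Unique A → length A ℕ.≤ length S → length A ℕ.< q ℕ.^ j →
    Σ[ P ∈ Pairs n ] length P ℕ.≤ j ℕ.* (length S ℕ.* (2 ℕ.* h ℕ.* q ℕ.+ 1)) ×
      Meets S (fromℕ (2 ℕ.* j) - 1ℚ) A P
  -- Without samples the claim is vacuous. Its constant -1 is chosen so that the first level yields
  -- stretch 1.
  hierarchy S h q <2^h zero [] _ _ _ = [] , z≤n , λ _ _ _ _ ()
  hierarchy S h q <2^h zero (_ ∷ _) _ _ (s≤s ())
  hierarchy S h q <2^h (suc j) A A-unique A≤S A<q^ =
    let A′ , A′-unique , _ , hits , A′-size = balls-hit S A A-unique t h (ℕ.≤-<-trans (ℕ.*-monoʳ-≤ (length S) A≤S) <2^h)
    in level A′ A′-unique hits (smaller (length A′) A′-size)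
    where
    t : ℕ
    t = 2 ℕ.* h ℕ.* q
    instance
      2h-nonZero : NonZero (2 ℕ.* h)
      2h-nonZero = ℕ.m*n≢0 2 h
      t-nonZero : NonZero t
      t-nonZero = ℕ.m*n≢0 (2 ℕ.* h) q
    smaller : ∀ a → a ℕ.* t ℕ.≤ h ℕ.* (2 ℕ.* length A) → a ℕ.* q ℕ.≤ length A
    smaller a size = ℕ.*-cancelˡ-≤ (2 ℕ.* h) (begin
      2 ℕ.* h ℕ.* (a ℕ.* q) ≡⟨ lemma₁ (2 ℕ.* h) a q ⟩
      a ℕ.* t ≤⟨ size ⟩
      h ℕ.* (2 ℕ.* length A) ≡⟨ lemma₂ h (length A) ⟩
      2 ℕ.* h ℕ.* length A ∎)
      where
      open ℕ.≤-Reasoning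
      lemma₁ : ∀ a b c → a ℕ.* (b ℕ.* c) ≡ b ℕ.* (a ℕ.* c)
      lemma₁ = solve-∀
      lemma₂ : ∀ a b → a ℕ.* (2 ℕ.* b) ≡ 2 ℕ.* a ℕ.* b
      lemma₂ = solve-∀
    level : ∀ A′ → Unique A′ → HitsBalls S A t A′ → length A′ ℕ.* q ℕ.≤ length A → _
    level A′ A′-unique hits A′q≤A =
      let P′ , P′-size , meets = hierarchy S h q <2^h j A′ A′-unique
            (ℕ.≤-trans (ℕ.≤-trans (ℕ.m≤m*n (length A′) q) A′q≤A) A≤S)
            (ℕ.*-cancelʳ-< q (length A′) (q ℕ.^ j) (ℕ.≤-<-trans A′q≤A (subst (length A ℕ.<_) (ℕ.*-comm q (q ℕ.^ j)) A<q^)))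
      in stars ++ P′ ,
         subst (ℕ._≤ _) (sym (length-++ stars)) (ℕ.+-mono-≤ length-stars P′-size) ,
         Meets-≡ {A = A} {P = stars ++ P′} (cong (_- 1ℚ) (trans (sym (fromℕ-+ 2 (2 ℕ.* j))) (cong fromℕ (sym (ℕ.*-suc 2 j)))))
           (extend {P′ = P′} (0≤fromℕ (2 ℕ.* j)) meets)
      where open Bunches S A A′ A-unique t hits

-- Emulators and hopsets as routes in a subgraph

module _ {n} (G G′ : Graph n) {s : ℚ} (1≤s : 1ℚ ≤ s) where

  private
    0≤s : 0ℚ ≤ s
    0≤s = ℚ.≤-trans 0≤1 1≤s

  -- The query starts at w = u with the empty walk, so the term 2r vanishes and the stretch c
  -- remains.
  meets⇒spans : ∀ {S c P} → Meets G S c S P → (∀ {x y} → (x , y) ∈ P → Approximates s G G′ x y) →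
    ∀ {u v} → u ∈ S → v ∈ S → (p : Path (Edge G) u v) → Route G′ u v (s * (c * pathLength p))
  meets⇒spans {c = c} meets known {u} {v} u∈S v∈S p =
    let x , r₁ , r₂ , known₁ , known₂ , le = meets (Approximates s G G′) known u∈S v∈S u∈S ε
          (λ q → ε , 0≤* 0≤s (0≤pathLength G q)) p
        q₁ , le₁ = known₁ r₁
        q₂ , le₂ = known₂ r₂
        q₁⁻ , len , _ = reverse G′ q₁
    in q₁⁻ ◅◅ q₂ , (begin
      pathLength (q₁⁻ ◅◅ q₂) ≡⟨ pathLength-◅◅ q₁⁻ q₂ ⟩
      pathLength q₁⁻ + pathLength q₂ ≡⟨ cong (_+ pathLength q₂) len ⟩
      pathLength q₁ + pathLength q₂ ≤⟨ ℚ.+-mono-≤ le₁ le₂ ⟩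
      s * pathLength r₁ + s * pathLength r₂ ≡⟨ ℚ.*-distribˡ-+ s _ _ ⟨
      s * (pathLength r₁ + pathLength r₂) ≤⟨ *-monoˡ-≤ 0≤s le ⟩
      s * (0ℚ + 0ℚ + c * pathLength p) ≡⟨ cong (s *_) (ℚ.+-identityˡ (c * pathLength p)) ⟩
      s * (c * pathLength p) ∎)
    where open ℚ.≤-Reasoning

  module _ {H : Graph n} {β ϵ c} (0≤ϵ : 0ℚ ≤ ϵ) (0≤c : 0ℚ ≤ c) (hopset : IsHopset β ϵ G H)
    (H-approx : ∀ {u v} → Linked (edgePairs H) u v → Approximates s G G′ u v)
    (spans : ∀ {u v} (p : Path (Edge G) u v) → Route G′ u v (s * (c * pathLength p))) where

    private
      a : ℚ
      a = s * (c * W-max G)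
      0≤a : 0ℚ ≤ a
      0≤a = 0≤* 0≤s (0≤* 0≤c (0≤W-max G))

    -- A hopset edge is stretched by s only. An edge of `G` may be missing, and its detour is
    -- charged additively, so the additive error is proportional to the number of hops.
    replaceEdges : ∀ {u v} (q : Path (G ∪ᴱ H) u v) →
      Route G′ u v (s * pathLength q + fromℕ (hops q) * a)
    replaceEdges ε = ε , ℚ.≤-reflexive (sym (trans (cong₂ _+_ (ℚ.*-zeroʳ s) (ℚ.*-zeroˡ a)) (ℚ.+-identityˡ 0ℚ)))
    replaceEdges ((w , e) ◅ q) =
      let p , le = replaceEdges q ; p′ , le′ = replaceEdge e in
      p′ ◅◅ p , (begin
        pathLength (p′ ◅◅ p) ≡⟨ pathLength-◅◅ p′ p ⟩
        pathLength p′ + pathLength p ≤⟨ ℚ.+-mono-≤ le′ le ⟩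
        (s * w + a) + (s * pathLength q + fromℕ (hops q) * a) ≡⟨ lemma s w a (pathLength q) (fromℕ (hops q)) ⟩
        s * (w + pathLength q) + (a + fromℕ (hops q) * a) ≡⟨ cong (s * (w + pathLength q) +_) suc-* ⟨
        s * (w + pathLength q) + fromℕ (suc (hops q)) * a ∎)
      where
      open ℚ.≤-Reasoning
      lemma : ∀ s w a l h → (s * w + a) + (s * l + h * a) ≡ s * (w + l) + (a + h * a)
      lemma = ring-solve-∀ ℚ-ring
      suc-* : fromℕ (suc (hops q)) * a ≡ a + fromℕ (hops q) * a
      suc-* = trans (cong (_* a) (fromℕ-+ 1 (hops q))) (trans (ℚ.*-distribʳ-+ a 1ℚ (fromℕ (hops q))) (cong (_+ fromℕ (hops q) * a) (ℚ.*-identityˡ a)))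
      replaceEdge : ∀ {u v w} → (G ∪ᴱ H) u v w → Route G′ u v (s * w + a)
      replaceEdge {w = w} (inj₁ e) =
        let p , le = spans ((_ , e) ◅ ε) in
        p , ℚ.≤-trans le (ℚ.≤-trans (*-monoˡ-≤ 0≤s (*-monoˡ-≤ 0≤c (subst (_≤ W-max G) (sym (ℚ.+-identityʳ w)) (edge≤W-max G e))))
              (p≤q+p′ (0≤* 0≤s (ℚ.<⇒≤ (Graph.positive G e)))))
      replaceEdge (inj₂ e) with proj₁ hopset e
      ... | (r , refl) , _ = let p , le = H-approx (edgePairs⁺ H e) r in p , ℚ.≤-trans le (p≤p+q′ 0≤a)

    spanner-path : ∀ {u v} (p : Path (Edge G) u v) →
      Route G′ u v (s * (1ℚ + ϵ) * pathLength p + fromℕ β * a)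
    spanner-path {u} {v} p = result (proj₂ hopset u v _ (isDist G (geodesic G p)))
      where
      open ℚ.≤-Reasoning
      g : Geodesic G u v
      g = geodesic G p
      result : ∃[ d′ ] IsHopDist β (G ∪ᴱ H) u v d′ × pathLength (Geodesic.path g) ≤ d′ × d′ ≤ (1ℚ + ϵ) * pathLength (Geodesic.path g) →
        Route G′ u v (s * (1ℚ + ϵ) * pathLength p + fromℕ β * a)
      result (_ , ((q , ≤β , refl) , _) , _ , d′≤) =
        let p′ , le = replaceEdges q in p′ , (begin
          pathLength p′
            ≤⟨ le ⟩
          s * pathLength q + fromℕ (hops q) * a
            ≤⟨ ℚ.+-mono-≤ (*-monoˡ-≤ 0≤s d′≤) (*-monoʳ-≤ 0≤a (fromℕ-mono-≤ ≤β)) ⟩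
          s * ((1ℚ + ϵ) * pathLength (Geodesic.path g)) + fromℕ β * a
            ≤⟨ ℚ.+-monoˡ-≤ (fromℕ β * a) (*-monoˡ-≤ 0≤s (*-monoˡ-≤ (0≤+ 0≤1 0≤ϵ) (Geodesic.shortest g p))) ⟩
          s * ((1ℚ + ϵ) * pathLength p) + fromℕ β * a
            ≡⟨ cong (_+ fromℕ β * a) (ℚ.*-assoc s (1ℚ + ϵ) (pathLength p)) ⟨
          s * (1ℚ + ϵ) * pathLength p + fromℕ β * a ∎)

module _ {n} (G : Graph n) (S : List (Fin n)) where

  nearestPairs : Pairs n
  nearestPairs = concatMap (λ v → map (_, v) (nearest G S v)) (allFin n)

  length-nearestPairs : length nearestPairs ℕ.≤ n
  length-nearestPairs = ℕ.≤-trans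
    (length-concatMap-≤ (λ v → map (_, v) (nearest G S v)) 1 (allFin n) λ {v} _ →
      ℕ.≤-trans (ℕ.≤-reflexive (length-map (_, v) (nearest G S v))) (nearest-size G S v))
    (ℕ.≤-reflexive (trans (ℕ.*-identityʳ _) (length-allFin n)))

  nearestPairs⁺ : ∀ {s} → s ∈ S → ∀ v → ∃[ m ] m ∈ S × (m , v) ∈ nearestPairs × Closer G v m s
  nearestPairs⁺ s∈S v = let m , m∈S , m∈ , m≼s = nearest⁺ G S {v} s∈S in
    m , m∈S , ∈-concatMap⁺ (λ v → map (_, v) (nearest G S v)) (lose (∈-allFin v) (∈-map⁺ (_, v) m∈)) , m≼s

  -- s → v is routed through the member m of S nearest to v, where dist(m,v) ≤
  -- dist(s,v) and so dist(s,m) ≤ 2 dist(s,v).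
  sourcewise-path : ∀ {s c P L} → 1ℚ ≤ s → 0ℚ ≤ c → Meets G S c S P → Preserves s G (P ++ nearestPairs) L →
    ∀ {u v} → u ∈ S → (p : Path (Edge G) u v) →
    Route (restrict G L) u v (s * ((c + c + 1ℚ) * pathLength p))
  sourcewise-path {s} {c} {P} {L} 1≤s 0≤c meets pres {u} {v} u∈S p =
    let m , m∈S , mv∈ , m≼u = nearestPairs⁺ u∈S v
        r , r≤p = m≼u p
        r⁻ , r⁻-len , _ = reverse G r
        q , q≤ = meets⇒spans G (restrict G L) {s} 1≤s {S} {c} {P} meets (λ xy∈ → pres (∈-++⁺ˡ xy∈)) u∈S m∈S (p ◅◅ r⁻)
        q′ , q′≤ = pres (∈-++⁺ʳ P mv∈) r
        l = pathLength p
        p◅◅r⁻≤ : pathLength (p ◅◅ r⁻) ≤ l + l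
        p◅◅r⁻≤ = subst (_≤ l + l) (sym (trans (pathLength-◅◅ p r⁻) (cong (l +_) r⁻-len))) (ℚ.+-monoʳ-≤ l r≤p)
    in q ◅◅ q′ , (begin
      pathLength (q ◅◅ q′) ≡⟨ pathLength-◅◅ q q′ ⟩
      pathLength q + pathLength q′ ≤⟨ ℚ.+-mono-≤ q≤ q′≤ ⟩
      s * (c * pathLength (p ◅◅ r⁻)) + s * pathLength r ≤⟨ ℚ.+-mono-≤ (*-monoˡ-≤ 0≤s (*-monoˡ-≤ 0≤c p◅◅r⁻≤)) (*-monoˡ-≤ 0≤s r≤p) ⟩
      s * (c * (l + l)) + s * l ≡⟨ cong (λ z → s * (c * (l + l)) + s * z) (ℚ.*-identityˡ l) ⟨
      s * (c * (l + l)) + s * (1ℚ * l) ≡⟨ lemma s c l 1ℚ ⟩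
      s * ((c + c + 1ℚ) * l) ∎)
    where
    open ℚ.≤-Reasoning
    0≤s : 0ℚ ≤ s
    0≤s = ℚ.≤-trans 0≤1 1≤s
    lemma : ∀ s c l o → s * (c * (l + l)) + s * (o * l) ≡ s * ((c + c + o) * l)
    lemma = ring-solve-∀ ℚ-ring

-- Growth rates

logSize : ℕ → ℕ
logSize n = suc ⌊log₂ n ⌋

loglogSize : ℕ → ℕ
loglogSize n = suc ⌊log₂ ⌊log₂ n ⌋ ⌋

-- The hopset parameter k ≈ log log n is the exponent of a base polynomial in log n.
growth : ℕ → ℕ → ℕ
growth a n = 2 ℕ.^ (a ℕ.* (loglogSize n ℕ.* loglogSize n))

n<2^n : ∀ n → n ℕ.< 2 ℕ.^ n
n<2^n zero    = s≤s z≤n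
n<2^n (suc n) = ℕ.+-mono-≤ (ℕ.m^n>0 2 n) (ℕ.≤-trans (n<2^n n) (ℕ.m≤m+n _ 0))

logSize≤ : ∀ n → logSize n ℕ.≤ 2 ℕ.^ loglogSize n
logSize≤ n = n<2^1+⌊log₂n⌋ ⌊log₂ n ⌋

≤growth : ∀ a n {x} → x ℕ.≤ 2 ℕ.^ (a ℕ.* loglogSize n) → x ℕ.≤ growth a n
≤growth a n x≤ = ℕ.≤-trans x≤ (ℕ.^-monoʳ-≤ 2 (ℕ.*-monoʳ-≤ a (ℕ.m≤m*n (loglogSize n) (loglogSize n))))

constant≤polylog : ∀ c n → c ℕ.≤ 2 ℕ.^ (c ℕ.* loglogSize n)
constant≤polylog c n = ℕ.≤-trans (ℕ.<⇒≤ (n<2^n c)) (ℕ.^-monoʳ-≤ 2 (ℕ.m≤m*n c (loglogSize n)))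

logSize≤polylog : ∀ n → logSize n ℕ.≤ 2 ℕ.^ (1 ℕ.* loglogSize n)
logSize≤polylog n = ℕ.≤-trans (logSize≤ n) (ℕ.^-monoʳ-≤ 2 (ℕ.≤-reflexive (sym (ℕ.*-identityˡ (loglogSize n)))))

*≤polylog : ∀ a b n {x y} → x ℕ.≤ 2 ℕ.^ (a ℕ.* loglogSize n) → y ℕ.≤ 2 ℕ.^ (b ℕ.* loglogSize n) →
  x ℕ.* y ℕ.≤ 2 ℕ.^ ((a ℕ.+ b) ℕ.* loglogSize n)
*≤polylog a b n x≤ y≤ = ℕ.≤-trans (ℕ.*-mono-≤ x≤ y≤)
  (ℕ.≤-reflexive (trans (sym (ℕ.^-distribˡ-+-* 2 (a ℕ.* l) (b ℕ.* l))) (cong (2 ℕ.^_) (sym (ℕ.*-distribʳ-+ l a b)))))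
  where l = loglogSize n

constant≤growth : ∀ c n → c ℕ.≤ growth c n
constant≤growth c n = ≤growth c n (constant≤polylog c n)

logSize≤growth : ∀ n → logSize n ℕ.≤ growth 1 n
logSize≤growth n = ≤growth 1 n (logSize≤polylog n)

*≤growth : ∀ a b n {x y} → x ℕ.≤ growth a n → y ℕ.≤ growth b n → x ℕ.* y ℕ.≤ growth (a ℕ.+ b) n
*≤growth a b n {x} {y} x≤ y≤ = begin
  x ℕ.* y ≤⟨ ℕ.*-mono-≤ x≤ y≤ ⟩
  2 ℕ.^ (a ℕ.* l) ℕ.* 2 ℕ.^ (b ℕ.* l) ≡⟨ ℕ.^-distribˡ-+-* 2 (a ℕ.* l) (b ℕ.* l) ⟨
  2 ℕ.^ (a ℕ.* l ℕ.+ b ℕ.* l) ≡⟨ cong (2 ℕ.^_) (ℕ.*-distribʳ-+ l a b) ⟨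
  growth (a ℕ.+ b) n ∎
  where
  open ℕ.≤-Reasoning
  l = loglogSize n ℕ.* loglogSize n

+≤growth : ∀ a b n {x y} → x ℕ.≤ growth a n → y ℕ.≤ growth b n → x ℕ.+ y ℕ.≤ growth (2 ℕ.+ (a ℕ.+ b)) n
+≤growth a b n {x} {y} x≤ y≤ = begin
  x ℕ.+ y ≤⟨ ℕ.+-mono-≤ (ℕ.≤-trans x≤ (mono a (ℕ.m≤m+n a b))) (ℕ.≤-trans y≤ (mono b (ℕ.m≤n+m b a))) ⟩
  growth (a ℕ.+ b) n ℕ.+ growth (a ℕ.+ b) n ≡⟨ cong (growth (a ℕ.+ b) n ℕ.+_) (ℕ.+-identityʳ _) ⟨
  2 ℕ.* growth (a ℕ.+ b) n ≤⟨ *≤growth 2 (a ℕ.+ b) n (constant≤growth 2 n) ℕ.≤-refl ⟩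
  growth (2 ℕ.+ (a ℕ.+ b)) n ∎
  where
  open ℕ.≤-Reasoning
  mono : ∀ c → c ℕ.≤ a ℕ.+ b → growth c n ℕ.≤ growth (a ℕ.+ b) n
  mono c c≤ = ℕ.^-monoʳ-≤ 2 (ℕ.*-monoˡ-≤ _ c≤)

^≤growth : ∀ a n {x} → x ℕ.≤ 2 ℕ.^ (a ℕ.* loglogSize n) → x ℕ.^ loglogSize n ℕ.≤ growth a n
^≤growth a n {x} x≤ = begin
  x ℕ.^ λn ≤⟨ ℕ.^-monoˡ-≤ λn x≤ ⟩
  (2 ℕ.^ (a ℕ.* λn)) ℕ.^ λn ≡⟨ ℕ.^-*-assoc 2 (a ℕ.* λn) λn ⟩
  2 ℕ.^ (a ℕ.* λn ℕ.* λn) ≡⟨ cong (2 ℕ.^_) (ℕ.*-assoc a λn λn) ⟩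
  growth a n ∎
  where
  open ℕ.≤-Reasoning
  λn = loglogSize n

-- With Y = 2^⌊x/4⌋ one has x+1 ≤ 4Y and 16c ≤ Y, so the left side is at most Y⁴.
quadratic≤2^ : ∀ c x → 4 ℕ.* (c ℕ.+ 4) ℕ.≤ x → c ℕ.* (suc x ℕ.* suc x) ℕ.≤ 2 ℕ.^ x
quadratic≤2^ c x le = begin
  c ℕ.* (suc x ℕ.* suc x) ≤⟨ ℕ.*-monoʳ-≤ c (ℕ.*-mono-≤ x< x<) ⟩
  c ℕ.* (4 ℕ.* Y ℕ.* (4 ℕ.* Y)) ≡⟨ lemma c Y ⟩
  16 ℕ.* c ℕ.* (Y ℕ.* Y) ≤⟨ ℕ.*-monoˡ-≤ (Y ℕ.* Y) (begin
    16 ℕ.* c ≤⟨ ℕ.*-monoʳ-≤ 16 (ℕ.<⇒≤ (n<2^n c)) ⟩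
    16 ℕ.* 2 ℕ.^ c ≡⟨ ℕ.^-distribˡ-+-* 2 4 c ⟨
    2 ℕ.^ (4 ℕ.+ c) ≡⟨ cong (2 ℕ.^_) (ℕ.+-comm 4 c) ⟩
    2 ℕ.^ (c ℕ.+ 4) ≤⟨ ℕ.^-monoʳ-≤ 2 c+4≤y ⟩
    Y ≤⟨ ℕ.m≤m*n Y Y ⟩
    Y ℕ.* Y ∎) ⟩
  Y ℕ.* Y ℕ.* (Y ℕ.* Y) ≡⟨ cong₂ ℕ._*_ (square y) (square y) ⟩
  2 ℕ.^ (y ℕ.+ y) ℕ.* 2 ℕ.^ (y ℕ.+ y) ≡⟨ square (y ℕ.+ y) ⟩
  2 ℕ.^ (y ℕ.+ y ℕ.+ (y ℕ.+ y)) ≤⟨ ℕ.^-monoʳ-≤ 2 (ℕ.≤-trans (ℕ.≤-reflexive (four y)) (m/n*n≤m x 4)) ⟩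
  2 ℕ.^ x ∎
  where
  open ℕ.≤-Reasoning
  y = x ℕ./ 4
  Y = 2 ℕ.^ y
  instance
    Y-nonZero : NonZero Y
    Y-nonZero = ℕ.m^n≢0 2 y
  c+4≤y : c ℕ.+ 4 ℕ.≤ y
  c+4≤y = subst (ℕ._≤ y) (trans (cong (ℕ._/ 4) (ℕ.*-comm 4 (c ℕ.+ 4))) (m*n/n≡m (c ℕ.+ 4) 4)) (/-monoˡ-≤ 4 le)
  x< : suc x ℕ.≤ 4 ℕ.* Y
  x< = begin
    suc x ≡⟨ cong suc (m≡m%n+[m/n]*n x 4) ⟩
    suc (x ℕ.% 4) ℕ.+ y ℕ.* 4 ≤⟨ ℕ.+-monoˡ-≤ (y ℕ.* 4) (m%n<n x 4) ⟩
    suc y ℕ.* 4 ≤⟨ ℕ.*-monoˡ-≤ 4 (n<2^n y) ⟩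
    Y ℕ.* 4 ≡⟨ ℕ.*-comm Y 4 ⟩
    4 ℕ.* Y ∎
  square : ∀ e → 2 ℕ.^ e ℕ.* 2 ℕ.^ e ≡ 2 ℕ.^ (e ℕ.+ e)
  square e = sym (ℕ.^-distribˡ-+-* 2 e e)
  four : ∀ y → y ℕ.+ y ℕ.+ (y ℕ.+ y) ≡ y ℕ.* 4
  four = solve-∀
  lemma : ∀ c z → c ℕ.* (4 ℕ.* z ℕ.* (4 ℕ.* z)) ≡ 16 ℕ.* c ℕ.* (z ℕ.* z)
  lemma = solve-∀

growth-subpolynomial : ∀ a → Subpolynomial (growth a)
growth-subpolynomial a d = 2 ℕ.^ (2 ℕ.^ x₀) , bound
  where
  -- The threshold of `quadratic≤2^` for the coefficient d·a. It has to be reached by log log n,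
  -- hence the double exponential.
  x₀ = 4 ℕ.* (d ℕ.* a ℕ.+ 4)
  bound : ∀ n → 2 ℕ.^ (2 ℕ.^ x₀) ℕ.≤ n → growth a n ℕ.^ d ℕ.≤ n
  bound n N≤n = begin
    growth a n ℕ.^ d ≡⟨ ℕ.^-*-assoc 2 (a ℕ.* (suc ll ℕ.* suc ll)) d ⟩
    2 ℕ.^ (a ℕ.* (suc ll ℕ.* suc ll) ℕ.* d) ≤⟨ ℕ.^-monoʳ-≤ 2 (begin
      a ℕ.* (suc ll ℕ.* suc ll) ℕ.* d ≡⟨ lemma a d (suc ll ℕ.* suc ll) ⟩
      d ℕ.* a ℕ.* (suc ll ℕ.* suc ll) ≤⟨ quadratic≤2^ (d ℕ.* a) ll x₀≤ll ⟩
      2 ℕ.^ ll ≤⟨ 2^⌊log₂n⌋≤n ⌊log₂ n ⌋ {{ℕ.>-nonZero (ℕ.<-≤-trans (ℕ.m^n>0 2 x₀) 2^x₀≤l)}} ⟩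
      ⌊log₂ n ⌋ ∎) ⟩
    2 ℕ.^ ⌊log₂ n ⌋ ≤⟨ 2^⌊log₂n⌋≤n n {{ℕ.>-nonZero (ℕ.<-≤-trans (ℕ.m^n>0 2 (2 ℕ.^ x₀)) N≤n)}} ⟩
    n ∎
    where
    open ℕ.≤-Reasoning
    ll = ⌊log₂ ⌊log₂ n ⌋ ⌋
    2^x₀≤l : 2 ℕ.^ x₀ ℕ.≤ ⌊log₂ n ⌋
    2^x₀≤l = subst (ℕ._≤ ⌊log₂ n ⌋) (⌊log₂[2^n]⌋≡n (2 ℕ.^ x₀)) (⌊log₂⌋-mono-≤ N≤n)
    x₀≤ll : x₀ ℕ.≤ ll
    x₀≤ll = subst (ℕ._≤ ll) (⌊log₂[2^n]⌋≡n x₀) (⌊log₂⌋-mono-≤ 2^x₀≤l)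
    lemma : ∀ a d z → a ℕ.* z ℕ.* d ≡ d ℕ.* a ℕ.* z
    lemma = solve-∀

-- Number of levels, accumulated stretch and reciprocals

iterateLevel-≥ : ∀ K .{{_ : NonZero K}} j x → x ℕ.+ j ℕ.≤ iterateLevel K j x
iterateLevel-≥ K zero    x = ℕ.≤-reflexive (ℕ.+-identityʳ x)
iterateLevel-≥ K (suc j) x = ℕ.≤-trans
  (ℕ.≤-trans (ℕ.≤-reflexive (ℕ.+-suc x j)) (s≤s (ℕ.+-monoˡ-≤ j (ℕ.m≤m+n x (x ℕ./ K)))))
  (iterateLevel-≥ K j (nextLevel K x))

-- In each step the cross term ϵ·2jϵ is at most ϵ because 2jϵ ≤ 1, which accounts for the factor 2.
[1+ϵ]^j≤ : ∀ {ϵ} → 0ℚ ≤ ϵ → ∀ j → fromℕ (2 ℕ.* j) * ϵ ≤ 1ℚ → (1ℚ + ϵ) ^ j ≤ 1ℚ + fromℕ (2 ℕ.* j) * ϵ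
[1+ϵ]^j≤ {ϵ} 0≤ϵ zero    _  = p≤p+q′ (0≤* ℚ.≤-refl 0≤ϵ)
[1+ϵ]^j≤ {ϵ} 0≤ϵ (suc j) ≤1 = begin
  (1ℚ + ϵ) * (1ℚ + ϵ) ^ j
    ≤⟨ *-monoˡ-≤ (0≤+ 0≤1 0≤ϵ) ([1+ϵ]^j≤ 0≤ϵ j 2jϵ≤1) ⟩
  (1ℚ + ϵ) * (1ℚ + x)
    ≡⟨ trans (ℚ.*-distribʳ-+ (1ℚ + x) 1ℚ ϵ) (cong₂ _+_ (ℚ.*-identityˡ (1ℚ + x)) (trans (ℚ.*-distribˡ-+ ϵ 1ℚ x) (cong (_+ ϵ * x) (ℚ.*-identityʳ ϵ)))) ⟩
  (1ℚ + x) + (ϵ + ϵ * x)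
    ≤⟨ ℚ.+-monoʳ-≤ (1ℚ + x) (ℚ.+-monoʳ-≤ ϵ (subst (ϵ * x ≤_) (ℚ.*-identityʳ ϵ) (*-monoˡ-≤ 0≤ϵ 2jϵ≤1))) ⟩
  (1ℚ + x) + (ϵ + ϵ)
    ≡⟨ trans (ℚ.+-assoc 1ℚ x (ϵ + ϵ)) (cong (1ℚ +_) (trans (ℚ.+-comm x (ϵ + ϵ)) (sym suc-*))) ⟩
  1ℚ + fromℕ (2 ℕ.* suc j) * ϵ ∎
  where
  open ℚ.≤-Reasoning
  x = fromℕ (2 ℕ.* j) * ϵ
  suc-* : fromℕ (2 ℕ.* suc j) * ϵ ≡ (ϵ + ϵ) + x
  suc-* = trans (cong (λ m → fromℕ m * ϵ) (ℕ.*-suc 2 j)) (trans (cong (_* ϵ) (fromℕ-+ 2 (2 ℕ.* j)))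
    (trans (ℚ.*-distribʳ-+ ϵ (fromℕ 2) (fromℕ (2 ℕ.* j))) (cong (_+ x) (2* ϵ))))
  2jϵ≤1 : x ≤ 1ℚ
  2jϵ≤1 = ℚ.≤-trans (*-monoʳ-≤ 0≤ϵ (fromℕ-mono-≤ (ℕ.*-monoʳ-≤ 2 (ℕ.n≤1+n j)))) ≤1

fromℕ-pos : ∀ m .{{_ : NonZero m}} → Positive (fromℕ m)
fromℕ-pos (suc m) = _

recip : ∀ m .{{_ : NonZero m}} → ℚ
recip m = (1/ fromℕ m) {{ℚ.pos⇒nonZero (fromℕ m) {{fromℕ-pos m}}}}

recip-pos : ∀ m .{{_ : NonZero m}} → Positive (recip m)
recip-pos m = ℚ.1/pos⇒pos (fromℕ m) {{fromℕ-pos m}}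

0≤recip : ∀ m .{{_ : NonZero m}} → 0ℚ ≤ recip m
0≤recip m = 0≤1/ (fromℕ m) {{fromℕ-pos m}}

*-recip : ∀ m .{{_ : NonZero m}} → fromℕ m * recip m ≡ 1ℚ
*-recip m = 1/-inverseʳ (fromℕ m) {{fromℕ-pos m}}

recip-* : ∀ a b .{{_ : NonZero a}} .{{_ : NonZero b}} .{{_ : NonZero (a ℕ.* b)}} → fromℕ a * recip (a ℕ.* b) ≡ recip b
recip-* a b = begin
  A * r ≡⟨ ℚ.*-identityʳ _ ⟨
  A * r * 1ℚ ≡⟨ cong (A * r *_) (*-recip b) ⟨
  A * r * (B * recip b) ≡⟨ lemma A r B (recip b) ⟩
  (A * B) * r * recip b ≡⟨ cong (λ z → z * r * recip b) (fromℕ-* a b) ⟨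
  fromℕ (a ℕ.* b) * r * recip b ≡⟨ cong (_* recip b) (*-recip (a ℕ.* b)) ⟩
  1ℚ * recip b ≡⟨ ℚ.*-identityˡ _ ⟩
  recip b ∎
  where
  open Relation.Binary.PropositionalEquality.≡-Reasoning
  A = fromℕ a
  B = fromℕ b
  r = recip (a ℕ.* b)
  lemma : ∀ a b c d → a * b * (c * d) ≡ (a * c) * b * d
  lemma = ring-solve-∀ ℚ-ring

recip≤1 : ∀ m .{{_ : NonZero m}} → recip m ≤ 1ℚ
recip≤1 m = subst₂ _≤_ (ℚ.*-identityˡ (recip m)) (*-recip m) (*-monoʳ-≤ (0≤recip m) (fromℕ-mono-≤ (ℕ.>-nonZero⁻¹ m)))

recip<1 : ∀ m .{{_ : NonZero m}} → 1 ℕ.< m → recip m < 1ℚ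
recip<1 m 1<m = ℚ.≰⇒> λ 1≤r → ℕ.<⇒≱ 1<m (fromℕ-cancel-≤ (subst₂ _≤_ (ℚ.*-identityʳ (fromℕ m)) (*-recip m) (*-monoˡ-≤ (0≤fromℕ m) 1≤r)))

-- For a reciprocal accuracy the hop bound is a natural number and needs no rounding.
hopBound-recip : ∀ C k N .{{_ : NonZero N}} → hopBound C k (recip N) {{recip-pos N}} ≡ fromℕ ((C ℕ.* k ℕ.* N) ℕ.^ k)
hopBound-recip C k N = trans
  (cong (_^ k) (trans (cong (fromℕ (C ℕ.* k) *_) (ℚ.1/-involutive (fromℕ N) {{ℚ.pos⇒nonZero (fromℕ N) {{fromℕ-pos N}}}})) (sym (fromℕ-* (C ℕ.* k) N))))
  (sym (fromℕ-^ (C ℕ.* k ℕ.* N) k))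

Preserves-≤ : ∀ {n s s′} (G : Graph n) {P L} → s ≤ s′ → Preserves s G P L → Preserves s′ G P L
Preserves-≤ G s≤s′ pres uv∈ p = let q , le = pres uv∈ p in q , ℚ.≤-trans le (*-monoʳ-≤ (0≤pathLength G p) s≤s′)

n<2^logSize : ∀ n → n ℕ.< 2 ℕ.^ logSize n
n<2^logSize = n<2^1+⌊log₂n⌋

2^1+k∸1-nonZero : ∀ k → NonZero (2 ℕ.^ suc k ℕ.∸ 1)
2^1+k∸1-nonZero k = ℕ.>-nonZero (ℕ.∸-monoˡ-≤ 1 (ℕ.*-monoʳ-≤ 2 (ℕ.m^n>0 2 k)))

2^k≤2^1+k∸1 : ∀ k → 2 ℕ.^ k ℕ.≤ 2 ℕ.^ suc k ℕ.∸ 1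
2^k≤2^1+k∸1 k = ℕ.≤-trans (ℕ.m≤m+n (2 ℕ.^ k) (2 ℕ.^ k ℕ.∸ 1))
  (ℕ.≤-reflexive (sym (trans (cong (λ z → 2 ℕ.^ k ℕ.+ z ℕ.∸ 1) (ℕ.+-identityʳ (2 ℕ.^ k))) (ℕ.+-∸-assoc (2 ℕ.^ k) (ℕ.m^n>0 2 k)))))

module NearExact {C : ℕ} (guarantee : HopsetGuarantee C) where

  hopFactor : ℕ → ℕ → ℕ
  hopFactor n m = (C ℕ.* loglogSize n ℕ.* (2 ℕ.* suc (logSize n) ℕ.* m)) ℕ.^ loglogSize n

  -- The first two factors are `pairCost` at level 0. In the last one, 1 stands for the given pairs,
  -- and the other term for η levels whose hopsets are bounded by means of R = 2n.
  cost : ℕ → ℕ → ℕ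
  cost n m = (hopFactor n m ℕ.+ 2) ℕ.* (4 ℕ.* logSize n) ℕ.* (4 ℕ.* C ℕ.* logSize n ℕ.+ 1)

  nearExact : ∀ {n} (G : Graph n) m .{{_ : NonZero m}} P →
    Σ[ L ∈ Pairs n ] length L ℕ.≤ cost n m ℕ.* (length P ℕ.+ n) × Preserves (1ℚ + recip m) G P L
  nearExact {n} G m P =
    let L , size , pres = preserve η 0 (iterateLevel-≥ K η 0) P
    in L , ℕ.≤-trans size (size≤ (length P)) , Preserves-≤ G stretch pres
    where
    η = logSize n
    -- Large enough that K exceeds log n and n^(1/K) is at most 2, and small enough that a
    -- polylogarithm to the power k is n^o(1).
    k = loglogSize n
    K = 2 ℕ.^ suc k ℕ.∸ 1
    -- The η+1 factors 1+1/N multiply to at most 1 + 2(η+1)/N = 1 + 1/m.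
    N = 2 ℕ.* suc η ℕ.* m
    M = hopFactor n m
    instance
      2η-nonZero : NonZero (2 ℕ.* suc η)
      2η-nonZero = ℕ.m*n≢0 2 (suc η)
      N-nonZero : NonZero N
      N-nonZero = ℕ.m*n≢0 (2 ℕ.* suc η) m
      K-nonZero : NonZero K
      K-nonZero = 2^1+k∸1-nonZero k
      ϵ-pos : Positive (recip N)
      ϵ-pos = recip-pos N
    1<N : 1 ℕ.< N
    1<N = ℕ.≤-trans (ℕ.*-monoʳ-≤ 2 {1} {suc η} (s≤s z≤n)) (ℕ.m≤m*n (2 ℕ.* suc η) m)
    n≤2^K : n ℕ.≤ 2 ℕ.^ K
    n≤2^K = ℕ.≤-trans (ℕ.<⇒≤ (n<2^logSize n)) (ℕ.^-monoʳ-≤ 2 (ℕ.≤-trans (logSize≤ n) (2^k≤2^1+k∸1 k)))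
    -- That is, n^(1+1/K) ≤ 2n.
    R-bound : n ℕ.^ suc K ℕ.≤ (2 ℕ.* n) ℕ.^ K
    R-bound = ℕ.≤-trans (ℕ.*-monoˡ-≤ (n ℕ.^ K) n≤2^K) (ℕ.≤-reflexive (sym (^-distribʳ-* 2 n K)))
    open Preserver guarantee G η (n<2^logSize n) k (s≤s z≤n) (recip N) (recip<1 N 1<N)
      M (λ β β≤ → fromℕ-cancel-≤ (subst (fromℕ β ≤_) (hopBound-recip C k N) β≤)) (2 ℕ.* n) R-bound
    size≤ : ∀ p → p ℕ.* pairCost 0 ℕ.+ η ℕ.* levelCost ℕ.≤ cost n m ℕ.* (p ℕ.+ n)
    size≤ p = ℕ.≤-trans (ℕ.m≤m+n _ _) (ℕ.≤-reflexive (expand p (M ℕ.+ 2) η C n))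
      where
      expand : ∀ p M η C n → p ℕ.* (M ℕ.* (4 ℕ.* η ℕ.* 1)) ℕ.+ η ℕ.* (2 ℕ.* (C ℕ.* (2 ℕ.* n)) ℕ.* (M ℕ.* (4 ℕ.* η)))
        ℕ.+ M ℕ.* (4 ℕ.* η) ℕ.* (4 ℕ.* C ℕ.* η ℕ.* p ℕ.+ n) ≡ M ℕ.* (4 ℕ.* η) ℕ.* (4 ℕ.* C ℕ.* η ℕ.+ 1) ℕ.* (p ℕ.+ n)
      expand = solve-∀
    exact : fromℕ (2 ℕ.* suc η) * recip N ≡ recip m
    exact = recip-* (2 ℕ.* suc η) m
    stretch : (1ℚ + recip N) ^ suc η ≤ 1ℚ + recip m
    stretch = subst (λ x → (1ℚ + recip N) ^ suc η ≤ 1ℚ + x) exact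
      ([1+ϵ]^j≤ (0≤recip N) (suc η) (subst (_≤ 1ℚ) (sym exact) (recip≤1 m)))

  cost-growth : ∀ b → ∃[ a ] ∀ n m → m ℕ.≤ 2 ℕ.^ (b ℕ.* loglogSize n) → cost n m ℕ.≤ growth a n
  cost-growth b = e₁ ℕ.+ e₂ , λ n m m≤ →
    *≤growth e₁ e₂ n
      (*≤growth (2 ℕ.+ (e₀ ℕ.+ 2)) 5 n
        (+≤growth e₀ 2 n (^≤growth e₀ n (base n m m≤)) (constant≤growth 2 n))
        (*≤growth 4 1 n (constant≤growth 4 n) (logSize≤growth n)))
      (+≤growth (4 ℕ.* C ℕ.+ 1) 1 n (*≤growth (4 ℕ.* C) 1 n (constant≤growth (4 ℕ.* C) n) (logSize≤growth n)) (constant≤growth 1 n))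
    where
    e₀ = C ℕ.+ 1 ℕ.+ (1 ℕ.+ 2 ℕ.+ b)
    e₁ = 2 ℕ.+ (e₀ ℕ.+ 2) ℕ.+ 5
    e₂ = 2 ℕ.+ (4 ℕ.* C ℕ.+ 1 ℕ.+ 1)
    module _ (n m : ℕ) (m≤ : m ℕ.≤ 2 ℕ.^ (b ℕ.* loglogSize n)) where
      l = loglogSize n
      base : C ℕ.* l ℕ.* (2 ℕ.* suc (logSize n) ℕ.* m) ℕ.≤ 2 ℕ.^ ((C ℕ.+ 1 ℕ.+ (1 ℕ.+ 2 ℕ.+ b)) ℕ.* l)
      base = *≤polylog (C ℕ.+ 1) (1 ℕ.+ 2 ℕ.+ b) n
        (*≤polylog C 1 n (constant≤polylog C n) (subst (λ z → l ℕ.≤ 2 ℕ.^ z) (sym (ℕ.*-identityˡ l)) (ℕ.<⇒≤ (n<2^n l))))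
        (*≤polylog (1 ℕ.+ 2) b n (*≤polylog 1 2 n 2≤ suc-logSize) m≤)
        where
        2≤ : 2 ℕ.≤ 2 ℕ.^ (1 ℕ.* l)
        2≤ = ℕ.^-monoʳ-≤ 2 {1} {1 ℕ.* l} (s≤s z≤n)
        suc-logSize : suc (logSize n) ℕ.≤ 2 ℕ.^ (2 ℕ.* l)
        suc-logSize = ℕ.≤-trans (ℕ.+-mono-≤ (ℕ.m^n>0 2 l) (logSize≤ n))
          (ℕ.≤-trans (ℕ.≤-reflexive (cong (2 ℕ.^ l ℕ.+_) (sym (ℕ.+-identityʳ (2 ℕ.^ l)))))
            (ℕ.^-monoʳ-≤ 2 {suc l} {2 ℕ.* l} (subst (suc l ℕ.≤_) (sym (cong (l ℕ.+_) (ℕ.+-identityʳ l))) (ℕ.+-monoˡ-≤ l {1} {l} (s≤s z≤n)))))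

-- Sourcewise spanners

small-recip : ∀ ϵ → 0ℚ < ϵ → ∃[ m ] recip (suc m) ≤ ϵ
small-recip ϵ 0<ϵ = m , (begin
  recip (suc m) ≡⟨ ℚ.*-identityʳ _ ⟨
  recip (suc m) * 1ℚ ≤⟨ *-monoˡ-≤ (0≤recip (suc m)) 1≤ ⟩
  recip (suc m) * (ϵ * fromℕ (suc m)) ≡⟨ lemma (recip (suc m)) ϵ (fromℕ (suc m)) ⟩
  fromℕ (suc m) * recip (suc m) * ϵ ≡⟨ cong (_* ϵ) (*-recip (suc m)) ⟩
  1ℚ * ϵ ≡⟨ ℚ.*-identityˡ ϵ ⟩
  ϵ ∎)
  where
  open ℚ.≤-Reasoning
  instance
    ϵ-pos : Positive ϵ
    ϵ-pos = ℚ.positive 0<ϵ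
  upper = fromℕ-upper ((1/ ϵ) {{ℚ.pos⇒nonZero ϵ}})
  m = proj₁ upper
  1≤ : 1ℚ ≤ ϵ * fromℕ (suc m)
  1≤ = subst (_≤ ϵ * fromℕ (suc m)) (1/-inverseʳ ϵ)
    (*-monoˡ-≤ (ℚ.<⇒≤ 0<ϵ) (ℚ.≤-trans (proj₂ upper) (fromℕ-mono-≤ (ℕ.n≤1+n m))))
  lemma : ∀ a b c → a * (b * c) ≡ c * a * b
  lemma = ring-solve-∀ ℚ-ring

-- The hypothesis says x ≤ s^(1/k), whence s·x ≤ s^(1+1/k).
root-≤ : ∀ s k {r} → 1 ℕ.≤ k → fromℕ s ^[1+1/ k ]≤ r → ∀ x → x ℕ.^ k ℕ.≤ s → fromℕ (s ℕ.* x) ≤ r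
root-≤ s k {r} 1≤k (0≤r , le) x x^k≤s = ^-cancelˡ-≤ k 1≤k (0≤fromℕ (s ℕ.* x)) 0≤r (begin
  fromℕ (s ℕ.* x) ^ k ≡⟨ fromℕ-^ (s ℕ.* x) k ⟨
  fromℕ ((s ℕ.* x) ℕ.^ k) ≤⟨ fromℕ-mono-≤ (ℕ.≤-trans (ℕ.≤-reflexive (^-distribʳ-* s x k)) (ℕ.*-monoʳ-≤ (s ℕ.^ k) x^k≤s)) ⟩
  fromℕ (s ℕ.^ k ℕ.* s) ≡⟨ cong fromℕ (ℕ.*-comm (s ℕ.^ k) s) ⟩
  fromℕ (s ℕ.^ suc k) ≡⟨ fromℕ-^ s (suc k) ⟩
  fromℕ s ^ suc k ≤⟨ le ⟩
  r ^ k ∎)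
  where open ℚ.≤-Reasoning

size≤root : ∀ s k {r} → 1 ℕ.≤ k → fromℕ s ^[1+1/ k ]≤ r → fromℕ s ≤ r
size≤root zero    k 1≤k (0≤r , _) = 0≤r
size≤root (suc s) k {r} 1≤k bound = subst (λ x → fromℕ x ≤ r) (ℕ.*-identityʳ (suc s))
  (root-≤ (suc s) k 1≤k bound 1 (subst (ℕ._≤ suc s) (sym (ℕ.^-zeroˡ k)) (s≤s z≤n)))

twice≤root : ∀ s k {r} → 1 ℕ.≤ k → fromℕ s ^[1+1/ k ]≤ r → fromℕ (s ℕ.* 2) ≤ fromℕ 2 * r
twice≤root s k {r} 1≤k bound = subst (_≤ fromℕ 2 * r) (trans (sym (fromℕ-* 2 s)) (cong fromℕ (ℕ.*-comm 2 s)))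
  (*-monoˡ-≤ (0≤fromℕ 2) (size≤root s k 1≤k bound))

-- The ideal ratio is s^(1/k) with k levels. Once k reaches η, ratio 2 with η levels is used
-- instead, so that both the number of pairs and the later loss in stretch are bounded independently
-- of k.
record Sampling (s k η : ℕ) : Set where
  field
    levels ratio : ℕ
    1≤levels     : 1 ℕ.≤ levels
    levels≤k     : levels ℕ.≤ k
    levels≤η     : levels ℕ.≤ η
    0<ratio      : 0 ℕ.< ratio
    s<ratio^     : s ℕ.< ratio ℕ.^ levels
    s*ratio≤     : ∀ r → fromℕ s ^[1+1/ k ]≤ r → fromℕ (s ℕ.* ratio) ≤ fromℕ 2 * r

sampling : ∀ s k η → 1 ℕ.≤ k → 1 ℕ.≤ η → s ℕ.< 2 ℕ.^ η → Sampling s k η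
sampling s k η 1≤k 1≤η s<2^η with η ℕ.≤? k
... | yes η≤k = record
  { levels = η ; ratio = 2 ; 1≤levels = 1≤η ; levels≤k = η≤k ; levels≤η = ℕ.≤-refl
  ; 0<ratio = s≤s z≤n ; s<ratio^ = s<2^η ; s*ratio≤ = λ r → twice≤root s k 1≤k }
... | no η≰k = search s (ℕ.<-≤-trans (n<1+n^ s) (ℕ.^-monoˡ-≤ k (ℕ.n≤1+n (suc s))))
  where
  n<1+n^ : ∀ s → s ℕ.< suc s ℕ.^ k
  n<1+n^ s = subst (ℕ._≤ suc s ℕ.^ k) (ℕ.*-identityʳ (suc s)) (ℕ.^-monoʳ-≤ (suc s) 1≤k)
  found : ∀ q → 0 ℕ.< q → s ℕ.< q ℕ.^ k → (∀ r → fromℕ s ^[1+1/ k ]≤ r → fromℕ (s ℕ.* q) ≤ fromℕ 2 * r) → Sampling s k η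
  found q 0<q s<q^k sq≤ = record
    { levels = k ; ratio = q ; 1≤levels = 1≤k ; levels≤k = ℕ.≤-refl ; levels≤η = ℕ.<⇒≤ (ℕ.≰⇒> η≰k)
    ; 0<ratio = 0<q ; s<ratio^ = s<q^k ; s*ratio≤ = sq≤ }
  -- Descends to the smallest ratio q+2 ≥ 2 that works. The one below it fails, so it is at most
  -- s^(1/k), and the ratio found is at most twice that.
  search : ∀ q → s ℕ.< (2 ℕ.+ q) ℕ.^ k → Sampling s k η
  search zero s<2^k = found 2 (s≤s z≤n) s<2^k λ r → twice≤root s k 1≤k
  search (suc q) s<q^k with s ℕ.<? (2 ℕ.+ q) ℕ.^ k
  ... | yes s< = search q s<
  ... | no  s≮ = found (3 ℕ.+ q) (s≤s z≤n) s<q^k λ r bound → begin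
    fromℕ (s ℕ.* (3 ℕ.+ q)) ≤⟨ fromℕ-mono-≤ (ℕ.*-monoʳ-≤ s {3 ℕ.+ q} {2 ℕ.* (2 ℕ.+ q)} (3+q≤ q)) ⟩
    fromℕ (s ℕ.* (2 ℕ.* (2 ℕ.+ q))) ≡⟨ cong fromℕ (lemma s (2 ℕ.+ q)) ⟩
    fromℕ (2 ℕ.* (s ℕ.* (2 ℕ.+ q))) ≡⟨ fromℕ-* 2 (s ℕ.* (2 ℕ.+ q)) ⟩
    fromℕ 2 * fromℕ (s ℕ.* (2 ℕ.+ q)) ≤⟨ *-monoˡ-≤ (0≤fromℕ 2) (root-≤ s k 1≤k bound (2 ℕ.+ q) (ℕ.≮⇒≥ s≮)) ⟩
    fromℕ 2 * r ∎
    where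
    open ℚ.≤-Reasoning
    lemma : ∀ s x → s ℕ.* (2 ℕ.* x) ≡ 2 ℕ.* (s ℕ.* x)
    lemma = solve-∀
    3+q≤ : ∀ q → 3 ℕ.+ q ℕ.≤ 2 ℕ.* (2 ℕ.+ q)
    3+q≤ q = ℕ.≤-trans (ℕ.m≤m+n (3 ℕ.+ q) (1 ℕ.+ q)) (ℕ.≤-reflexive (twice q))
      where
      twice : ∀ q → 3 ℕ.+ q ℕ.+ (1 ℕ.+ q) ≡ 2 ℕ.* (2 ℕ.+ q)
      twice = solve-∀

-- At most η levels, each with a term 4η·(s·q) ≤ 8η·r for the bunches and s ≤ r for the pivots.
starCost : ℕ → ℕ
starCost n = logSize n ℕ.* (8 ℕ.* logSize n ℕ.+ 1)

record SpanningPairs {n} (G : Graph n) (S : List (Fin n)) (k : ℕ) : Set₁ where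
  field
    κ        : ℕ
    1≤κ      : 1 ℕ.≤ κ
    κ≤k      : κ ℕ.≤ k
    κ≤log    : κ ℕ.≤ logSize n
    pairs    : Pairs n
    meets    : Meets G S (fromℕ (2 ℕ.* κ) - 1ℚ) S pairs
    size     : ∀ r → fromℕ (length S) ^[1+1/ k ]≤ r → fromℕ (length pairs) ≤ fromℕ (starCost n) * r

spanningPairs : ∀ {n} (G : Graph n) S → Unique S → ∀ k → 1 ℕ.≤ k → SpanningPairs G S k
spanningPairs {n} G S S-unique k 1≤k =
  let P , P-size , meets = hierarchy G S (2 ℕ.* η) q (square<2^ η s<2^η) κ S S-unique ℕ.≤-refl s<ratio^
  in record
  { κ = κ ; 1≤κ = 1≤levels ; κ≤k = levels≤k ; κ≤log = levels≤η ; pairs = P ; meets = meets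
  ; size = λ r bound → bounded r bound (length P) P-size }
  where
  η = logSize n
  s = length S
  s<2^η : s ℕ.< 2 ℕ.^ η
  s<2^η = ℕ.≤-<-trans (ℕ.≤-trans (Unique-⊆⇒length≤ S-unique (λ {x} _ → ∈-allFin x)) (ℕ.≤-reflexive (length-allFin n))) (n<2^logSize n)
  open Sampling (sampling s k η 1≤k (s≤s z≤n) s<2^η) renaming (levels to κ; ratio to q)
  instance
    q-nonZero : NonZero q
    q-nonZero = ℕ.>-nonZero 0<ratio
  bounded : ∀ r → fromℕ s ^[1+1/ k ]≤ r → ∀ l → l ℕ.≤ κ ℕ.* (s ℕ.* (2 ℕ.* (2 ℕ.* η) ℕ.* q ℕ.+ 1)) → fromℕ l ≤ fromℕ (starCost n) * r
  bounded r bound l l≤ = begin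
    fromℕ l
      ≤⟨ fromℕ-mono-≤ (ℕ.≤-trans l≤ (ℕ.≤-trans (ℕ.*-monoˡ-≤ _ levels≤η) (ℕ.≤-reflexive (lemma₁ η s q)))) ⟩
    fromℕ (η ℕ.* (4 ℕ.* η) ℕ.* (s ℕ.* q) ℕ.+ η ℕ.* s)
      ≡⟨ trans (fromℕ-+ (η ℕ.* (4 ℕ.* η) ℕ.* (s ℕ.* q)) (η ℕ.* s)) (cong₂ _+_ (fromℕ-* (η ℕ.* (4 ℕ.* η)) (s ℕ.* q)) (fromℕ-* η s)) ⟩
    fromℕ (η ℕ.* (4 ℕ.* η)) * fromℕ (s ℕ.* q) + fromℕ η * fromℕ s
      ≤⟨ ℚ.+-mono-≤ (*-monoˡ-≤ (0≤fromℕ (η ℕ.* (4 ℕ.* η))) (s*ratio≤ r bound)) (*-monoˡ-≤ (0≤fromℕ η) (size≤root s k 1≤k bound)) ⟩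
    fromℕ (η ℕ.* (4 ℕ.* η)) * (fromℕ 2 * r) + fromℕ η * r
      ≡⟨ lemma₂ (fromℕ (η ℕ.* (4 ℕ.* η))) (fromℕ 2) r (fromℕ η) ⟩
    (fromℕ (η ℕ.* (4 ℕ.* η)) * fromℕ 2 + fromℕ η) * r
      ≡⟨ cong (_* r) (trans (cong (_+ fromℕ η) (sym (fromℕ-* (η ℕ.* (4 ℕ.* η)) 2))) (sym (fromℕ-+ (η ℕ.* (4 ℕ.* η) ℕ.* 2) η))) ⟩
    fromℕ (η ℕ.* (4 ℕ.* η) ℕ.* 2 ℕ.+ η) * r
      ≡⟨ cong (λ x → fromℕ x * r) (lemma₃ η) ⟩
    fromℕ (starCost n) * r ∎
    where
    open ℚ.≤-Reasoning
    lemma₁ : ∀ η s q → η ℕ.* (s ℕ.* (2 ℕ.* (2 ℕ.* η) ℕ.* q ℕ.+ 1)) ≡ η ℕ.* (4 ℕ.* η) ℕ.* (s ℕ.* q) ℕ.+ η ℕ.* s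
    lemma₁ = solve-∀
    lemma₂ : ∀ a b r c → a * (b * r) + c * r ≡ (a * b + c) * r
    lemma₂ = ring-solve-∀ ℚ-ring
    lemma₃ : ∀ η → η ℕ.* (4 ℕ.* η) ℕ.* 2 ℕ.+ η ≡ η ℕ.* (8 ℕ.* η ℕ.+ 1)
    lemma₃ = solve-∀

starCost-growth : ∀ n → starCost n ℕ.≤ growth 13 n
starCost-growth n = *≤growth 1 12 n (logSize≤growth n)
  (+≤growth 9 1 n (*≤growth 8 1 n (constant≤growth 8 n) (logSize≤growth n)) (constant≤growth 1 n))

module Sourcewise {C : ℕ} (guarantee : HopsetGuarantee C) where

  open NearExact guarantee

  sourcewise : ∀ ϵ → 0ℚ < ϵ → ∃[ a ] ∀ {n} (G : Graph n) k → 1 ℕ.≤ k → ∀ S → Unique S →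
    Σ[ L ∈ Pairs n ]
      (∀ r → fromℕ (length S) ^[1+1/ k ]≤ r → fromℕ (length L) ≤ fromℕ (growth a n) * (fromℕ n + r)) ×
      (∀ {u v} → u ∈ S → (p : Path (Edge G) u v) →
        Route (restrict G L) u v ((fromℕ (4 ℕ.* k) - 1ℚ + ϵ) * pathLength p))
  sourcewise ϵ 0<ϵ = a₀ ℕ.+ 17 , λ {n} G k 1≤k S S-unique →
    let open SpanningPairs (spanningPairs G S S-unique k 1≤k)
        -- The stretch 4κ-1 is below 4·log n for every k, so a relative error 1/m adds at most
        -- 1/(m₀+1) ≤ ϵ. As m is polylogarithmic, the preserver remains affordable.
        m = 4 ℕ.* logSize n ℕ.* suc m₀
        instance
          4η-nonZero : NonZero (4 ℕ.* logSize n)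
          4η-nonZero = ℕ.m*n≢0 4 (logSize n)
          m-nonZero : NonZero m
          m-nonZero = ℕ.m*n≢0 (4 ℕ.* logSize n) (suc m₀)
        L , L-size , pres = nearExact G m (pairs ++ nearestPairs G S)
    in L ,
       (λ r bound → few n (length pairs) (length (nearestPairs G S)) (length L) (length-nearestPairs G S)
         (subst (λ l → length L ℕ.≤ cost n m ℕ.* (l ℕ.+ n)) (length-++ pairs) L-size) r (proj₁ bound) (size r bound)) ,
       λ {u} {v} u∈S p →
         let p′ , le = sourcewise-path G S {1ℚ + recip m} {fromℕ (2 ℕ.* κ) - 1ℚ} {pairs} {L} (p≤p+q′ {1ℚ} (0≤recip m)) (0≤2κ-1 κ 1≤κ) meets pres u∈S p
         in p′ , ℚ.≤-trans le (subst (_≤ (fromℕ (4 ℕ.* k) - 1ℚ + ϵ) * pathLength p) (ℚ.*-assoc (1ℚ + recip m) (fromℕ (2 ℕ.* κ) - 1ℚ + (fromℕ (2 ℕ.* κ) - 1ℚ) + 1ℚ) (pathLength p))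
              (*-monoʳ-≤ (0≤pathLength G p) (stretch (logSize n) κ k κ≤log κ≤k)))
    where
    m₀ = proj₁ (small-recip ϵ 0<ϵ)
    b₀ = 4 ℕ.+ 1 ℕ.+ suc m₀
    a₀ = proj₁ (cost-growth b₀)
    0≤2κ-1 : ∀ κ → 1 ℕ.≤ κ → 0ℚ ≤ fromℕ (2 ℕ.* κ) - 1ℚ
    0≤2κ-1 κ 1≤κ = ℚ.+-monoˡ-≤ (ℚ.- 1ℚ) {1ℚ} {fromℕ (2 ℕ.* κ)} (fromℕ-mono-≤ (ℕ.≤-trans 1≤κ (ℕ.m≤m+n κ (κ ℕ.+ 0))))
    stretch : ∀ η .{{_ : NonZero (4 ℕ.* η)}} .{{_ : NonZero (4 ℕ.* η ℕ.* suc m₀)}} κ k → κ ℕ.≤ η → κ ℕ.≤ k →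
      let c = fromℕ (2 ℕ.* κ) - 1ℚ in
      (1ℚ + recip (4 ℕ.* η ℕ.* suc m₀)) * (c + c + 1ℚ) ≤ fromℕ (4 ℕ.* k) - 1ℚ + ϵ
    stretch η κ k κ≤η κ≤k = begin
      (1ℚ + ρ) * (c + c + 1ℚ) ≡⟨ cong ((1ℚ + ρ) *_) 2c+1 ⟩
      (1ℚ + ρ) * (fromℕ (4 ℕ.* κ) - 1ℚ) ≡⟨ trans (ℚ.*-distribʳ-+ (fromℕ (4 ℕ.* κ) - 1ℚ) 1ℚ ρ) (cong (_+ ρ * (fromℕ (4 ℕ.* κ) - 1ℚ)) (ℚ.*-identityˡ (fromℕ (4 ℕ.* κ) - 1ℚ))) ⟩
      fromℕ (4 ℕ.* κ) - 1ℚ + ρ * (fromℕ (4 ℕ.* κ) - 1ℚ)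
        ≤⟨ ℚ.+-mono-≤ (ℚ.+-monoˡ-≤ (ℚ.- 1ℚ) (fromℕ-mono-≤ (ℕ.*-monoʳ-≤ 4 κ≤k))) (*-monoˡ-≤ (0≤recip (4 ℕ.* η ℕ.* suc m₀)) 4κ-1≤4η) ⟩
      fromℕ (4 ℕ.* k) - 1ℚ + ρ * fromℕ (4 ℕ.* η)
        ≡⟨ cong (fromℕ (4 ℕ.* k) - 1ℚ +_) (trans (ℚ.*-comm ρ (fromℕ (4 ℕ.* η))) (recip-* (4 ℕ.* η) (suc m₀))) ⟩
      fromℕ (4 ℕ.* k) - 1ℚ + recip (suc m₀)
        ≤⟨ ℚ.+-monoʳ-≤ (fromℕ (4 ℕ.* k) - 1ℚ) (proj₂ (small-recip ϵ 0<ϵ)) ⟩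
      fromℕ (4 ℕ.* k) - 1ℚ + ϵ ∎
      where
      open ℚ.≤-Reasoning
      ρ = recip (4 ℕ.* η ℕ.* suc m₀)
      c = fromℕ (2 ℕ.* κ) - 1ℚ
      4κ-1≤4η : fromℕ (4 ℕ.* κ) - 1ℚ ≤ fromℕ (4 ℕ.* η)
      4κ-1≤4η = subst (fromℕ (4 ℕ.* κ) - 1ℚ ≤_) (ℚ.+-identityʳ _) (ℚ.+-mono-≤ (fromℕ-mono-≤ (ℕ.*-monoʳ-≤ 4 κ≤η)) (ℚ.neg-antimono-≤ 0≤1))
      2c+1 : c + c + 1ℚ ≡ fromℕ (4 ℕ.* κ) - 1ℚ
      2c+1 = trans (lemma (fromℕ (2 ℕ.* κ)) 1ℚ) (cong (_- 1ℚ) (trans (sym (fromℕ-+ (2 ℕ.* κ) (2 ℕ.* κ))) (cong fromℕ (four κ))))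
        where
        lemma : ∀ a o → (a - o) + (a - o) + o ≡ (a + a) - o
        lemma = ring-solve-∀ ℚ-ring
        four : ∀ κ → 2 ℕ.* κ ℕ.+ 2 ℕ.* κ ≡ 4 ℕ.* κ
        four = solve-∀
    few : ∀ n p q l → q ℕ.≤ n → l ℕ.≤ cost n (4 ℕ.* logSize n ℕ.* suc m₀) ℕ.* (p ℕ.+ q ℕ.+ n) → ∀ r → 0ℚ ≤ r →
      fromℕ p ≤ fromℕ (starCost n) * r → fromℕ l ≤ fromℕ (growth (a₀ ℕ.+ 17) n) * (fromℕ n + r)
    few n p q l q≤n l≤ r 0≤r p≤ = begin
      fromℕ l ≤⟨ fromℕ-mono-≤ (ℕ.≤-trans l≤ (ℕ.*-mono-≤ c≤ (ℕ.+-monoˡ-≤ n (ℕ.+-monoʳ-≤ p q≤n)))) ⟩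
      fromℕ (growth a₀ n ℕ.* (p ℕ.+ n ℕ.+ n)) ≡⟨ trans (fromℕ-* (growth a₀ n) _) (cong (g *_) (trans (fromℕ-+ (p ℕ.+ n) n) (cong (_+ fromℕ n) (fromℕ-+ p n)))) ⟩
      g * (fromℕ p + fromℕ n + fromℕ n) ≤⟨ *-monoˡ-≤ (0≤fromℕ (growth a₀ n)) (begin
        fromℕ p + fromℕ n + fromℕ n ≡⟨ ℚ.+-assoc (fromℕ p) (fromℕ n) (fromℕ n) ⟩
        fromℕ p + (fromℕ n + fromℕ n) ≡⟨ cong (fromℕ p +_) (2* fromℕ n) ⟨
        fromℕ p + fromℕ 2 * fromℕ n ≤⟨ ℚ.+-mono-≤ (ℚ.≤-trans p≤ (*-monoˡ-≤ {r} {fromℕ n + r} {fromℕ (starCost n)} (0≤fromℕ (starCost n)) (p≤q+p′ (0≤fromℕ n))))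
                (*-monoˡ-≤ {fromℕ n} {fromℕ n + r} {fromℕ 2} (0≤fromℕ 2) (p≤p+q′ 0≤r)) ⟩
        fromℕ (starCost n) * (fromℕ n + r) + fromℕ 2 * (fromℕ n + r) ≡⟨ ℚ.*-distribʳ-+ (fromℕ n + r) (fromℕ (starCost n)) (fromℕ 2) ⟨
        (fromℕ (starCost n) + fromℕ 2) * (fromℕ n + r) ≡⟨ cong (_* (fromℕ n + r)) (fromℕ-+ (starCost n) 2) ⟨
        fromℕ (starCost n ℕ.+ 2) * (fromℕ n + r) ∎) ⟩
      g * (fromℕ (starCost n ℕ.+ 2) * (fromℕ n + r)) ≡⟨ ℚ.*-assoc g (fromℕ (starCost n ℕ.+ 2)) (fromℕ n + r) ⟨
      g * fromℕ (starCost n ℕ.+ 2) * (fromℕ n + r) ≡⟨ cong (_* (fromℕ n + r)) (fromℕ-* (growth a₀ n) (starCost n ℕ.+ 2)) ⟨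
      fromℕ (growth a₀ n ℕ.* (starCost n ℕ.+ 2)) * (fromℕ n + r)
        ≤⟨ *-monoʳ-≤ (0≤+ (0≤fromℕ n) 0≤r) (fromℕ-mono-≤ (*≤growth a₀ 17 n ℕ.≤-refl
             (+≤growth 13 2 n (starCost-growth n) (constant≤growth 2 n)))) ⟩
      fromℕ (growth (a₀ ℕ.+ 17) n) * (fromℕ n + r) ∎
      where
      open ℚ.≤-Reasoning
      g = fromℕ (growth a₀ n)
      c≤ : cost n (4 ℕ.* logSize n ℕ.* suc m₀) ℕ.≤ growth a₀ n
      c≤ = proj₂ (cost-growth b₀) n _ (*≤polylog 5 (suc m₀) n
        (*≤polylog 4 1 n (constant≤polylog 4 n) (logSize≤polylog n)) (constant≤polylog (suc m₀) n))

-- Slack spanners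

elements : ∀ {n} → Subset n → List (Fin n)
elements []          = []
elements (true  ∷ S) = zero ∷ map suc (elements S)
elements (false ∷ S) = map suc (elements S)

length-elements : ∀ {n} (S : Subset n) → length (elements S) ≡ ∣ S ∣
length-elements []          = refl
length-elements (true  ∷ S) = cong suc (trans (length-map suc (elements S)) (length-elements S))
length-elements (false ∷ S) = trans (length-map suc (elements S)) (length-elements S)

elements-unique : ∀ {n} (S : Subset n) → Unique (elements S)
elements-unique []          = []
elements-unique (true  ∷ S) = All.tabulate (λ x∈ → λ { refl → case-zero (∈-map⁻ suc x∈) }) ∷ Unique.map⁺ Fin.suc-injective (elements-unique S)
  where
  case-zero : ¬ (∃[ y ] y ∈ elements S × zero ≡ suc y)
  case-zero ()
elements-unique (false ∷ S) = Unique.map⁺ Fin.suc-injective (elements-unique S)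

elements⁺ : ∀ {n} {S : Subset n} {x} → x Subset.∈ S → x ∈ elements S
elements⁺ {S = true  ∷ S} here       = here refl
elements⁺ {S = true  ∷ S} (there x∈) = there (∈-map⁺ suc (elements⁺ x∈))
elements⁺ {S = false ∷ S} (there x∈) = ∈-map⁺ suc (elements⁺ x∈)

elements⁻ : ∀ {n} {S : Subset n} {x} → x ∈ elements S → x Subset.∈ S
elements⁻ {S = true  ∷ S} (here refl) = here
elements⁻ {S = true  ∷ S} (there x∈) with ∈-map⁻ suc x∈
... | y , y∈ , refl = there (elements⁻ y∈)
elements⁻ {S = false ∷ S} x∈ with ∈-map⁻ suc x∈
... | y , y∈ , refl = there (elements⁻ y∈)

-- The ceiling is computed as the negated floor of -q. The remainder of that division, which is less
-- than the denominator, is the amount added by rounding.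
ceiling< : ∀ q c → 0ℚ ≤ q → ℤ.+ c ≡ ℚ.ceiling q → fromℕ c < q + 1ℚ
ceiling< q zero 0≤q _ = ℚ.<-≤-trans (ℚ.positive⁻¹ 1ℚ) (p≤q+p′ 0≤q)
ceiling< (mkℚ -[1+ _ ] _ _) (suc c) (*≤* ()) _
ceiling< (mkℚ (ℤ.+ 0) _ _) (suc c) 0≤q ()
ceiling< q@(mkℚ +[1+ m ] d-1 _) (suc c) 0≤q eq =
  subst (_< q + 1ℚ) (trans (ℚ.+-comm (fromℕ c) 1ℚ) (sym (fromℕ-+ 1 c))) (ℚ.+-monoˡ-< 1ℚ c<q)
  where
  d = suc d-1
  r = -[1+ m ] ℤ.%ℕ d
  quotient : -[1+ m ] ℤ./ℕ d ≡ -[1+ c ]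
  quotient = trans (sym (div-pos-is-/ℕ -[1+ m ] d))
    (trans (sym (ℤ.neg-involutive (-[1+ m ] ℤ./ (ℤ.+ d)))) (cong ℤ.-_ (sym eq)))
  division : +[1+ m ] ℤ.+ (ℤ.+ r) ≡ +[1+ c ] ℤ.* (ℤ.+ d)
  division = trans
    (cong (λ z → ℤ.- z ℤ.+ (ℤ.+ r)) (trans (a≡a%ℕn+[a/ℕn]*n -[1+ m ] d) (cong (λ z → (ℤ.+ r) ℤ.+ z ℤ.* (ℤ.+ d)) quotient)))
    (cancel (ℤ.+ r) -[1+ c ] (ℤ.+ d))
    where
    cancel : ∀ r q d → ℤ.- (r ℤ.+ q ℤ.* d) ℤ.+ r ≡ (ℤ.- q) ℤ.* d
    cancel = ℤ-solve-∀
  natural : suc m ℕ.+ r ≡ suc c ℕ.* d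
  natural = ℤ.+-injective (trans division (sym (ℤ.pos-* (suc c) d)))
  c*d< : c ℕ.* d ℕ.< suc m
  c*d< = ℕ.+-cancelˡ-< d _ _ (subst (ℕ._< d ℕ.+ suc m) natural (subst (ℕ._< d ℕ.+ suc m) (ℕ.+-comm r (suc m))
    (ℕ.+-monoˡ-< (suc m) (n%ℕd<d -[1+ m ] d))))
  c<q : fromℕ c < q
  c<q = *<* (subst₂ ℤ._<_ (ℤ.pos-* c d) (sym (ℤ.*-identityʳ +[1+ m ])) (ℤ.+<+ c*d<))

module _ {n} (G : Graph n) where

  farthest⇒closer : ∀ {v F} → IsFarthest G v F → ∀ {w x} → w Subset.∈ F → x Subset.∉ F → Closer G v x w
  farthest⇒closer farthest w∈F x∉F p =
    let p⁻ , p⁻-len , _ = reverse G p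
        _ , ((q , q-len) , _) , d′≤ = farthest w∈F x∉F _ (isDist G (geodesic G p⁻))
        q⁻ , q⁻-len , _ = reverse G q
    in q⁻ , ℚ.≤-trans (ℚ.≤-reflexive (trans q⁻-len q-len))
         (ℚ.≤-trans d′≤ (ℚ.≤-trans (Geodesic.shortest (geodesic G p⁻) p⁻) (ℚ.≤-reflexive p⁻-len)))

  -- All vertices outside `F` are at least as close to v as w. Two roundings may make T + ∣F∣ equal
  -- to n+1, which costs one vertex; w itself keeps the threshold positive for T ≤ 1.
  far-ball : ∀ {v F} → IsFarthest G v F → ∀ {w} → w Subset.∈ F → ∀ T →
    T ℕ.+ ∣ F ∣ ℕ.≤ suc n → (T ℕ.∸ 1) ℕ.⊔ 1 ℕ.≤ length (ball G (allFin n) v w)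
  far-ball {v} {F} farthest {w} w∈F T T+F≤ = ℕ.⊔-lub T-1≤ 1≤
    where
    open ℕ.≤-Reasoning
    within : ∀ {x} → Closer G v x w → x ∈ ball G (allFin n) v w
    within {x} x≼w = ∈-filter⁺ (λ x → closer? G v x w) (∈-allFin x) x≼w
    1≤ : 1 ℕ.≤ length (ball G (allFin n) v w)
    1≤ = Unique-⊆⇒length≤ {xs = w ∷ []} ([] ∷ []) λ { (here refl) → within λ p → p , ℚ.≤-refl }
    T-1≤ : T ℕ.∸ 1 ℕ.≤ length (ball G (allFin n) v w)
    T-1≤ = begin
      T ℕ.∸ 1 ≡⟨ cong (ℕ._∸ 1) (ℕ.m+n∸n≡m T ∣ F ∣) ⟨
      T ℕ.+ ∣ F ∣ ℕ.∸ ∣ F ∣ ℕ.∸ 1 ≤⟨ ℕ.∸-monoˡ-≤ 1 (ℕ.∸-monoˡ-≤ ∣ F ∣ T+F≤) ⟩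
      suc n ℕ.∸ ∣ F ∣ ℕ.∸ 1 ≡⟨ trans (ℕ.∸-+-assoc (suc n) ∣ F ∣ 1) (cong (suc n ℕ.∸_) (ℕ.+-comm ∣ F ∣ 1)) ⟩
      n ℕ.∸ ∣ F ∣ ≡⟨ trans (length-elements (∁ F)) (∣∁p∣≡n∸∣p∣ F) ⟨
      length (elements (∁ F)) ≤⟨ Unique-⊆⇒length≤ (elements-unique (∁ F)) (λ x∈ → within (farthest⇒closer farthest w∈F (x∈∁p⇒x∉p (elements⁻ x∈)))) ⟩
      length (ball G (allFin n) v w) ∎

≤2*pred⊔1 : ∀ T → T ℕ.≤ 2 ℕ.* ((T ℕ.∸ 1) ℕ.⊔ 1)
≤2*pred⊔1 zero          = z≤n
≤2*pred⊔1 (suc zero)    = s≤s z≤n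
≤2*pred⊔1 (suc (suc T)) = ℕ.≤-trans (ℕ.m≤m+n (2 ℕ.+ T) T) (ℕ.≤-trans (ℕ.≤-reflexive (lemma T)) (ℕ.*-monoʳ-≤ 2 (ℕ.m≤m⊔n (suc T) 1)))
  where
  lemma : ∀ T → 2 ℕ.+ T ℕ.+ T ≡ 2 ℕ.* suc T
  lemma = solve-∀

abstract
  third : ℚ
  third = recip 3

  0<third : 0ℚ < third
  0<third = ℚ.positive⁻¹ (recip 3) {{recip-pos 3}}

  3*third : fromℕ 3 * third ≡ 1ℚ
  3*third = *-recip 3

module Slack {C : ℕ} (guarantee : HopsetGuarantee C) where

  open Sourcewise guarantee

  -- S meets every ball around v that reaches some w ∈ F, so that v → s → w costs
  -- three times the sourcewise stretch.
  slack : ∃[ a ] ∀ {n} (G : Graph n) ϵ .{{_ : Positive ϵ}} → ϵ < 1ℚ → ∀ k → 1 ℕ.≤ k →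
    ∃[ G′ ] IsSlackSpanner ϵ (fromℕ (12 ℕ.* k) - 1ℚ + 0ℚ) G G′ ×
      (∀ r → (1/ ϵ) {{ℚ.pos⇒nonZero ϵ}} ^[1+1/ k ]≤ r → fromℕ (#edges G′) ≤ fromℕ (growth a n) * (fromℕ n + r))
  slack = a₁ ℕ.+ 18 , slackSpanner
    where
    a₁ = proj₁ (sourcewise third 0<third)
    t₁ t₃ : ℕ → ℚ
    t₁ k = fromℕ (4 ℕ.* k) - 1ℚ + third
    t₃ k = fromℕ (12 ℕ.* k) - 1ℚ + 0ℚ
    0≤t₁ : ∀ k → 1 ℕ.≤ k → 0ℚ ≤ t₁ k
    0≤t₁ k 1≤k = 0≤+ {fromℕ (4 ℕ.* k) - 1ℚ} {third} (ℚ.+-monoˡ-≤ (ℚ.- 1ℚ) {1ℚ} {fromℕ (4 ℕ.* k)} (fromℕ-mono-≤ (ℕ.*-mono-≤ {1} {4} (s≤s z≤n) 1≤k))) (ℚ.<⇒≤ 0<third)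
    -- Three times 4k-1+1/3 is 12k-2, so the rounded error still leaves room below 12k-1 and the
    -- o(1) term can be 0.
    triple : ∀ k → t₁ k + t₁ k + t₁ k ≤ t₃ k
    triple k = begin
      t₁ k + t₁ k + t₁ k
        ≡⟨ rearrange (fromℕ (4 ℕ.* k)) 1ℚ third ⟩
      (fromℕ (4 ℕ.* k) + fromℕ (4 ℕ.* k) + fromℕ (4 ℕ.* k)) - 1ℚ + ((third + third + third - 1ℚ) - 1ℚ)
        ≡⟨ cong (λ x → (x - 1ℚ) + ((third + third + third - 1ℚ) - 1ℚ)) (trans (cong (_+ fromℕ (4 ℕ.* k)) (sym (fromℕ-+ (4 ℕ.* k) (4 ℕ.* k)))) (trans (sym (fromℕ-+ (4 ℕ.* k ℕ.+ 4 ℕ.* k) (4 ℕ.* k))) (cong fromℕ (twelve k)))) ⟩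
      fromℕ (12 ℕ.* k) - 1ℚ + ((third + third + third - 1ℚ) - 1ℚ)
        ≤⟨ ℚ.+-monoʳ-≤ (fromℕ (12 ℕ.* k) - 1ℚ) slack≤0 ⟩
      t₃ k ∎
      where
      open ℚ.≤-Reasoning
      twelve : ∀ k → 4 ℕ.* k ℕ.+ 4 ℕ.* k ℕ.+ 4 ℕ.* k ≡ 12 ℕ.* k
      twelve = solve-∀
      rearrange : ∀ a o e → (a - o + e) + (a - o + e) + (a - o + e) ≡ (a + a + a) - o + ((e + e + e - o) - o)
      rearrange = ring-solve-∀ ℚ-ring
      thirds : third + third + third ≡ 1ℚ
      thirds = trans (cong₂ _+_ (sym (2* third)) (sym (ℚ.*-identityˡ third))) (trans (sym (ℚ.*-distribʳ-+ third (fromℕ 2) 1ℚ)) 3*third)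
      slack≤0 : (third + third + third - 1ℚ) - 1ℚ ≤ 0ℚ
      slack≤0 = subst (λ x → x - 1ℚ ≤ 0ℚ) (trans (sym (ℚ.+-inverseʳ 1ℚ)) (cong (_- 1ℚ) (sym thirds)))
        (subst (_≤ 0ℚ) (sym (ℚ.+-identityˡ (ℚ.- 1ℚ))) (ℚ.neg-antimono-≤ 0≤1))
    module _ {n} (G : Graph n) (ϵ : ℚ) .{{ϵ-pos : Positive ϵ}} (ϵ<1 : ϵ < 1ℚ) (k : ℕ) (1≤k : 1 ℕ.≤ k) where
      0≤ϵ : 0ℚ ≤ ϵ
      0≤ϵ = ℚ.<⇒≤ (ℚ.positive⁻¹ ϵ)
      η = logSize n
      D = (1/ ϵ) {{ℚ.pos⇒nonZero ϵ}}
      target = ceil (ϵ * fromℕ n) (0≤* 0≤ϵ (0≤fromℕ n))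
      T = proj₁ target
      t = (T ℕ.∸ 1) ℕ.⊔ 1
      instance
        t-nonZero : NonZero t
        t-nonZero = ℕ.>-nonZero (ℕ.m≤n⊔m (T ℕ.∸ 1) 1)
      n²< : length (allFin n) ℕ.* length (allFin n) ℕ.< 2 ℕ.^ (2 ℕ.* η)
      n²< = square<2^ η (subst (ℕ._< 2 ℕ.^ η) (sym (length-allFin n)) (n<2^logSize n))
      -- As ϵn ≤ T ≤ 2t, the size of the hitting set gives a·ϵn ≤ 8ηn. Cancelling n fails for n = 0,
      -- where a = 0.
      few : ∀ a → a ℕ.≤ n → a ℕ.* t ℕ.≤ 2 ℕ.* η ℕ.* (2 ℕ.* n) → fromℕ a ≤ fromℕ (8 ℕ.* η) * D
      few a a≤n size = begin
        fromℕ a ≡⟨ ℚ.*-identityʳ (fromℕ a) ⟨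
        fromℕ a * 1ℚ ≡⟨ cong (fromℕ a *_) (1/-inverseʳ ϵ) ⟨
        fromℕ a * (ϵ * D) ≡⟨ ℚ.*-assoc (fromℕ a) ϵ D ⟨
        fromℕ a * ϵ * D ≤⟨ *-monoʳ-≤ (0≤1/ ϵ) (cancel n a≤n scaled) ⟩
        fromℕ (8 ℕ.* η) * D ∎
        where
        open ℚ.≤-Reasoning
        natural : a ℕ.* T ℕ.≤ 8 ℕ.* η ℕ.* n
        natural = ℕ.≤-trans (ℕ.*-monoʳ-≤ a (≤2*pred⊔1 T)) (ℕ.≤-trans (ℕ.≤-reflexive (lemma₁ a t)) (ℕ.≤-trans (ℕ.*-monoʳ-≤ 2 size) (ℕ.≤-reflexive (lemma₂ η n))))
          where
          lemma₁ : ∀ a t → a ℕ.* (2 ℕ.* t) ≡ 2 ℕ.* (a ℕ.* t)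
          lemma₁ = solve-∀
          lemma₂ : ∀ η n → 2 ℕ.* (2 ℕ.* η ℕ.* (2 ℕ.* n)) ≡ 8 ℕ.* η ℕ.* n
          lemma₂ = solve-∀
        scaled : fromℕ a * ϵ * fromℕ n ≤ fromℕ (8 ℕ.* η) * fromℕ n
        scaled = begin
          fromℕ a * ϵ * fromℕ n ≡⟨ ℚ.*-assoc (fromℕ a) ϵ (fromℕ n) ⟩
          fromℕ a * (ϵ * fromℕ n) ≤⟨ *-monoˡ-≤ (0≤fromℕ a) (proj₁ (proj₂ target)) ⟩
          fromℕ a * fromℕ T ≡⟨ fromℕ-* a T ⟨
          fromℕ (a ℕ.* T) ≤⟨ fromℕ-mono-≤ natural ⟩
          fromℕ (8 ℕ.* η ℕ.* n) ≡⟨ fromℕ-* (8 ℕ.* η) n ⟩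
          fromℕ (8 ℕ.* η) * fromℕ n ∎
        cancel : ∀ n → a ℕ.≤ n → fromℕ a * ϵ * fromℕ n ≤ fromℕ (8 ℕ.* η) * fromℕ n → fromℕ a * ϵ ≤ fromℕ (8 ℕ.* η)
        cancel zero a≤0 _ = subst (_≤ fromℕ (8 ℕ.* η)) (sym (trans (cong (λ a → fromℕ a * ϵ) (ℕ.n≤0⇒n≡0 a≤0)) (ℚ.*-zeroˡ ϵ))) (0≤fromℕ (8 ℕ.* η))
        cancel (suc n) _ le = ℚ.*-cancelʳ-≤-pos (fromℕ (suc n)) le
      -- The power (8η)^(k+1) is at most (8η)^(2k), so the root lets out the factor (8η)², whatever
      -- k is.
      rooted : ∀ a r → fromℕ a ≤ fromℕ (8 ℕ.* η) * D → D ^[1+1/ k ]≤ r → fromℕ a ^[1+1/ k ]≤ (fromℕ (8 ℕ.* η) ^ 2 * r)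
      rooted a r a≤ (0≤r , le) = 0≤* (0≤^ 2 0≤E) 0≤r , (begin
        fromℕ a ^ suc k ≤⟨ ^-monoˡ-≤ (suc k) (0≤fromℕ a) a≤ ⟩
        (E * D) ^ suc k ≡⟨ ^-distrib-* E D (suc k) ⟩
        E ^ suc k * D ^ suc k ≤⟨ *-mono-≤ (0≤^ (suc k) 0≤E) (^-monoʳ-≤ (fromℕ-mono-≤ 1≤8η) suc-k≤) (0≤^ (suc k) (0≤1/ ϵ)) le ⟩
        E ^ (2 ℕ.* k) * r ^ k ≡⟨ cong (_* r ^ k) (^-assocʳ E 2 k) ⟨
        (E ^ 2) ^ k * r ^ k ≡⟨ ^-distrib-* (E ^ 2) r k ⟨
        (E ^ 2 * r) ^ k ∎)
        where
        open ℚ.≤-Reasoning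
        E = fromℕ (8 ℕ.* η)
        0≤E : 0ℚ ≤ E
        0≤E = 0≤fromℕ (8 ℕ.* η)
        1≤8η : 1 ℕ.≤ 8 ℕ.* η
        1≤8η = ℕ.*-mono-≤ {1} {8} {1} {η} (s≤s z≤n) (s≤s z≤n)
        suc-k≤ : suc k ℕ.≤ 2 ℕ.* k
        suc-k≤ = ℕ.≤-trans (ℕ.+-monoˡ-≤ k 1≤k) (ℕ.≤-reflexive (cong (k ℕ.+_) (sym (ℕ.+-identityʳ k))))
      -- T exceeds ϵn by at most 1 and the ceiling exceeds (1-ϵ)n by less than 1, so the sum is
      -- below n+2.
      T+F≤ : ∀ c → ℤ.+ c ≡ ℚ.ceiling ((1ℚ - ϵ) * fromℕ n) → T ℕ.+ c ℕ.≤ suc n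
      T+F≤ c c≡ = ℕ.≮⇒≥ λ too-many → ℚ.<-irrefl refl (begin-strict
        fromℕ (2 ℕ.+ n) ≤⟨ fromℕ-mono-≤ too-many ⟩
        fromℕ (T ℕ.+ c) ≡⟨ fromℕ-+ T c ⟩
        fromℕ T + fromℕ c <⟨ ℚ.+-mono-≤-< (proj₂ (proj₂ target)) (ceiling< ((1ℚ - ϵ) * fromℕ n) c (0≤* 0≤1-ϵ (0≤fromℕ n)) c≡) ⟩
        (ϵ * fromℕ n + 1ℚ) + ((1ℚ - ϵ) * fromℕ n + 1ℚ) ≡⟨ lemma ϵ (fromℕ n) 1ℚ ⟩
        (1ℚ + 1ℚ) + 1ℚ * fromℕ n ≡⟨ cong (fromℕ 2 +_) (ℚ.*-identityˡ (fromℕ n)) ⟩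
        fromℕ 2 + fromℕ n ≡⟨ fromℕ-+ 2 n ⟨
        fromℕ (2 ℕ.+ n) ∎)
        where
        open ℚ.≤-Reasoning
        0≤1-ϵ : 0ℚ ≤ 1ℚ - ϵ
        0≤1-ϵ = subst (_≤ 1ℚ - ϵ) (ℚ.+-inverseʳ ϵ) (ℚ.+-monoˡ-≤ (ℚ.- ϵ) (ℚ.<⇒≤ ϵ<1))
        lemma : ∀ ϵ n o → (ϵ * n + o) + ((o - ϵ) * n + o) ≡ (o + o) + o * n
        lemma = ring-solve-∀ ℚ-ring
      bound : ∀ l m {x y z} → l ≤ m → 0ℚ ≤ m → x ≤ t₁ k * l → y ≤ t₁ k * (l + m) → z ≡ x + y → z ≤ t₃ k * m
      bound l m {x} {y} l≤m 0≤m x≤ y≤ refl = begin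
        x + y ≤⟨ ℚ.+-mono-≤ x≤ y≤ ⟩
        t₁ k * l + t₁ k * (l + m) ≤⟨ ℚ.+-mono-≤ (*-monoˡ-≤ (0≤t₁ k 1≤k) l≤m) (*-monoˡ-≤ (0≤t₁ k 1≤k) (ℚ.+-monoˡ-≤ m l≤m)) ⟩
        t₁ k * m + t₁ k * (m + m) ≡⟨ lemma (t₁ k) m ⟩
        (t₁ k + t₁ k + t₁ k) * m ≤⟨ *-monoʳ-≤ 0≤m (triple k) ⟩
        t₃ k * m ∎
        where
        open ℚ.≤-Reasoning
        lemma : ∀ t m → t * m + t * (m + m) ≡ (t + t + t) * m
        lemma = ring-solve-∀ ℚ-ring
      module Routed (A : List (Fin n)) (hits : HitsBalls G (allFin n) (allFin n) t A) (L : Pairs n)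
        (spans : ∀ {u v} → u ∈ A → (p : Path (Edge G) u v) →
          Route (restrict G L) u v (t₁ k * pathLength p)) where
        far : ∀ v F → ℤ.+ ∣ F ∣ ≡ ℚ.ceiling ((1ℚ - ϵ) * fromℕ n) → IsFarthest G v F →
          ∀ w → w Subset.∈ F → dist⟨ restrict G L , v , w ⟩≤ (t₃ k *_) ⟨dist⟨ G , v , w ⟩⟩
        far v F ∣F∣≡ farthest w w∈F = distBound G (restrict G L) (t₃ k *_) route
          where
          route : (p : Path (Edge G) v w) → Route (restrict G L) v w (t₃ k * pathLength p)
          route p = via (hits {v} {w} (∈-allFin v) (∈-allFin w) (far-ball G farthest w∈F T (T+F≤ ∣ F ∣ ∣F∣≡)))
            where
            via : ∃[ s ] s ∈ A × Closer G v s w → Route (restrict G L) v w (t₃ k * pathLength p)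
            via (s , s∈A , s≼w) =
              let p⁻ , p⁻-len , _ = reverse G p
                  r , r≤ = s≼w p⁻
                  q₁ , q₁≤ = spans s∈A r
                  q₁⁻ , q₁⁻-len , _ = reverse (restrict G L) q₁
                  q₂ , q₂≤ = spans s∈A (r ◅◅ p)
              in q₁⁻ ◅◅ q₂ , bound (pathLength r) (pathLength p) (ℚ.≤-trans r≤ (ℚ.≤-reflexive p⁻-len)) (0≤pathLength G p)
                   (subst (_≤ t₁ k * pathLength r) (sym q₁⁻-len) q₁≤) (subst (λ l → pathLength q₂ ≤ t₁ k * l) (pathLength-◅◅ r p) q₂≤) (pathLength-◅◅ q₁⁻ q₂)
      module Counted (A : List (Fin n)) (A-unique : Unique A) (A⊆ : A ⊆ allFin n)
        (A-size : length A ℕ.* t ℕ.≤ 2 ℕ.* η ℕ.* (2 ℕ.* length (allFin n))) (L : Pairs n)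
        (L-size : ∀ r → fromℕ (length A) ^[1+1/ k ]≤ r → fromℕ (length L) ≤ fromℕ (growth a₁ n) * (fromℕ n + r)) where
        edges≤ : ∀ r → D ^[1+1/ k ]≤ r → fromℕ (#edges (restrict G L)) ≤ fromℕ (growth (a₁ ℕ.+ 18) n) * (fromℕ n + r)
        edges≤ r bound = begin
          fromℕ (#edges (restrict G L)) ≤⟨ fromℕ-mono-≤ (#edges-restrict G L) ⟩
          fromℕ (length L) ≤⟨ L-size (E ^ 2 * r) (rooted (length A) r (few (length A) A≤n A-size′) bound) ⟩
          fromℕ (growth a₁ n) * (fromℕ n + E ^ 2 * r) ≤⟨ *-monoˡ-≤ (0≤fromℕ (growth a₁ n)) (ℚ.+-monoˡ-≤ (E ^ 2 * r) n≤) ⟩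
          fromℕ (growth a₁ n) * (E ^ 2 * fromℕ n + E ^ 2 * r) ≡⟨ lemma (fromℕ (growth a₁ n)) (E ^ 2) (fromℕ n) r ⟩
          fromℕ (growth a₁ n) * E ^ 2 * (fromℕ n + r) ≡⟨ cong (_* (fromℕ n + r)) (trans (cong (fromℕ (growth a₁ n) *_) (sym (fromℕ-^ (8 ℕ.* η) 2))) (sym (fromℕ-* (growth a₁ n) ((8 ℕ.* η) ℕ.^ 2)))) ⟩
          fromℕ (growth a₁ n ℕ.* (8 ℕ.* η) ℕ.^ 2) * (fromℕ n + r)
            ≤⟨ *-monoʳ-≤ (0≤+ (0≤fromℕ n) (proj₁ bound)) (fromℕ-mono-≤ (*≤growth a₁ 18 n ℕ.≤-refl (*≤growth 9 9 n 8η≤ (*≤growth 9 0 n 8η≤ ℕ.≤-refl)))) ⟩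
          fromℕ (growth (a₁ ℕ.+ 18) n) * (fromℕ n + r) ∎
          where
          open ℚ.≤-Reasoning
          E = fromℕ (8 ℕ.* η)
          8η≤ : 8 ℕ.* η ℕ.≤ growth 9 n
          8η≤ = *≤growth 8 1 n (constant≤growth 8 n) (logSize≤growth n)
          A≤n : length A ℕ.≤ n
          A≤n = ℕ.≤-trans (Unique-⊆⇒length≤ A-unique A⊆) (ℕ.≤-reflexive (length-allFin n))
          A-size′ : length A ℕ.* t ℕ.≤ 2 ℕ.* η ℕ.* (2 ℕ.* n)
          A-size′ = subst (λ m → length A ℕ.* t ℕ.≤ 2 ℕ.* η ℕ.* (2 ℕ.* m)) (length-allFin n) A-size
          n≤ : fromℕ n ≤ E ^ 2 * fromℕ n
          n≤ = subst (_≤ E ^ 2 * fromℕ n) (ℚ.*-identityˡ (fromℕ n))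
            (*-monoʳ-≤ {1ℚ} {E ^ 2} (0≤fromℕ n) (1≤^ 2 (fromℕ-mono-≤ (ℕ.*-mono-≤ {1} {8} {1} {η} (s≤s z≤n) (s≤s z≤n)))))
          lemma : ∀ g e n r → g * (e * n + e * r) ≡ g * e * (n + r)
          lemma = ring-solve-∀ ℚ-ring
      slackSpanner : ∃[ G′ ] IsSlackSpanner ϵ (t₃ k) G G′ ×
        (∀ r → D ^[1+1/ k ]≤ r → fromℕ (#edges G′) ≤ fromℕ (growth (a₁ ℕ.+ 18) n) * (fromℕ n + r))
      slackSpanner =
        let A , A-unique , A⊆ , hits , A-size = balls-hit G (allFin n) (allFin n) (Unique.allFin⁺ n) t (2 ℕ.* η) n²<
            L , L-size , spans = proj₂ (sourcewise third 0<third) G k 1≤k A A-unique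
        in restrict G L ,
           (restrict-⊆ G L , Routed.far A hits L spans) ,
           Counted.edges≤ A A-unique A⊆ A-size L L-size

-- Spanners with additive error

inverse-unique : ∀ x y .{{x-pos : Positive x}} → x * y ≡ 1ℚ → (1/ x) {{ℚ.pos⇒nonZero x}} ≡ y
inverse-unique x y xy≡1 = begin
  x⁻¹ ≡⟨ ℚ.*-identityʳ x⁻¹ ⟨
  x⁻¹ * 1ℚ ≡⟨ cong (x⁻¹ *_) xy≡1 ⟨
  x⁻¹ * (x * y) ≡⟨ lemma x⁻¹ x y ⟩
  x * x⁻¹ * y ≡⟨ cong (_* y) (1/-inverseʳ x) ⟩
  1ℚ * y ≡⟨ ℚ.*-identityˡ y ⟩
  y ∎
  where
  open Relation.Binary.PropositionalEquality.≡-Reasoning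
  x⁻¹ = (1/ x) {{ℚ.pos⇒nonZero x}}
  lemma : ∀ a b c → a * (b * c) ≡ b * a * c
  lemma = ring-solve-∀ ℚ-ring

-- Factors of the form aᵏ are absorbed by the constant hidden in the hop bound.
hopBound-scale : ∀ a C k ϵ .{{_ : Positive ϵ}} → hopBound (a ℕ.* C) k ϵ ≡ fromℕ (a ℕ.^ k) * hopBound C k ϵ
hopBound-scale a C k ϵ = trans (cong (_^ k) base) (trans (^-distrib-* (fromℕ a) (fromℕ (C ℕ.* k) * D) k) (cong (_* (fromℕ (C ℕ.* k) * D) ^ k) (sym (fromℕ-^ a k))))
  where
  D = (1/ ϵ) {{ℚ.pos⇒nonZero ϵ}}
  base : fromℕ (a ℕ.* C ℕ.* k) * D ≡ fromℕ a * (fromℕ (C ℕ.* k) * D)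
  base = trans (cong (_* D) (trans (cong fromℕ (ℕ.*-assoc a C k)) (fromℕ-* a (C ℕ.* k)))) (ℚ.*-assoc (fromℕ a) (fromℕ (C ℕ.* k)) D)

hopBound-fraction : ∀ C k ϵ N .{{_ : Positive ϵ}} .{{_ : NonZero N}} .{{pos : Positive (ϵ * recip N)}} →
  hopBound C k (ϵ * recip N) ≡ hopBound (N ℕ.* C) k ϵ
hopBound-fraction C k ϵ N = cong (_^ k) (begin
  fromℕ (C ℕ.* k) * (1/ (ϵ * recip N)) {{ℚ.pos⇒nonZero (ϵ * recip N)}}
    ≡⟨ cong (fromℕ (C ℕ.* k) *_) (inverse-unique (ϵ * recip N) (fromℕ N * D) product) ⟩
  fromℕ (C ℕ.* k) * (fromℕ N * D) ≡⟨ lemma (fromℕ (C ℕ.* k)) (fromℕ N) D ⟩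
  fromℕ N * fromℕ (C ℕ.* k) * D ≡⟨ cong (_* D) (trans (sym (fromℕ-* N (C ℕ.* k))) (cong fromℕ (sym (ℕ.*-assoc N C k)))) ⟩
  fromℕ (N ℕ.* C ℕ.* k) * D ∎)
  where
  open Relation.Binary.PropositionalEquality.≡-Reasoning
  D = (1/ ϵ) {{ℚ.pos⇒nonZero ϵ}}
  lemma : ∀ a b c → a * (b * c) ≡ b * a * c
  lemma = ring-solve-∀ ℚ-ring
  lemma′ : ∀ a b c d → a * b * (c * d) ≡ (c * b) * (a * d)
  lemma′ = ring-solve-∀ ℚ-ring
  product : ϵ * recip N * (fromℕ N * D) ≡ 1ℚ
  product = trans (lemma′ ϵ (recip N) (fromℕ N) D) (trans (cong₂ _*_ (*-recip N) (1/-inverseʳ ϵ)) (ℚ.*-identityˡ 1ℚ))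

0≤hopBound : ∀ C k ϵ .{{_ : Positive ϵ}} → 0ℚ ≤ hopBound C k ϵ
0≤hopBound C k ϵ = 0≤^ k (0≤* (0≤fromℕ (C ℕ.* k)) (0≤1/ ϵ))

hopBound-mono : ∀ {C C′} k ϵ .{{_ : Positive ϵ}} → C ℕ.≤ C′ → hopBound C k ϵ ≤ hopBound C′ k ϵ
hopBound-mono {C} k ϵ C≤C′ = ^-monoˡ-≤ k (0≤* (0≤fromℕ (C ℕ.* k)) (0≤1/ ϵ)) (*-monoʳ-≤ (0≤1/ ϵ) (fromℕ-mono-≤ (ℕ.*-monoˡ-≤ k C≤C′)))

1≤hopBound : ∀ C k ϵ .{{_ : Positive ϵ}} → ϵ < 1ℚ → 1 ℕ.≤ C → 1 ℕ.≤ k → 1ℚ ≤ hopBound C k ϵ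
1≤hopBound C k ϵ ϵ<1 1≤C 1≤k = 1≤^ k (1≤* (fromℕ-mono-≤ (ℕ.*-mono-≤ 1≤C 1≤k)) 1≤D)
  where
  D = (1/ ϵ) {{ℚ.pos⇒nonZero ϵ}}
  1≤D : 1ℚ ≤ D
  1≤D = subst₂ _≤_ (1/-inverseʳ ϵ) (ℚ.*-identityˡ D) (*-monoʳ-≤ (0≤1/ ϵ) (ℚ.<⇒≤ ϵ<1))

spannerPairs : ∀ {n k} {G : Graph n} (H : Graph n) → SpanningPairs G (allFin n) k → Pairs n
spannerPairs H sp = edgePairs H ++ SpanningPairs.pairs sp

module _ {n} (G H : Graph n) {β ϵ s} k (0≤ϵ : 0ℚ ≤ ϵ) (hopset : IsHopset β ϵ G H)
  (1≤s : 1ℚ ≤ s) (s≤2 : s ≤ fromℕ 2) (sp : SpanningPairs G (allFin n) (2 ℕ.^ suc k ℕ.∸ 1)) where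

  open SpanningPairs sp

  -- Edges of G on the β-hop path are replaced by detours of stretch 2κ-1 < 4·2ᵏ.
  spanner : ∀ {L} → Preserves s G (spannerPairs H sp) L → ∀ {α a} → s * (1ℚ + ϵ) ≤ α →
    fromℕ β * (fromℕ 8 * (fromℕ (2 ℕ.^ k) * W-max G)) ≤ a → IsSpanner α a G (restrict G L)
  spanner {L} pres {α} {a} α≥ a≥ = restrict-⊆ G L , λ u v → distBound G (restrict G L) (λ d → α * d + a) (route u v)
    where
    c : ℚ
    c = fromℕ (2 ℕ.* κ) - 1ℚ
    0≤c : 0ℚ ≤ c
    0≤c = ℚ.+-monoˡ-≤ (ℚ.- 1ℚ) {1ℚ} {fromℕ (2 ℕ.* κ)} (fromℕ-mono-≤ (ℕ.≤-trans 1≤κ (ℕ.m≤m+n κ (κ ℕ.+ 0))))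
    0≤s : 0ℚ ≤ s
    0≤s = ℚ.≤-trans 0≤1 1≤s
    2κ≤ : 2 ℕ.* κ ℕ.≤ 4 ℕ.* 2 ℕ.^ k
    2κ≤ = ℕ.≤-trans (ℕ.*-monoʳ-≤ 2 (ℕ.≤-trans κ≤k (ℕ.m∸n≤m (2 ℕ.^ suc k) 1))) (ℕ.≤-reflexive (lemma (2 ℕ.^ k)))
      where
      lemma : ∀ x → 2 ℕ.* (2 ℕ.* x) ≡ 4 ℕ.* x
      lemma = solve-∀
    c≤ : c ≤ fromℕ (4 ℕ.* 2 ℕ.^ k)
    c≤ = subst (c ≤_) (ℚ.+-identityʳ _) (ℚ.+-mono-≤ (fromℕ-mono-≤ 2κ≤) (ℚ.neg-antimono-≤ 0≤1))
    detour≤ : s * (c * W-max G) ≤ fromℕ 8 * (fromℕ (2 ℕ.^ k) * W-max G)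
    detour≤ = begin
      s * (c * W-max G) ≤⟨ *-mono-≤ 0≤s s≤2 (0≤* 0≤c (0≤W-max G)) (*-monoʳ-≤ (0≤W-max G) c≤) ⟩
      fromℕ 2 * (fromℕ (4 ℕ.* 2 ℕ.^ k) * W-max G) ≡⟨ ℚ.*-assoc (fromℕ 2) (fromℕ (4 ℕ.* 2 ℕ.^ k)) (W-max G) ⟨
      fromℕ 2 * fromℕ (4 ℕ.* 2 ℕ.^ k) * W-max G ≡⟨ cong (_* W-max G) (fromℕ-* 2 (4 ℕ.* 2 ℕ.^ k)) ⟨
      fromℕ (2 ℕ.* (4 ℕ.* 2 ℕ.^ k)) * W-max G ≡⟨ cong (λ x → fromℕ x * W-max G) (ℕ.*-assoc 2 4 (2 ℕ.^ k)) ⟨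
      fromℕ (8 ℕ.* 2 ℕ.^ k) * W-max G ≡⟨ cong (_* W-max G) (fromℕ-* 8 (2 ℕ.^ k)) ⟩
      fromℕ 8 * fromℕ (2 ℕ.^ k) * W-max G ≡⟨ ℚ.*-assoc (fromℕ 8) (fromℕ (2 ℕ.^ k)) (W-max G) ⟩
      fromℕ 8 * (fromℕ (2 ℕ.^ k) * W-max G) ∎
      where open ℚ.≤-Reasoning
    H-approx : ∀ {u v} → Linked (edgePairs H) u v → Approximates s G (restrict G L) u v
    H-approx = Preserves-linked {s = s} G {edgePairs H} {L} (λ uv∈ → pres (∈-++⁺ˡ uv∈))
    route : ∀ u v (p : Path (Edge G) u v) → Route (restrict G L) u v (α * pathLength p + a)
    route u v p =
      let p′ , le = spanner-path G (restrict G L) {s} 1≤s {H} {β} {ϵ} {c} 0≤ϵ 0≤c hopset H-approx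
            (meets⇒spans G (restrict G L) {s} 1≤s {allFin n} {c} {pairs} meets (λ xy∈ → pres (∈-++⁺ʳ (edgePairs H) xy∈)) (∈-allFin _) (∈-allFin _)) p
      in p′ , ℚ.≤-trans le (ℚ.+-mono-≤ (*-monoʳ-≤ (0≤pathLength G p) α≥)
                (ℚ.≤-trans (*-monoˡ-≤ (0≤fromℕ β) detour≤) a≥))

allFin-root : ∀ n k {r} → fromℕ n ^[1+1/ k ]≤ r → fromℕ (length (allFin n)) ^[1+1/ k ]≤ r
allFin-root n k {r} = subst (λ m → fromℕ m ^[1+1/ k ]≤ r) (sym (length-allFin n))

1≤2^1+k∸1 : ∀ k → 1 ℕ.≤ 2 ℕ.^ suc k ℕ.∸ 1
1≤2^1+k∸1 k = ℕ.>-nonZero⁻¹ (2 ℕ.^ suc k ℕ.∸ 1) {{2^1+k∸1-nonZero k}}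

-- For n ≤ 1 the logarithm is 0, but then there are no edges and both sides are 0.
W-max≤W-max*log : ∀ n (G : Graph n) → W-max G ≤ W-max G * fromℕ ⌈log₂ n ⌉
W-max≤W-max*log zero          G = ℚ.≤-refl
W-max≤W-max*log (suc zero)    G = ℚ.≤-refl
W-max≤W-max*log n@(suc (suc _)) G = subst (_≤ W-max G * fromℕ ⌈log₂ n ⌉) (ℚ.*-identityʳ (W-max G))
  (*-monoˡ-≤ (0≤W-max G) (fromℕ-mono-≤ (ℕ.≤-trans (ℕ.≤-reflexive (sym (⌈log₂2^n⌉≡n 1))) (⌈log₂⌉-mono-≤ {2} {n} (s≤s (s≤s z≤n))))))

module FixedSpanner {C : ℕ} (guarantee : HopsetGuarantee C) where

  open NearExact guarantee

  fixedSpanner : ∀ k → 1 ℕ.≤ k → ∀ ϵ .{{_ : Positive ϵ}} → ϵ < 1ℚ →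
    ∃[ a ] ∀ {n} (G : Graph n) →
      ∃[ G′ ] IsSpanner (1ℚ + ϵ) (hopBound (64 ℕ.* C) k ϵ * W-max G * fromℕ ⌈log₂ n ⌉) G G′ ×
        (∀ r → fromℕ n ^[1+1/ 2 ℕ.^ suc k ℕ.∸ 1 ]≤ r → fromℕ (#edges G′) ≤ fromℕ (growth a n) * r)
  fixedSpanner k 1≤k ϵ {{ϵ-pos}} ϵ<1 = a₀ ℕ.+ e , λ {n} G → build G (guarantee G k 1≤k ϵ₀ {{ϵ₀-pos}} ϵ₀<1)
    where
    K = 2 ℕ.^ suc k ℕ.∸ 1
    -- Both the hopset and the preserver have error at most ϵ₀, and (1+ϵ₀)² ≤ 1+4ϵ₀.
    ϵ₀ = ϵ * recip 4
    instance
      ϵ₀-pos : Positive ϵ₀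
      ϵ₀-pos = ℚ.pos*pos⇒pos ϵ {{ϵ-pos}} (recip 4) {{recip-pos 4}}
    0<ϵ₀ : 0ℚ < ϵ₀
    0<ϵ₀ = ℚ.positive⁻¹ ϵ₀
    0≤ϵ₀ : 0ℚ ≤ ϵ₀
    0≤ϵ₀ = ℚ.<⇒≤ 0<ϵ₀
    0≤ϵ : 0ℚ ≤ ϵ
    0≤ϵ = ℚ.<⇒≤ (ℚ.positive⁻¹ ϵ)
    ϵ₀≤ϵ : ϵ₀ ≤ ϵ
    ϵ₀≤ϵ = subst (ϵ₀ ≤_) (ℚ.*-identityʳ ϵ) (*-monoˡ-≤ 0≤ϵ (recip≤1 4))
    ϵ₀<1 : ϵ₀ < 1ℚ
    ϵ₀<1 = ℚ.≤-<-trans ϵ₀≤ϵ ϵ<1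
    4ϵ₀ : fromℕ 4 * ϵ₀ ≡ ϵ
    4ϵ₀ = trans (lemma (fromℕ 4) ϵ (recip 4)) (trans (cong (_* ϵ) (*-recip 4)) (ℚ.*-identityˡ ϵ))
      where
      lemma : ∀ a b c → a * (b * c) ≡ a * c * b
      lemma = ring-solve-∀ ℚ-ring
    m₀ = proj₁ (small-recip ϵ₀ 0<ϵ₀)
    s : ℚ
    s = 1ℚ + recip (suc m₀)
    s≤ : s ≤ 1ℚ + ϵ₀
    s≤ = ℚ.+-monoʳ-≤ 1ℚ (proj₂ (small-recip ϵ₀ 0<ϵ₀))
    1≤s : 1ℚ ≤ s
    1≤s = p≤p+q′ {1ℚ} (0≤recip (suc m₀))
    s≤2 : s ≤ fromℕ 2
    s≤2 = ℚ.+-monoʳ-≤ 1ℚ {recip (suc m₀)} {1ℚ} (recip≤1 (suc m₀))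
    α≥ : s * (1ℚ + ϵ₀) ≤ 1ℚ + ϵ
    α≥ = begin
      s * (1ℚ + ϵ₀) ≤⟨ *-monoʳ-≤ (0≤+ 0≤1 0≤ϵ₀) s≤ ⟩
      (1ℚ + ϵ₀) * (1ℚ + ϵ₀) ≡⟨ ^2 ⟩
      (1ℚ + ϵ₀) ^ 2 ≤⟨ [1+ϵ]^j≤ 0≤ϵ₀ 2 (subst (_≤ 1ℚ) (sym 4ϵ₀) (ℚ.<⇒≤ ϵ<1)) ⟩
      1ℚ + fromℕ 4 * ϵ₀ ≡⟨ cong (1ℚ +_) 4ϵ₀ ⟩
      1ℚ + ϵ ∎
      where
      open ℚ.≤-Reasoning
      ^2 : (1ℚ + ϵ₀) * (1ℚ + ϵ₀) ≡ (1ℚ + ϵ₀) ^ 2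
      ^2 = cong ((1ℚ + ϵ₀) *_) (sym (ℚ.*-identityʳ (1ℚ + ϵ₀)))
    b₀ = suc m₀
    a₀ = proj₁ (cost-growth b₀)
    e = 2 ℕ.+ (2 ℕ.+ (C ℕ.+ 13) ℕ.+ 1)
    -- Accuracy ϵ/4 multiplies the hidden constant by 4, and 8·2ᵏ ≤ 16ᵏ multiplies it by 16; hence
    -- 64.
    additive : ∀ β → fromℕ β ≤ hopBound C k ϵ₀ → fromℕ β * (fromℕ 8 * fromℕ (2 ℕ.^ k)) ≤ hopBound (64 ℕ.* C) k ϵ
    additive β β≤ = begin
      fromℕ β * (fromℕ 8 * fromℕ (2 ℕ.^ k))
        ≤⟨ *-mono-≤ (0≤fromℕ β) β≤ (0≤* (0≤fromℕ 8) (0≤fromℕ (2 ℕ.^ k))) 8*2^k≤ ⟩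
      hopBound C k ϵ₀ * fromℕ (16 ℕ.^ k)
        ≡⟨ trans (cong (_* fromℕ (16 ℕ.^ k)) (hopBound-fraction C k ϵ 4)) (ℚ.*-comm (hopBound (4 ℕ.* C) k ϵ) (fromℕ (16 ℕ.^ k))) ⟩
      fromℕ (16 ℕ.^ k) * hopBound (4 ℕ.* C) k ϵ
        ≡⟨ hopBound-scale 16 (4 ℕ.* C) k ϵ ⟨
      hopBound (16 ℕ.* (4 ℕ.* C)) k ϵ
        ≡⟨ cong (λ c → hopBound c k ϵ) (sym (ℕ.*-assoc 16 4 C)) ⟩
      hopBound (64 ℕ.* C) k ϵ ∎
      where
      open ℚ.≤-Reasoning
      8*2^k≤ : fromℕ 8 * fromℕ (2 ℕ.^ k) ≤ fromℕ (16 ℕ.^ k)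
      8*2^k≤ = subst (_≤ fromℕ (16 ℕ.^ k)) (fromℕ-* 8 (2 ℕ.^ k)) (fromℕ-mono-≤
        (ℕ.≤-trans (ℕ.*-monoˡ-≤ (2 ℕ.^ k) (subst (ℕ._≤ 8 ℕ.^ k) (ℕ.*-identityʳ 8) (ℕ.^-monoʳ-≤ 8 1≤k)))
          (ℕ.≤-reflexive (sym (^-distribʳ-* 8 2 k)))))
    build : ∀ {n} (G : Graph n) → (∃[ β ] ∃[ H ] IsHopset β ϵ₀ G H × fromℕ β ≤ hopBound C k ϵ₀ ×
        (∀ r → fromℕ n ^[1+1/ K ]≤ r → fromℕ (#edges H) ≤ fromℕ C * r)) →
      ∃[ G′ ] IsSpanner (1ℚ + ϵ) (hopBound (64 ℕ.* C) k ϵ * W-max G * fromℕ ⌈log₂ n ⌉) G G′ ×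
        (∀ r → fromℕ n ^[1+1/ K ]≤ r → fromℕ (#edges G′) ≤ fromℕ (growth (a₀ ℕ.+ e) n) * r)
    build {n} G (β , H , hopset , β≤ , H-size) =
      let sp = spanningPairs G (allFin n) (Unique.allFin⁺ n) K (1≤2^1+k∸1 k)
          L , L-size , pres = nearExact G (suc m₀) (spannerPairs H sp)
      in restrict G L , spanner G H k 0≤ϵ₀ hopset 1≤s s≤2 sp pres α≥ a≥ ,
         λ r bound → ℚ.≤-trans (fromℕ-mono-≤ (#edges-restrict G L))
           (few (length (edgePairs H)) (length (SpanningPairs.pairs sp)) (length L)
             (subst (λ l → length L ℕ.≤ cost n (suc m₀) ℕ.* (l ℕ.+ n)) (length-++ (edgePairs H)) L-size) r
             (proj₁ bound)
             (subst (λ h → fromℕ h ≤ fromℕ C * r) (sym (length-edgePairs H)) (H-size r bound))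
             (SpanningPairs.size sp r (allFin-root n K bound))
             (size≤root n K (1≤2^1+k∸1 k) bound))
      where
      open ℚ.≤-Reasoning
      W = W-max G
      a≥ : fromℕ β * (fromℕ 8 * (fromℕ (2 ℕ.^ k) * W)) ≤ hopBound (64 ℕ.* C) k ϵ * W * fromℕ ⌈log₂ n ⌉
      a≥ = begin
        fromℕ β * (fromℕ 8 * (fromℕ (2 ℕ.^ k) * W)) ≡⟨ lemma (fromℕ β) (fromℕ 8) (fromℕ (2 ℕ.^ k)) W ⟩
        fromℕ β * (fromℕ 8 * fromℕ (2 ℕ.^ k)) * W ≤⟨ *-monoʳ-≤ (0≤W-max G) (additive β β≤) ⟩
        hopBound (64 ℕ.* C) k ϵ * W ≤⟨ *-monoˡ-≤ (0≤hopBound (64 ℕ.* C) k ϵ) (W-max≤W-max*log n G) ⟩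
        hopBound (64 ℕ.* C) k ϵ * (W * fromℕ ⌈log₂ n ⌉) ≡⟨ ℚ.*-assoc (hopBound (64 ℕ.* C) k ϵ) W (fromℕ ⌈log₂ n ⌉) ⟨
        hopBound (64 ℕ.* C) k ϵ * W * fromℕ ⌈log₂ n ⌉ ∎
        where
        lemma : ∀ a b c d → a * (b * (c * d)) ≡ a * (b * c) * d
        lemma = ring-solve-∀ ℚ-ring
      few : ∀ h p l → l ℕ.≤ cost n (suc m₀) ℕ.* (h ℕ.+ p ℕ.+ n) → ∀ r → 0ℚ ≤ r → fromℕ h ≤ fromℕ C * r →
        fromℕ p ≤ fromℕ (starCost n) * r → fromℕ n ≤ r → fromℕ l ≤ fromℕ (growth (a₀ ℕ.+ e) n) * r
      few h p l l≤ r 0≤r h≤ p≤ n≤ = begin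
        fromℕ l ≤⟨ fromℕ-mono-≤ (ℕ.≤-trans l≤ (ℕ.*-monoˡ-≤ (h ℕ.+ p ℕ.+ n) (proj₂ (cost-growth b₀) n (suc m₀) (constant≤polylog (suc m₀) n)))) ⟩
        fromℕ (growth a₀ n ℕ.* (h ℕ.+ p ℕ.+ n)) ≡⟨ fromℕ-* (growth a₀ n) (h ℕ.+ p ℕ.+ n) ⟩
        g * fromℕ (h ℕ.+ p ℕ.+ n) ≡⟨ cong (g *_) (trans (fromℕ-+ (h ℕ.+ p) n) (cong (_+ fromℕ n) (fromℕ-+ h p))) ⟩
        g * (fromℕ h + fromℕ p + fromℕ n) ≤⟨ *-monoˡ-≤ (0≤fromℕ (growth a₀ n)) (ℚ.+-mono-≤ (ℚ.+-mono-≤ h≤ p≤) (subst (fromℕ n ≤_) (sym (ℚ.*-identityˡ r)) n≤)) ⟩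
        g * (fromℕ C * r + fromℕ (starCost n) * r + 1ℚ * r) ≡⟨ lemma g (fromℕ C) (fromℕ (starCost n)) 1ℚ r ⟩
        g * (fromℕ C + fromℕ (starCost n) + 1ℚ) * r ≡⟨ cong (λ x → g * x * r) (trans (cong (_+ 1ℚ) (sym (fromℕ-+ C (starCost n)))) (sym (fromℕ-+ (C ℕ.+ starCost n) 1))) ⟩
        g * fromℕ (C ℕ.+ starCost n ℕ.+ 1) * r ≡⟨ cong (_* r) (fromℕ-* (growth a₀ n) (C ℕ.+ starCost n ℕ.+ 1)) ⟨
        fromℕ (growth a₀ n ℕ.* (C ℕ.+ starCost n ℕ.+ 1)) * r ≤⟨ *-monoʳ-≤ 0≤r (fromℕ-mono-≤ (*≤growth a₀ e n ℕ.≤-refl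
                (+≤growth (2 ℕ.+ (C ℕ.+ 13)) 1 n (+≤growth C 13 n (constant≤growth C n) (starCost-growth n)) (constant≤growth 1 n)))) ⟩
        fromℕ (growth (a₀ ℕ.+ e) n) * r ∎
        where
        g = fromℕ (growth a₀ n)
        lemma : ∀ g a b c r → g * (a * r + b * r + c * r) ≡ g * (a + b + c) * r
        lemma = ring-solve-∀ ℚ-ring

-- Number of levels for bounded k

module _ (K : ℕ) .{{_ : NonZero K}} where

  iterateLevel-+ : ∀ i j x → iterateLevel K (i ℕ.+ j) x ≡ iterateLevel K j (iterateLevel K i x)
  iterateLevel-+ zero    j x = refl
  iterateLevel-+ (suc i) j x = iterateLevel-+ i j (nextLevel K x)

  -- As long as x is at least a·K, the quotient x/K contributes a to every step besides the constant
  -- 1.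
  iterateLevel-gain : ∀ j x a → a ℕ.* K ℕ.≤ x → x ℕ.+ j ℕ.* suc a ℕ.≤ iterateLevel K j x
  iterateLevel-gain zero    x a _  = ℕ.≤-reflexive (ℕ.+-identityʳ x)
  iterateLevel-gain (suc j) x a le = ℕ.≤-trans
    (ℕ.≤-trans (ℕ.≤-reflexive (sym (ℕ.+-assoc x (suc a) (j ℕ.* suc a)))) (ℕ.+-monoˡ-≤ (j ℕ.* suc a) step))
    (iterateLevel-gain j (nextLevel K x) a (ℕ.≤-trans le (ℕ.m≤n⇒m≤1+n (ℕ.m≤m+n x (x ℕ./ K)))))
    where
    step : x ℕ.+ suc a ℕ.≤ nextLevel K x
    step = ℕ.≤-trans (ℕ.≤-reflexive (ℕ.+-suc x a)) (s≤s (ℕ.+-monoʳ-≤ x (subst (ℕ._≤ x ℕ./ K) (m*n/n≡m a K) (/-monoˡ-≤ K le))))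

  -- K steps at least double x + K.
  iterateLevel-doubling : ∀ i x a → a ℕ.* K ℕ.≤ x → 2 ℕ.^ i ℕ.* suc a ℕ.* K ℕ.≤ K ℕ.+ iterateLevel K (i ℕ.* K) x
  iterateLevel-doubling zero    x a le = ℕ.≤-trans (ℕ.≤-reflexive (cong (ℕ._* K) (ℕ.*-identityˡ (suc a)))) (ℕ.+-monoʳ-≤ K le)
  iterateLevel-doubling (suc i) x a le = begin
    2 ℕ.* 2 ℕ.^ i ℕ.* suc a ℕ.* K ≡⟨ lemma (2 ℕ.^ i) a K ⟩
    2 ℕ.^ i ℕ.* suc (suc (2 ℕ.* a)) ℕ.* K ≤⟨ iterateLevel-doubling i (iterateLevel K K x) (suc (2 ℕ.* a)) gained ⟩
    K ℕ.+ iterateLevel K (i ℕ.* K) (iterateLevel K K x) ≡⟨ cong (K ℕ.+_) (iterateLevel-+ K (i ℕ.* K) x) ⟨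
    K ℕ.+ iterateLevel K (suc i ℕ.* K) x ∎
    where
    open ℕ.≤-Reasoning
    lemma : ∀ p a K → 2 ℕ.* p ℕ.* suc a ℕ.* K ≡ p ℕ.* suc (suc (2 ℕ.* a)) ℕ.* K
    lemma = solve-∀
    gained : suc (2 ℕ.* a) ℕ.* K ℕ.≤ iterateLevel K K x
    gained = ℕ.≤-trans (ℕ.≤-reflexive (lemma′ a K)) (ℕ.≤-trans (ℕ.+-monoˡ-≤ (K ℕ.* suc a) le) (iterateLevel-gain K x a le))
      where
      lemma′ : ∀ a K → suc (2 ℕ.* a) ℕ.* K ≡ a ℕ.* K ℕ.+ K ℕ.* suc a
      lemma′ = solve-∀

-- Blocks of K steps double x + K, which starts at K ≥ 2ᵏ, so only about log log n - k blocks are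
-- needed. Their total length is the origin of the factor 2ᵏ(log log n - k) in the error.
enough-levels : ∀ n k .{{_ : NonZero (2 ℕ.^ suc k ℕ.∸ 1)}} → k ℕ.≤ ⌊log₂ ⌊log₂ n ⌋ ⌋ →
  let K = 2 ℕ.^ suc k ℕ.∸ 1 in logSize n ℕ.≤ iterateLevel K ((⌊log₂ ⌊log₂ n ⌋ ⌋ ℕ.∸ k ℕ.+ 2) ℕ.* K) 0
enough-levels n k k≤ll = ℕ.≤-trans (logSize≤ n) (ℕ.+-cancelˡ-≤ K _ _ (begin
  K ℕ.+ 2 ℕ.^ suc ll ≡⟨ cong (λ e → K ℕ.+ 2 ℕ.^ e) exponent ⟨
  K ℕ.+ 2 ℕ.^ (suc d ℕ.+ k) ≡⟨ cong (K ℕ.+_) (ℕ.^-distribˡ-+-* 2 (suc d) k) ⟩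
  K ℕ.+ 2 ℕ.^ suc d ℕ.* 2 ℕ.^ k ≤⟨ ℕ.+-mono-≤ (ℕ.m≤n*m K (2 ℕ.^ suc d) {{ℕ.m^n≢0 2 (suc d)}}) (ℕ.*-monoʳ-≤ (2 ℕ.^ suc d) 2^k≤K) ⟩
  2 ℕ.^ suc d ℕ.* K ℕ.+ 2 ℕ.^ suc d ℕ.* K ≡⟨ lemma (2 ℕ.^ suc d) K ⟩
  2 ℕ.* 2 ℕ.^ suc d ℕ.* 1 ℕ.* K ≡⟨ cong (λ e → 2 ℕ.^ e ℕ.* 1 ℕ.* K) (ℕ.+-comm 2 d) ⟩
  2 ℕ.^ (d ℕ.+ 2) ℕ.* 1 ℕ.* K ≤⟨ iterateLevel-doubling K (d ℕ.+ 2) 0 0 z≤n ⟩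
  K ℕ.+ iterateLevel K ((d ℕ.+ 2) ℕ.* K) 0 ∎))
  where
  open ℕ.≤-Reasoning
  K = 2 ℕ.^ suc k ℕ.∸ 1
  ll = ⌊log₂ ⌊log₂ n ⌋ ⌋
  d = ll ℕ.∸ k
  exponent : suc d ℕ.+ k ≡ suc ll
  exponent = cong suc (ℕ.m∸n+n≡m k≤ll)
  2^k≤K : 2 ℕ.^ k ℕ.≤ K
  2^k≤K = 2^k≤2^1+k∸1 k
  lemma : ∀ p K → p ℕ.* K ℕ.+ p ℕ.* K ≡ 2 ℕ.* p ℕ.* 1 ℕ.* K
  lemma = solve-∀

log-nonZero : ∀ n → 1 ℕ.≤ ⌊log₂ n ⌋ → NonZero n
log-nonZero (suc n) _ = _

-- The smallest such R is found by descent. Its predecessor is below the K-th root of x, so R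
-- exceeds the root by at most 1.
ceilRoot : ∀ x K → 1 ℕ.≤ K → ∃[ R ] x ℕ.≤ R ℕ.^ K × (∀ r → 0ℚ ≤ r → fromℕ x ≤ r ^ K → fromℕ R ≤ r + 1ℚ)
ceilRoot x K 1≤K = search x (x≤x^K x)
  where
  x≤x^K : ∀ x → x ℕ.≤ x ℕ.^ K
  x≤x^K zero    = z≤n
  x≤x^K (suc x) = subst (ℕ._≤ suc x ℕ.^ K) (ℕ.*-identityʳ (suc x)) (ℕ.^-monoʳ-≤ (suc x) 1≤K)
  search : ∀ R → x ℕ.≤ R ℕ.^ K → ∃[ R ] x ℕ.≤ R ℕ.^ K × (∀ r → 0ℚ ≤ r → fromℕ x ≤ r ^ K → fromℕ R ≤ r + 1ℚ)
  search zero x≤ = 0 , x≤ , λ r 0≤r _ → 0≤+ 0≤r 0≤1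
  search (suc R) x≤ with x ℕ.≤? R ℕ.^ K
  ... | yes x≤R = search R x≤R
  ... | no  x≰R = suc R , x≤ , λ r 0≤r x≤r → subst (_≤ r + 1ℚ) (trans (ℚ.+-comm (fromℕ R) 1ℚ) (sym (fromℕ-+ 1 R)))
    (ℚ.+-monoˡ-≤ 1ℚ (^-cancelˡ-≤ K 1≤K (0≤fromℕ R) 0≤r
      (ℚ.≤-trans (subst (_≤ fromℕ x) (fromℕ-^ R K) (fromℕ-mono-≤ (ℕ.<⇒≤ (ℕ.≰⇒> x≰R)))) x≤r)))

module UniformSpanner {C : ℕ} (guarantee : HopsetGuarantee C) where

  -- `B` is the coefficient 32·(33C + 34) of the cubed logarithm in the edge count; it also exceeds
  -- the constants 3 and 8 in the two error terms. In `b`, 8C comes from the accuracy ϵ/8, and 2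
  -- makes the hop bound at least 1 even for C = 0.
  B b : ℕ
  B = 1056 ℕ.* C ℕ.+ 1088
  b = 8 ℕ.* C ℕ.+ 2

  module _ {n} (G : Graph n) (k : ℕ) (1≤k : 1 ℕ.≤ k) (k≤ll : k ℕ.≤ ⌊log₂ ⌊log₂ n ⌋ ⌋)
    (ϵ : ℚ) .{{ϵ-pos : Positive ϵ}} (ϵ<1 : ϵ < 1ℚ) (y≤1 : ϵ * fromℕ (2 ℕ.^ k ℕ.* (⌊log₂ ⌊log₂ n ⌋ ⌋ ℕ.∸ k ℕ.+ 1)) ≤ 1ℚ) where

    private
      η = logSize n
      ll = ⌊log₂ ⌊log₂ n ⌋ ⌋
      d = ll ℕ.∸ k
      K = 2 ℕ.^ suc k ℕ.∸ 1
      Q = 2 ℕ.^ k ℕ.* (d ℕ.+ 1)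
      j = (d ℕ.+ 2) ℕ.* K
      y = ϵ * fromℕ Q
      -- The hopset of `G` itself has accuracy ϵ, which fixes the additive error. The levels of the
      -- preserver use ϵ/8: as j+1 ≤ 4Q, their j+1 factors multiply to at most 1+y.
      ϵ′ = ϵ * recip 8
      hb = hopBound C k ϵ
      hb₁ = hopBound b k ϵ
      W = W-max G
      instance
        K-nonZero : NonZero K
        K-nonZero = 2^1+k∸1-nonZero k
        ϵ′-pos : Positive ϵ′
        ϵ′-pos = ℚ.pos*pos⇒pos ϵ {{ϵ-pos}} (recip 8) {{recip-pos 8}}
      0≤ϵ : 0ℚ ≤ ϵ
      0≤ϵ = ℚ.<⇒≤ (ℚ.positive⁻¹ ϵ)
      0≤ϵ′ : 0ℚ ≤ ϵ′
      0≤ϵ′ = ℚ.<⇒≤ (ℚ.positive⁻¹ ϵ′)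
      ϵ′<1 : ϵ′ < 1ℚ
      ϵ′<1 = ℚ.≤-<-trans (subst (ϵ′ ≤_) (ℚ.*-identityʳ ϵ) (*-monoˡ-≤ 0≤ϵ (recip≤1 8))) ϵ<1
      0≤y : 0ℚ ≤ y
      0≤y = 0≤* 0≤ϵ (0≤fromℕ Q)
      1≤ll : 1 ℕ.≤ ll
      1≤ll = ℕ.≤-trans 1≤k k≤ll
      1≤n : 1 ℕ.≤ n
      1≤n = ℕ.>-nonZero⁻¹ n {{log-nonZero n (ℕ.>-nonZero⁻¹ ⌊log₂ n ⌋ {{log-nonZero ⌊log₂ n ⌋ 1≤ll}})}}

      j<4Q : suc j ℕ.≤ 4 ℕ.* Q
      j<4Q = begin
        suc ((d ℕ.+ 2) ℕ.* K) ≤⟨ ℕ.+-monoˡ-≤ ((d ℕ.+ 2) ℕ.* K) {1} {d ℕ.+ 2} (ℕ.m≤n⇒m≤o+n d (s≤s z≤n)) ⟩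
        d ℕ.+ 2 ℕ.+ (d ℕ.+ 2) ℕ.* K ≡⟨ ℕ.*-suc (d ℕ.+ 2) K ⟨
        (d ℕ.+ 2) ℕ.* suc K ≡⟨ cong ((d ℕ.+ 2) ℕ.*_) (ℕ.m+[n∸m]≡n (ℕ.m^n>0 2 (suc k))) ⟩
        (d ℕ.+ 2) ℕ.* (2 ℕ.* 2 ℕ.^ k) ≤⟨ ℕ.m≤m+n _ (2 ℕ.^ k ℕ.* (2 ℕ.* d)) ⟩
        (d ℕ.+ 2) ℕ.* (2 ℕ.* 2 ℕ.^ k) ℕ.+ 2 ℕ.^ k ℕ.* (2 ℕ.* d) ≡⟨ lemma d (2 ℕ.^ k) ⟩
        4 ℕ.* Q ∎
        where
        open ℕ.≤-Reasoning
        lemma : ∀ d p → (d ℕ.+ 2) ℕ.* (2 ℕ.* p) ℕ.+ p ℕ.* (2 ℕ.* d) ≡ 4 ℕ.* (p ℕ.* (d ℕ.+ 1))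
        lemma = solve-∀

      Q≤η : Q ℕ.≤ η
      Q≤η = begin
        2 ℕ.^ k ℕ.* (d ℕ.+ 1) ≤⟨ ℕ.*-monoʳ-≤ (2 ℕ.^ k) (subst (ℕ._≤ 2 ℕ.^ d) (ℕ.+-comm 1 d) (n<2^n d)) ⟩
        2 ℕ.^ k ℕ.* 2 ℕ.^ d ≡⟨ ℕ.^-distribˡ-+-* 2 k d ⟨
        2 ℕ.^ (k ℕ.+ d) ≡⟨ cong (2 ℕ.^_) (ℕ.m+[n∸m]≡n k≤ll) ⟩
        2 ℕ.^ ll ≤⟨ 2^⌊log₂n⌋≤n ⌊log₂ n ⌋ {{log-nonZero ⌊log₂ n ⌋ 1≤ll}} ⟩
        ⌊log₂ n ⌋ ≤⟨ ℕ.n≤1+n ⌊log₂ n ⌋ ⟩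
        η ∎
        where
        open ℕ.≤-Reasoning

      2[1+j]ϵ′≤y : fromℕ (2 ℕ.* suc j) * ϵ′ ≤ y
      2[1+j]ϵ′≤y = begin
        fromℕ (2 ℕ.* suc j) * (ϵ * recip 8) ≤⟨ *-monoʳ-≤ 0≤ϵ′ (fromℕ-mono-≤ (ℕ.≤-trans (ℕ.*-monoʳ-≤ 2 j<4Q) (ℕ.≤-reflexive (sym (ℕ.*-assoc 2 4 Q))))) ⟩
        fromℕ (8 ℕ.* Q) * (ϵ * recip 8) ≡⟨ cong (_* (ϵ * recip 8)) (fromℕ-* 8 Q) ⟩
        fromℕ 8 * fromℕ Q * (ϵ * recip 8) ≡⟨ lemma (fromℕ 8) (fromℕ Q) ϵ (recip 8) ⟩
        fromℕ 8 * recip 8 * y ≡⟨ cong (_* y) (*-recip 8) ⟩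
        1ℚ * y ≡⟨ ℚ.*-identityˡ y ⟩
        y ∎
        where
        open ℚ.≤-Reasoning
        lemma : ∀ a q e r → a * q * (e * r) ≡ a * r * (e * q)
        lemma = ring-solve-∀ ℚ-ring

      s : ℚ
      s = 1ℚ + y
      1≤s : 1ℚ ≤ s
      1≤s = p≤p+q′ {1ℚ} 0≤y
      s≤2 : s ≤ fromℕ 2
      s≤2 = ℚ.+-monoʳ-≤ 1ℚ {y} {1ℚ} y≤1
      stretch : (1ℚ + ϵ′) ^ suc j ≤ s
      stretch = ℚ.≤-trans ([1+ϵ]^j≤ 0≤ϵ′ (suc j) (ℚ.≤-trans 2[1+j]ϵ′≤y y≤1)) (ℚ.+-monoʳ-≤ 1ℚ 2[1+j]ϵ′≤y)

      α≥ : s * (1ℚ + ϵ) ≤ 1ℚ + fromℕ B * y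
      α≥ = begin
        (1ℚ + y) * (1ℚ + ϵ) ≡⟨ ℚ.*-distribˡ-+ (1ℚ + y) 1ℚ ϵ ⟩
        (1ℚ + y) * 1ℚ + (1ℚ + y) * ϵ ≤⟨ ℚ.+-mono-≤ (ℚ.≤-reflexive (ℚ.*-identityʳ (1ℚ + y))) (*-mono-≤ (0≤+ 0≤1 0≤y) s≤2 0≤ϵ ϵ≤y) ⟩
        1ℚ + y + fromℕ 2 * y ≡⟨ ℚ.+-assoc 1ℚ y (fromℕ 2 * y) ⟩
        1ℚ + (y + fromℕ 2 * y) ≡⟨ cong (λ z → 1ℚ + (z + fromℕ 2 * y)) (ℚ.*-identityˡ y) ⟨
        1ℚ + (1ℚ * y + fromℕ 2 * y) ≡⟨ cong (1ℚ +_) (ℚ.*-distribʳ-+ y 1ℚ (fromℕ 2)) ⟨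
        1ℚ + fromℕ 3 * y ≤⟨ ℚ.+-monoʳ-≤ 1ℚ (*-monoʳ-≤ 0≤y (fromℕ-mono-≤ (ℕ.≤-trans (ℕ.≤ᵇ⇒≤ 3 1088 _) (ℕ.m≤n+m 1088 (1056 ℕ.* C))))) ⟩
        1ℚ + fromℕ B * y ∎
        where
        open ℚ.≤-Reasoning
        ϵ≤y : ϵ ≤ y
        ϵ≤y = subst (_≤ y) (ℚ.*-identityʳ ϵ) (*-monoˡ-≤ 0≤ϵ (fromℕ-mono-≤ {1} {Q} (ℕ.*-mono-≤ (ℕ.m^n>0 2 k) (ℕ.m≤n⇒m≤o+n d (s≤s z≤n)))))

      a≥ : ∀ β → fromℕ β ≤ hb → fromℕ β * (fromℕ 8 * (fromℕ (2 ℕ.^ k) * W)) ≤ fromℕ B * (hb * fromℕ (2 ℕ.^ k) * W)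
      a≥ β β≤ = begin
        fromℕ β * (fromℕ 8 * (fromℕ (2 ℕ.^ k) * W)) ≤⟨ *-monoʳ-≤ (0≤* (0≤fromℕ 8) 0≤2^kW) β≤ ⟩
        hb * (fromℕ 8 * (fromℕ (2 ℕ.^ k) * W)) ≡⟨ lemma hb (fromℕ 8) (fromℕ (2 ℕ.^ k)) W ⟩
        fromℕ 8 * (hb * fromℕ (2 ℕ.^ k) * W) ≤⟨ *-monoʳ-≤ (0≤* (0≤* (0≤hopBound C k ϵ) (0≤fromℕ (2 ℕ.^ k))) (0≤W-max G)) (fromℕ-mono-≤ (ℕ.≤-trans (ℕ.≤ᵇ⇒≤ 8 1088 _) (ℕ.m≤n+m 1088 (1056 ℕ.* C)))) ⟩
        fromℕ B * (hb * fromℕ (2 ℕ.^ k) * W) ∎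
        where
        open ℚ.≤-Reasoning
        0≤2^kW : 0ℚ ≤ fromℕ (2 ℕ.^ k) * W
        0≤2^kW = 0≤* (0≤fromℕ (2 ℕ.^ k)) (0≤W-max G)
        lemma : ∀ h a p w → h * (a * (p * w)) ≡ a * (h * p * w)
        lemma = ring-solve-∀ ℚ-ring

      η≤2log : η ℕ.≤ 2 ℕ.* ⌈log₂ n ⌉
      η≤2log = ℕ.≤-trans (ℕ.+-mono-≤ 1≤ ≤log) (ℕ.≤-reflexive (cong (⌈log₂ n ⌉ ℕ.+_) (sym (ℕ.+-identityʳ ⌈log₂ n ⌉))))
        where
        ≤log : ⌊log₂ n ⌋ ℕ.≤ ⌈log₂ n ⌉
        ≤log = subst (ℕ._≤ ⌈log₂ n ⌉) (⌈log₂2^n⌉≡n ⌊log₂ n ⌋) (⌈log₂⌉-mono-≤ (2^⌊log₂n⌋≤n n {{ℕ.>-nonZero 1≤n}}))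
        1≤ : 1 ℕ.≤ ⌈log₂ n ⌉
        1≤ = ℕ.≤-trans (ℕ.≤-trans (ℕ.m^n>0 2 ll) (2^⌊log₂n⌋≤n ⌊log₂ n ⌋ {{log-nonZero ⌊log₂ n ⌋ 1≤ll}})) ≤log

      -- All logarithmic factors are collected as a power of L, with j ≤ 4η ≤ 8L. The hop bound M of
      -- the levels becomes one factor `hb₁`, and R is at most 2r since r ≥ n ≥ 1.
      few : ∀ L M R → 1 ℕ.≤ L → η ℕ.≤ 2 ℕ.* L → fromℕ M ≤ hopBound C k ϵ′ + 1ℚ →
        ∀ h p l → l ℕ.≤ (h ℕ.+ p) ℕ.* ((M ℕ.+ 2) ℕ.* (4 ℕ.* η ℕ.* 1)) ℕ.+ j ℕ.* (2 ℕ.* (C ℕ.* R) ℕ.* ((M ℕ.+ 2) ℕ.* (4 ℕ.* η))) →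
        ∀ r → fromℕ n ≤ r → fromℕ R ≤ r + 1ℚ → fromℕ h ≤ fromℕ C * r → fromℕ p ≤ fromℕ (starCost n) * r →
        fromℕ l ≤ fromℕ (B ℕ.* L ℕ.^ B) * (r * hb₁ ^ 2)
      few L M R 1≤L η≤ M≤ h p l l≤ r n≤r R≤ h≤ p≤ = begin
        fromℕ l
          ≤⟨ fromℕ-mono-≤ (ℕ.≤-trans l≤ (ℕ.≤-trans (ℕ.+-monoʳ-≤ _ (ℕ.*-monoˡ-≤ _ j≤4η)) (ℕ.≤-reflexive (lemma₁ h p (M ℕ.+ 2) η C R)))) ⟩
        fromℕ (Z ℕ.* X)
          ≡⟨ fromℕ-* Z X ⟩
        fromℕ Z * fromℕ X
          ≤⟨ *-mono-≤ (0≤fromℕ Z) Mη≤ (0≤fromℕ X) pairs≤ ⟩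
        hb₁ * fromℕ (16 ℕ.* η) * (fromℕ F * r)
          ≡⟨ lemma₂ hb₁ (fromℕ (16 ℕ.* η)) (fromℕ F) r ⟩
        fromℕ (16 ℕ.* η) * fromℕ F * (r * hb₁)
          ≡⟨ cong (_* (r * hb₁)) (fromℕ-* (16 ℕ.* η) F) ⟨
        fromℕ (16 ℕ.* η ℕ.* F) * (r * hb₁)
          ≤⟨ *-mono-≤ (0≤fromℕ (16 ℕ.* η ℕ.* F)) (fromℕ-mono-≤ polylog) (0≤* 0≤r 0≤hb₁)
               (*-monoˡ-≤ 0≤r hb₁≤hb₁²) ⟩
        fromℕ (B ℕ.* L ℕ.^ B) * (r * hb₁ ^ 2) ∎
        where
        open ℚ.≤-Reasoning
        F = C ℕ.+ starCost n ℕ.+ 16 ℕ.* η ℕ.* C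
        X = h ℕ.+ p ℕ.+ 8 ℕ.* η ℕ.* C ℕ.* R
        Z = (M ℕ.+ 2) ℕ.* (4 ℕ.* η)
        0≤r : 0ℚ ≤ r
        0≤r = ℚ.≤-trans (0≤fromℕ n) n≤r
        1≤r : 1ℚ ≤ r
        1≤r = ℚ.≤-trans (fromℕ-mono-≤ 1≤n) n≤r
        0≤hb₁ : 0ℚ ≤ hb₁
        0≤hb₁ = 0≤hopBound b k ϵ
        1≤hb₁ : 1ℚ ≤ hb₁
        1≤hb₁ = 1≤hopBound b k ϵ ϵ<1 (ℕ.m≤n⇒m≤o+n (8 ℕ.* C) (s≤s z≤n)) 1≤k
        hb₁≤hb₁² : hb₁ ≤ hb₁ ^ 2
        hb₁≤hb₁² = subst₂ _≤_ (ℚ.*-identityʳ hb₁) (cong (hb₁ *_) (sym (ℚ.*-identityʳ hb₁))) (*-monoˡ-≤ 0≤hb₁ 1≤hb₁)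
        j≤4η : j ℕ.≤ 4 ℕ.* η
        j≤4η = ℕ.≤-trans (ℕ.n≤1+n j) (ℕ.≤-trans j<4Q (ℕ.*-monoʳ-≤ 4 Q≤η))
        lemma₁ : ∀ h p M η C R → (h ℕ.+ p) ℕ.* (M ℕ.* (4 ℕ.* η ℕ.* 1)) ℕ.+ 4 ℕ.* η ℕ.* (2 ℕ.* (C ℕ.* R) ℕ.* (M ℕ.* (4 ℕ.* η)))
          ≡ M ℕ.* (4 ℕ.* η) ℕ.* (h ℕ.+ p ℕ.+ 8 ℕ.* η ℕ.* C ℕ.* R)
        lemma₁ = solve-∀
        lemma₂ : ∀ h a c r → h * a * (c * r) ≡ a * c * (r * h)
        lemma₂ = ring-solve-∀ ℚ-ring
        M+2≤ : fromℕ (M ℕ.+ 2) ≤ hb₁ * fromℕ 4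
        M+2≤ = begin
          fromℕ (M ℕ.+ 2) ≡⟨ fromℕ-+ M 2 ⟩
          fromℕ M + fromℕ 2 ≤⟨ ℚ.+-monoˡ-≤ (fromℕ 2) M≤ ⟩
          hopBound C k ϵ′ + 1ℚ + fromℕ 2 ≡⟨ ℚ.+-assoc (hopBound C k ϵ′) 1ℚ (fromℕ 2) ⟩
          hopBound C k ϵ′ + fromℕ 3 ≤⟨ ℚ.+-mono-≤ (ℚ.≤-trans (ℚ.≤-reflexive (hopBound-fraction C k ϵ 8)) (hopBound-mono k ϵ (ℕ.m≤m+n (8 ℕ.* C) 2)))
                (subst (_≤ hb₁ * fromℕ 3) (ℚ.*-identityˡ (fromℕ 3)) (*-monoʳ-≤ (0≤fromℕ 3) 1≤hb₁)) ⟩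
          hb₁ + hb₁ * fromℕ 3 ≡⟨ cong (_+ hb₁ * fromℕ 3) (ℚ.*-identityʳ hb₁) ⟨
          hb₁ * 1ℚ + hb₁ * fromℕ 3 ≡⟨ ℚ.*-distribˡ-+ hb₁ 1ℚ (fromℕ 3) ⟨
          hb₁ * fromℕ 4 ∎
        Mη≤ : fromℕ ((M ℕ.+ 2) ℕ.* (4 ℕ.* η)) ≤ hb₁ * fromℕ (16 ℕ.* η)
        Mη≤ = begin
          fromℕ ((M ℕ.+ 2) ℕ.* (4 ℕ.* η)) ≡⟨ fromℕ-* (M ℕ.+ 2) (4 ℕ.* η) ⟩
          fromℕ (M ℕ.+ 2) * fromℕ (4 ℕ.* η) ≤⟨ *-monoʳ-≤ (0≤fromℕ (4 ℕ.* η)) M+2≤ ⟩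
          hb₁ * fromℕ 4 * fromℕ (4 ℕ.* η) ≡⟨ ℚ.*-assoc hb₁ (fromℕ 4) (fromℕ (4 ℕ.* η)) ⟩
          hb₁ * (fromℕ 4 * fromℕ (4 ℕ.* η)) ≡⟨ cong (hb₁ *_) (trans (sym (fromℕ-* 4 (4 ℕ.* η))) (cong fromℕ (sym (ℕ.*-assoc 4 4 η)))) ⟩
          hb₁ * fromℕ (16 ℕ.* η) ∎
        R≤2r : fromℕ R ≤ fromℕ 2 * r
        R≤2r = ℚ.≤-trans R≤ (ℚ.≤-trans (ℚ.+-monoʳ-≤ r 1≤r) (ℚ.≤-reflexive (sym (2* r))))
        pairs≤ : fromℕ (h ℕ.+ p ℕ.+ 8 ℕ.* η ℕ.* C ℕ.* R) ≤ fromℕ (C ℕ.+ starCost n ℕ.+ 16 ℕ.* η ℕ.* C) * r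
        pairs≤ = begin
          fromℕ (h ℕ.+ p ℕ.+ e ℕ.* R) ≡⟨ trans (fromℕ-+ (h ℕ.+ p) (e ℕ.* R)) (cong₂ _+_ (fromℕ-+ h p) (fromℕ-* e R)) ⟩
          fromℕ h + fromℕ p + fromℕ e * fromℕ R ≤⟨ ℚ.+-mono-≤ (ℚ.+-mono-≤ h≤ p≤) (*-monoˡ-≤ (0≤fromℕ e) R≤2r) ⟩
          fromℕ C * r + fromℕ (starCost n) * r + fromℕ e * (fromℕ 2 * r) ≡⟨ lemma (fromℕ C) (fromℕ (starCost n)) (fromℕ e) (fromℕ 2) r ⟩
          (fromℕ C + fromℕ (starCost n) + fromℕ 2 * fromℕ e) * r ≡⟨ cong (_* r) (trans (cong₂ _+_ (sym (fromℕ-+ C (starCost n))) (sym (fromℕ-* 2 e))) (sym (fromℕ-+ (C ℕ.+ starCost n) (2 ℕ.* e)))) ⟩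
          fromℕ (C ℕ.+ starCost n ℕ.+ 2 ℕ.* e) * r ≡⟨ cong (λ z → fromℕ (C ℕ.+ starCost n ℕ.+ z) * r) (lemma′ η C) ⟩
          fromℕ (C ℕ.+ starCost n ℕ.+ 16 ℕ.* η ℕ.* C) * r ∎
          where
          e = 8 ℕ.* η ℕ.* C
          lemma : ∀ c s e t r → c * r + s * r + e * (t * r) ≡ (c + s + t * e) * r
          lemma = ring-solve-∀ ℚ-ring
          lemma′ : ∀ η C → 2 ℕ.* (8 ℕ.* η ℕ.* C) ≡ 16 ℕ.* η ℕ.* C
          lemma′ = solve-∀
        polylog : 16 ℕ.* η ℕ.* (C ℕ.+ starCost n ℕ.+ 16 ℕ.* η ℕ.* C) ℕ.≤ B ℕ.* L ℕ.^ B
        polylog = bounded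
          where
          module N = ℕ.≤-Reasoning
          3≤B : 3 ℕ.≤ B
          3≤B = ℕ.≤-trans (ℕ.≤ᵇ⇒≤ 3 1088 _) (ℕ.m≤n+m 1088 (1056 ℕ.* C))
          x = 2 ℕ.* L
          L≤ : 1 ℕ.≤ L ℕ.* L
          L≤ = ℕ.*-mono-≤ 1≤L 1≤L
          expand : ∀ L C → 16 ℕ.* (2 ℕ.* L) ℕ.* (C ℕ.* (L ℕ.* L) ℕ.+ 2 ℕ.* L ℕ.* (8 ℕ.* (2 ℕ.* L) ℕ.+ L) ℕ.+ 16 ℕ.* (2 ℕ.* L) ℕ.* C ℕ.* L)
            ≡ (1056 ℕ.* C ℕ.+ 1088) ℕ.* (L ℕ.* (L ℕ.* (L ℕ.* 1)))
          expand = solve-∀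
          bounded : 16 ℕ.* η ℕ.* (C ℕ.+ η ℕ.* (8 ℕ.* η ℕ.+ 1) ℕ.+ 16 ℕ.* η ℕ.* C) ℕ.≤ B ℕ.* L ℕ.^ B
          bounded = N.begin
            16 ℕ.* η ℕ.* (C ℕ.+ η ℕ.* (8 ℕ.* η ℕ.+ 1) ℕ.+ 16 ℕ.* η ℕ.* C)
              N.≤⟨ ℕ.*-mono-≤ (ℕ.*-monoʳ-≤ 16 η≤) (ℕ.+-mono-≤ (ℕ.+-mono-≤ (ℕ.m≤m*n C (L ℕ.* L) {{ℕ.>-nonZero L≤}}) (ℕ.*-mono-≤ η≤ (ℕ.+-mono-≤ (ℕ.*-monoʳ-≤ 8 η≤) 1≤L)))
                     (ℕ.≤-trans (ℕ.*-monoˡ-≤ C (ℕ.*-monoʳ-≤ 16 η≤)) (ℕ.m≤m*n (16 ℕ.* x ℕ.* C) L {{ℕ.>-nonZero 1≤L}}))) ⟩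
            16 ℕ.* x ℕ.* (C ℕ.* (L ℕ.* L) ℕ.+ x ℕ.* (8 ℕ.* x ℕ.+ L) ℕ.+ 16 ℕ.* x ℕ.* C ℕ.* L)
              N.≡⟨ expand L C ⟩
            B ℕ.* L ℕ.^ 3
              N.≤⟨ ℕ.*-monoʳ-≤ B (ℕ.^-monoʳ-≤ L {{ℕ.>-nonZero 1≤L}} 3≤B) ⟩
            B ℕ.* L ℕ.^ B N.∎

    uniformSpanner : ∃[ G′ ]
      IsSpanner (1ℚ + fromℕ B * y) (fromℕ B * (hb * fromℕ (2 ℕ.^ k) * W)) G G′ ×
      (∀ r → fromℕ n ^[1+1/ K ]≤ r → fromℕ (#edges G′) ≤ fromℕ (B ℕ.* ⌈log₂ n ⌉ ℕ.^ B) * (r * hb₁ ^ 2))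
    uniformSpanner = build (guarantee G k 1≤k ϵ ϵ<1) (ceil (hopBound C k ϵ′) (0≤hopBound C k ϵ′)) (ceilRoot (n ℕ.^ suc K) K (1≤2^1+k∸1 k))
      where
      build : (∃[ β ] ∃[ H ] IsHopset β ϵ G H × fromℕ β ≤ hb × (∀ r → fromℕ n ^[1+1/ K ]≤ r → fromℕ (#edges H) ≤ fromℕ C * r)) →
        (∃[ M ] hopBound C k ϵ′ ≤ fromℕ M × fromℕ M ≤ hopBound C k ϵ′ + 1ℚ) →
        (∃[ R ] n ℕ.^ suc K ℕ.≤ R ℕ.^ K × (∀ r → 0ℚ ≤ r → fromℕ (n ℕ.^ suc K) ≤ r ^ K → fromℕ R ≤ r + 1ℚ)) →
        ∃[ G′ ] IsSpanner (1ℚ + fromℕ B * y) (fromℕ B * (hb * fromℕ (2 ℕ.^ k) * W)) G G′ ×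
          (∀ r → fromℕ n ^[1+1/ K ]≤ r → fromℕ (#edges G′) ≤ fromℕ (B ℕ.* ⌈log₂ n ⌉ ℕ.^ B) * (r * hb₁ ^ 2))
      build (β , H , hopset , β≤ , H-size) (M , ≤M , M≤) (R , R-bound , R≤) =
        let sp = spanningPairs G (allFin n) (Unique.allFin⁺ n) K (1≤2^1+k∸1 k)
            L , L-size , pres = preserve j 0 (enough-levels n k k≤ll) (spannerPairs H sp)
        in restrict G L ,
           spanner G H k 0≤ϵ hopset 1≤s s≤2 sp (Preserves-≤ G stretch pres) α≥ (a≥ β β≤) ,
           λ r bound → ℚ.≤-trans (fromℕ-mono-≤ (#edges-restrict G L))
             (few ⌈log₂ n ⌉ M R 1≤log η≤2log M≤ (length (edgePairs H)) (length (SpanningPairs.pairs sp)) (length L)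
               (subst (λ l → length L ℕ.≤ l ℕ.* pairCost 0 ℕ.+ j ℕ.* levelCost) (length-++ (edgePairs H)) L-size) r
               (size≤root n K (1≤2^1+k∸1 k) bound)
               (R≤ r (proj₁ bound) (subst (_≤ r ^ K) (sym (fromℕ-^ n (suc K))) (proj₂ bound)))
               (subst (λ h → fromℕ h ≤ fromℕ C * r) (sym (length-edgePairs H)) (H-size r bound))
               (SpanningPairs.size sp r (allFin-root n K bound)))
        where
        open Preserver guarantee G η (n<2^logSize n) k 1≤k ϵ′ ϵ′<1 M (λ β β≤ → fromℕ-cancel-≤ (ℚ.≤-trans β≤ ≤M)) R R-bound
        1≤log : 1 ℕ.≤ ⌈log₂ n ⌉
        1≤log = ℕ.*-cancelˡ-< 2 0 ⌈log₂ n ⌉ (ℕ.<-≤-trans (s≤s z≤n) η≤2log)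

-- Sourcewise spanners for subsets, and the four claims together

module SubsetSpanner {C : ℕ} (guarantee : HopsetGuarantee C) where

  open Sourcewise guarantee

  subsetSpanner : ∀ ϵ → 0ℚ < ϵ → ∃[ a ] ∀ {n} (G : Graph n) k → 1 ℕ.≤ k → ∀ (S : Subset n) →
    ∃[ G′ ] IsSourcewiseSpanner S (fromℕ (4 ℕ.* k) - 1ℚ + ϵ) G G′ ×
      (∀ r → fromℕ ∣ S ∣ ^[1+1/ k ]≤ r → fromℕ (#edges G′) ≤ fromℕ (growth a n) * (fromℕ n + r))
  subsetSpanner ϵ 0<ϵ = let a , spanners = sourcewise ϵ 0<ϵ in a , λ {n} G k 1≤k S →
    let L , size , spans = spanners G k 1≤k (elements S) (elements-unique S)
    in restrict G L ,
       (restrict-⊆ G L , λ s v s∈S → distBound G (restrict G L) ((fromℕ (4 ℕ.* k) - 1ℚ + ϵ) *_) (spans (elements⁺ s∈S))) ,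
       λ r bound → ℚ.≤-trans (fromℕ-mono-≤ (#edges-restrict G L))
         (size r (subst (λ m → fromℕ m ^[1+1/ k ]≤ r) (sym (length-elements S)) bound))

theorem1p6 : ∀ (C c : ℕ) → HopsetGuarantee C →
  -- (1), for fixed k and ϵ
  (∃[ B ] ∀ k → 1 ℕ.≤ k → ∀ ϵ .{{_ : Positive ϵ}} → ϵ < 1ℚ →
    ∃[ g ] Subpolynomial g ×
      (∀ {n} (G : Graph n) → PolynomialWeights c G →
        ∃[ G′ ] IsSpanner (1ℚ + ϵ) (hopBound B k ϵ * W-max G * fromℕ ⌈log₂ n ⌉) G G′ ×
          (∀ r → fromℕ n ^[1+1/ 2 ℕ.^ suc k ℕ.∸ 1 ]≤ r →
            fromℕ (#edges G′) ≤ fromℕ (g n) * r)))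
  ×
  -- (1), in its precise form, uniformly in k and ϵ
  (∃[ B ] ∃[ b ] 1 ℕ.< b ×
    (∀ {n} (G : Graph n) → PolynomialWeights c G →
      ∀ k → 1 ℕ.≤ k → k ℕ.≤ ⌊log₂ ⌊log₂ n ⌋ ⌋ →
      ∀ ϵ .{{_ : Positive ϵ}} → ϵ < 1ℚ →
      ϵ * fromℕ (2 ℕ.^ k ℕ.* (⌊log₂ ⌊log₂ n ⌋ ⌋ ℕ.∸ k ℕ.+ 1)) ≤ 1ℚ →
      ∃[ G′ ]
        IsSpanner
          (1ℚ + fromℕ B * (ϵ * fromℕ (2 ℕ.^ k ℕ.* (⌊log₂ ⌊log₂ n ⌋ ⌋ ℕ.∸ k ℕ.+ 1))))
          (fromℕ B * (hopBound C k ϵ * fromℕ (2 ℕ.^ k) * W-max G))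
          G G′ ×
        (∀ r → fromℕ n ^[1+1/ 2 ℕ.^ suc k ℕ.∸ 1 ]≤ r →
          fromℕ (#edges G′)
            ≤ fromℕ (B ℕ.* ⌈log₂ n ⌉ ℕ.^ B) * (r * (hopBound b k ϵ) ^ 2))))
  ×
  -- (2)
  (∀ ϵ → 0ℚ < ϵ →
    ∃[ g ] Subpolynomial g ×
      (∀ {n} (G : Graph n) → PolynomialWeights c G →
        ∀ k → 1 ℕ.≤ k → ∀ (S : Subset n) →
        ∃[ G′ ] IsSourcewiseSpanner S (fromℕ (4 ℕ.* k) - 1ℚ + ϵ) G G′ ×
          (∀ r → fromℕ ∣ S ∣ ^[1+1/ k ]≤ r →
            fromℕ (#edges G′) ≤ fromℕ (g n) * (fromℕ n + r))))
  ×
  -- (3), with slack parameter ϵ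
  (∃[ g ] ∃[ η ] Subpolynomial g × Vanishing η ×
    (∀ {n} (G : Graph n) → PolynomialWeights c G →
      ∀ ϵ .{{_ : Positive ϵ}} → ϵ < 1ℚ → ∀ k → 1 ℕ.≤ k →
      ∃[ G′ ] IsSlackSpanner ϵ (fromℕ (12 ℕ.* k) - 1ℚ + η n) G G′ ×
        (∀ r → (1/ ϵ) {{pos⇒nonZero ϵ}} ^[1+1/ k ]≤ r →
          fromℕ (#edges G′) ≤ fromℕ (g n) * (fromℕ n + r))))
theorem1p6 C c guarantee =
  (64 ℕ.* C , λ k 1≤k ϵ ϵ<1 →
    let a , spanners = FixedSpanner.fixedSpanner guarantee k 1≤k ϵ ϵ<1
    in growth a , growth-subpolynomial a , λ G _ → spanners G) ,
  (UniformSpanner.B guarantee , UniformSpanner.b guarantee , ℕ.m≤n+m 2 (8 ℕ.* C) ,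
    λ G _ k 1≤k k≤ll ϵ ϵ<1 small → UniformSpanner.uniformSpanner guarantee G k 1≤k k≤ll ϵ ϵ<1 small) ,
  (λ ϵ 0<ϵ →
    let a , spanners = SubsetSpanner.subsetSpanner guarantee ϵ 0<ϵ
    in growth a , growth-subpolynomial a , λ G _ → spanners G) ,
  (let a , spanners = Slack.slack guarantee
   in growth a , (λ _ → 0ℚ) , growth-subpolynomial a ,
      (λ _ 0<δ → 0 , λ _ _ → ℚ.<⇒≤ 0<δ) ,
      λ G _ ϵ ϵ<1 k 1≤k → spanners G ϵ ϵ<1 k 1≤k)
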